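{- Let $A$ be a degenerate–resonant combinatorial graph. Then there is a vertex $g$ of $A$ such that the translated combinatorial graph $Ag^{ -1}=\{hg^{ -1}: h\in A\}$ is not allowable. Consequently, if $S=(\mathtt v_1,\dots,\mathtt v_m)\in(\mathbb R^n)^m$ satisfies $(\mathtt v_i,\mathtt v_j)\neq 0$ for all $i,j$ and $(\mathtt v_a-\mathtt v_b,\mathtt v_a-\mathtt v_c)\ne 0$ for all pairwise distinct $a,b,c$, then $A$ has no realization $x\in\mathbb R^n\setminus\{\mathtt v_1,\dots,\mathtt v_m\}$.
   Context: Let $e_1,\dots,e_m$ be the standard basis of $\mathbb Z^m$ and $\eta(a)=\sum_i a_i$ for $a=\sum_i a_ie_i$. Let $G_2$ be the group of pairs $(a,\sigma)$ with $a\in\mathbb Z^m$, $\sigma\in\{1,-1\}$ and $\eta(a)=\sigma-1$ (so $\eta(a)=0$ for $\sigma=1$, "black", and $\eta(a)=-2$ for $\sigma=-1$, "red"), with product $(b,\rho)(a,\sigma)=(b+\rho a,\rho\sigma)$ and identity $0=(0,1)$; since $\sigma$ is determined by $a$ we identify $(a,\sigma)$ with $a$. Let $X=\{(e_i-e_j,1):i\ne j\}\cup\{(-e_i-e_j,-1):i\neq j\}$. The Cayley graph on $G_2$ joins $g$ and $\ell g$ for $\ell\in X$. A combinatorial graph is a finite subset $A\subset G_2$ containing $0$, together with all Cayley-graph edges between its elements, assumed connected. Its rank is the rank of the subgroup of $\mathbb Z^m$ generated by its vertices; $A$ is degenerate if its rank is smaller than the number of its vertices different from $0$. In $\mathbb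 Q[t_1,\dots,t_m]$ set, for $g=(a,\sigma)$, $C(g)=\frac{\sigma}{2}\big((\sum_i a_it_i)^2+\sum_i a_it_i^2\big)$. $A$ is degenerate–resonant if it is degenerate and for every relation $\sum_k n_k a_k=0$ ($n_k\in\mathbb Z$) among its vertices $a_k\neq 0$ one has $\sum_k n_kC(a_k)=0$. $A$ is allowable if none of its vertices equals $-2e_i$ or $-3e_i+e_j$ ($i\ne j$). Given $S=(\mathtt v_1,\dots,\mathtt v_m)$, $\mathtt v_i\in\mathbb R^n$, let $\pi(a)=\sum_ia_i\mathtt v_i$ and $K(a,\sigma)=\frac{\sigma}{2}\big(|\pi(a)|^2+\sum_ia_i|\mathtt v_i|^2\big)$. A point $x\in\mathbb R^n$ is a realization of $A$ if for every vertex $g=(a,\sigma)$ of $A$: $(x,\pi(a))=K(g)$ when $\sigma=1$, and $|x|^2+(x,\pi(a))=K(g)$ when $\sigma=-1$. -}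

module Defs where

open import Level using (0ℓ)
open import Data.Nat as ℕ using (ℕ; zero; suc)
open import Data.Integer as ℤ using (ℤ; +_; -[1+_])
open import Data.Rational as ℚ using (ℚ; ½)
open import Data.Fin as Fin using (Fin)
open import Data.Vec as Vec using (Vec; []; _∷_; zipWith; foldr; replicate; lookup; _[_]≔_; fromList)
open import Data.Vec.Properties using (≡-dec)
open import Data.Vec.Relation.Unary.All as VAll using ()
open import Data.List as List using (List; filter; length; map)
open import Data.List.Membership.Propositional using (_∈_)
open import Data.List.Relation.Unary.All as LAll using ()
open import Data.List.Relation.Unary.Unique.Propositional using (Unique)
open import Data.Product using (Σ; ∃; ∃-syntax; _×_; _,_)
open import Data.Sum using (_⊎_)
open import Relation.Nullary using (¬_; yes; no)
open import Relation.Nullary.Decidable using (¬?)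
open import Relation.Binary.PropositionalEquality using (_≡_; _≢_)
open import Relation.Binary.Definitions using (DecidableEquality)
open import Algebra.Structures using (IsCommutativeRing)
open import Relation.Binary.Structures using (IsTotalOrder)
open import Relation.Binary.Core using (Rel)

Zm : ℕ → Set
Zm m = Vec ℤ m

_≟v_ : ∀ {m} → DecidableEquality (Zm m)
_≟v_ = ≡-dec ℤ._≟_

0v : ∀ {m} → Zm m
0v {m} = replicate m (+ 0)

_+v_ : ∀ {m} → Zm m → Zm m → Zm m
_+v_ = zipWith ℤ._+_

_·v_ : ∀ {m} → ℤ → Zm m → Zm m
c ·v a = Vec.map (c ℤ.*_) a

-v_ : ∀ {m} → Zm m → Zm m
-v a = Vec.map ℤ.-_ a

e : ∀ {m} → Fin m → Zm m
e {m} i = replicate m (+ 0) [ i ]≔ (+ 1)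

η : ∀ {m} → Zm m → ℤ
η = foldr _ ℤ._+_ (+ 0)

combo : ∀ {m k} → Vec ℤ k → Vec (Zm m) k → Zm m
combo c ws = foldr _ _+v_ 0v (zipWith _·v_ c ws)

-- The group G₂.  An element (a,σ) is identified with a ∈ ℤ^m, subject to
-- η(a) = σ - 1, i.e. η(a) = 0 (σ = 1, black) or η(a) = -2 (σ = -1, red).

InG2 : ∀ {m} → Zm m → Set
InG2 a = η a ≡ + 0 ⊎ η a ≡ ℤ.- (+ 2)

σ : ∀ {m} → Zm m → ℤ
σ a with η a ℤ.≟ + 0
... | yes _ = + 1
... | no  _ = ℤ.- (+ 1)

-- product (b,ρ)(a,σ) = (b + ρ a, ρ σ)
_⊙_ : ∀ {m} → Zm m → Zm m → Zm m
b ⊙ a = b +v (σ b ·v a)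

inv : ∀ {m} → Zm m → Zm m
inv a = (ℤ.- σ a) ·v a

InX : ∀ {m} → Zm m → Set
InX {m} ℓ = ∃[ i ] ∃[ j ] (i ≢ j × (ℓ ≡ e i +v (-v e j) ⊎ ℓ ≡ (-v e i) +v (-v e j)))

Edge : ∀ {m} → Zm m → Zm m → Set
Edge g h = ∃[ ℓ ] (InX ℓ × h ≡ ℓ ⊙ g)

Adjacent : ∀ {m} → Zm m → Zm m → Set
Adjacent g h = Edge g h ⊎ Edge h g

data Reach {m} (A : List (Zm m)) : Zm m → Set where
  here : Reach A 0v
  step : ∀ {g h} → Reach A g → h ∈ A → Adjacent g h → Reach A h

record CombGraph {m} (A : List (Zm m)) : Set where
  field
    unique    : Unique A
    inG2      : LAll.All InG2 A
    has0      : 0v ∈ A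
    connected : ∀ {h} → h ∈ A → Reach A h

nonzero : ∀ {m} → List (Zm m) → List (Zm m)
nonzero = filter (λ a → ¬? (a ≟v 0v))

InSpan : ∀ {m} → List (Zm m) → Zm m → Set
InSpan A w = ∃[ c ] (combo c (fromList A) ≡ w)

LinIndep : ∀ {m r} → Vec (Zm m) r → Set
LinIndep {r = r} ws = ∀ (c : Vec ℤ r) → combo c ws ≡ 0v → c ≡ replicate r (+ 0)

HasRank : ∀ {m} → List (Zm m) → ℕ → Set
HasRank A r =
  (∃[ ws ] (VAll.All (InSpan A) {n = r} ws × LinIndep ws)) ×
  (∀ (ws : Vec _ (suc r)) → VAll.All (InSpan A) ws → ¬ LinIndep ws)

Degenerate : ∀ {m} → List (Zm m) → Set
Degenerate A = ∃[ r ] (HasRank A r × r ℕ.< length (nonzero A))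

-- C(g) = σ/2 ((Σ a_i t_i)² + Σ a_i t_i²) ∈ ℚ[t_1..t_m], a homogeneous
-- quadratic polynomial, represented by its coefficients: Ccoef a i j is
-- the coefficient of the monomial t_i t_j (for i ≠ j the monomial
-- t_i t_j = t_j t_i, so the coefficient is symmetric in i,j).

ℤ→ℚ : ℤ → ℚ
ℤ→ℚ z = z ℚ./ 1

-- coefficient of t_i t_j in (Σ a_k t_k)²
sqCoef : ∀ {m} → Zm m → Fin m → Fin m → ℤ
sqCoef a i j with i Fin.≟ j
... | yes _ = lookup a i ℤ.* lookup a i
... | no  _ = + 2 ℤ.* (lookup a i ℤ.* lookup a j)

-- coefficient of t_i t_j in Σ a_k t_k²
diagCoef : ∀ {m} → Zm m → Fin m → Fin m → ℤ
diagCoef a i j with i Fin.≟ j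
... | yes _ = lookup a i
... | no  _ = + 0

Ccoef : ∀ {m} → Zm m → Fin m → Fin m → ℚ
Ccoef a i j = ℤ→ℚ (σ a) ℚ.* (½ ℚ.* ℤ→ℚ (sqCoef a i j ℤ.+ diagCoef a i j))

CRelZero : ∀ {m k} → Vec ℤ k → Vec (Zm m) k → Set
CRelZero n as = ∀ i j →
  foldr _ ℚ._+_ ℚ.0ℚ (zipWith (λ nk a → ℤ→ℚ nk ℚ.* Ccoef a i j) n as) ≡ ℚ.0ℚ

DegenerateResonant : ∀ {m} → List (Zm m) → Set
DegenerateResonant A =
  Degenerate A ×
  (∀ (n : Vec ℤ (length (nonzero A))) →
     combo n (fromList (nonzero A)) ≡ 0v → CRelZero n (fromList (nonzero A)))

Forbidden : ∀ {m} → Zm m → Set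
Forbidden a = ∃[ i ] (a ≡ (+ 2) ·v (-v e i)
                      ⊎ ∃[ j ] (i ≢ j × a ≡ ((+ 3) ·v (-v e i)) +v e j))

Allowable : ∀ {m} → List (Zm m) → Set
Allowable A = ∀ {a} → a ∈ A → ¬ Forbidden a

translate : ∀ {m} → List (Zm m) → Zm m → List (Zm m)
translate A g = map (λ h → h ⊙ inv g) A

record RealField : Set₁ where
  infixl 6 _+_
  infixl 7 _*_
  infix 4 _≤_
  field
    Carrier : Set
    _+_ _*_ : Carrier → Carrier → Carrier
    -_      : Carrier → Carrier
    0# 1#   : Carrier
    _⁻¹     : Carrier → Carrier
    _≤_     : Carrier → Carrier → Set
    isCommutativeRing : IsCommutativeRing _≡_ _+_ _*_ -_ 0# 1#
    0≢1     : 0# ≢ 1#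
    inverse : ∀ x → x ≢ 0# → x * (x ⁻¹) ≡ 1#
    isTotalOrder : IsTotalOrder _≡_ _≤_
    +-mono-≤ : ∀ {x y} z → x ≤ y → x + z ≤ y + z
    *-nonneg : ∀ {x y} → 0# ≤ x → 0# ≤ y → 0# ≤ x * y
    sup : ∀ (P : Carrier → Set) → ∃ P → (∃[ b ] (∀ x → P x → x ≤ b)) →
          ∃[ s ] ((∀ x → P x → x ≤ s) × (∀ b → (∀ x → P x → x ≤ b) → s ≤ b))

module RealOps (R : RealField) where
  open RealField R

  ιℕ : ℕ → Carrier
  ιℕ zero = 0#
  ιℕ (suc n) = 1# + ιℕ n

  ι : ℤ → Carrier
  ι (+ n) = ιℕ n
  ι -[1+ n ] = - ιℕ (suc n)

  half : Carrier
  half = (1# + 1#) ⁻¹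

  _⊕_ : ∀ {n} → Vec Carrier n → Vec Carrier n → Vec Carrier n
  _⊕_ = zipWith _+_

  _⊛_ : ∀ {n} → Carrier → Vec Carrier n → Vec Carrier n
  c ⊛ v = Vec.map (c *_) v

  _⊖_ : ∀ {n} → Vec Carrier n → Vec Carrier n → Vec Carrier n
  u ⊖ v = u ⊕ ((- 1#) ⊛ v)

  zeroV : ∀ {n} → Vec Carrier n
  zeroV {n} = replicate n 0#

  ⟪_,_⟫ : ∀ {n} → Vec Carrier n → Vec Carrier n → Carrier
  ⟪ u , v ⟫ = foldr _ _+_ 0# (zipWith _*_ u v)

  module _ {n m : ℕ} (vs : Vec (Vec Carrier n) m) where
    π : Zm m → Vec Carrier n
    π a = foldr _ _⊕_ zeroV (zipWith (λ ai v → ι ai ⊛ v) a vs)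

    K : Zm m → Carrier
    K a = ι (σ a) * (half * (⟪ π a , π a ⟫ +
            foldr _ _+_ 0# (zipWith (λ ai v → ι ai * ⟪ v , v ⟫) a vs)))

    RealizesVertex : Vec Carrier n → Zm m → Set
    RealizesVertex x a with η a ℤ.≟ + 0
    ... | yes _ = ⟪ x , π a ⟫ ≡ K a
    ... | no  _ = ⟪ x , x ⟫ + ⟪ x , π a ⟫ ≡ K a

    Realization : List (Zm m) → Vec Carrier n → Set
    Realization A x = ∀ {a} → a ∈ A → RealizesVertex x a

    Generic1 : Set
    Generic1 = ∀ i j → ⟪ lookup vs i , lookup vs j ⟫ ≢ 0#

    Generic2 : Set
    Generic2 = ∀ a b c → a ≢ b → a ≢ c → b ≢ c →
      ⟪ lookup vs a ⊖ lookup vs b , lookup vs a ⊖ lookup vs c ⟫ ≢ 0#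

module Submission where

-- Replace a vertex a by σ(a) a.  Cayley edges become differences by roots
-- ± e_i ± e_j, and the entries of Σ n_k C(a_k) off the diagonal become those of
-- Σ n_k a_k ⊗ a_k.  Grow the graph one adjacent vertex q at a time, keeping it
-- affinely independent.  If q creates a relation, the relation n is unique up to
-- scale, and resonance says that Σ n_k a_k ⊗ a_k is a diagonal matrix diag(v).
-- Hence Σ n_k ⟨w , a_k - x⟩ a_k = diag(v) w, and choosing diag(v) w along a root
-- y - x between vertices of the circuit {n ≠ 0}, uniqueness of n determines the values
-- ⟨w , p - x⟩ at all vertices p of the circuit: edges without common vertex are
-- orthogonal, and edges with a common vertex are not, for the form v⁻¹.
-- Vertices outside the circuit are contracted to it by a linear map which can be
-- rounded so that roots go to vectors of ℓ¹-norm at most 2; so unless the circuit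
-- contains x and x + 2 e_i it is itself connected by roots, and so is the
-- circuit without q.  Inspecting the edges at the neighbour of q leaves three small
-- shapes, each contradicting resonance.  Hence some h g⁻¹ is - 2 e_i.
--
-- For a realization, such a pair puts the vertex g at some v_i; the edge
-- equations are right angles, so by genericity every neighbour of g is again at
-- one of the v_j, and finally so is the root.

open import Defs
open import Algebra.Bundles using (CommutativeRing)
open import Algebra.Structures using (IsCommutativeRing)
import Algebra.Properties.Ring
import Algebra.Solver.Ring as RingSolver
open import Algebra.Solver.Ring.AlmostCommutativeRing using (fromCommutativeRing; _-Raw-AlmostCommutative⟶_)
import Data.Bool as Bool
open import Data.Empty using (⊥; ⊥-elim)
open import Data.Fin as Fin using (Fin; zero; suc)
open import Data.Fin.Properties using (all?; any?; ¬∀⟶∃¬)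
open import Data.Integer as ℤ using (ℤ; 0ℤ; 1ℤ; -1ℤ; -[1+_])
import Data.Integer.Properties as ℤ
import Data.Integer.Tactic.RingSolver as ℤ-Solver
open import Data.List as List using (List; []; _∷_; map; length; allFin)
open import Data.List.Properties using (map-tabulate)
open import Data.List.Membership.Propositional using (_∈_; _∉_; find; lose)
open import Data.List.Membership.Propositional.Properties using (∈-allFin; ∈-map⁺; ∈-map⁻; ∈-filter⁻)
import Data.List.Membership.DecPropositional as DecMembership
open import Data.List.Relation.Binary.Subset.Propositional using (_⊆_)
open import Data.List.Relation.Unary.All as All using ([]; _∷_)
open import Data.List.Relation.Unary.All.Properties using (¬Any⇒All¬)
open import Data.List.Relation.Unary.AllPairs using ([]; _∷_; tail)
open import Data.List.Relation.Unary.Any as Any using (here; there)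
open import Data.List.Relation.Unary.Unique.Propositional using (Unique)
import Data.List.Relation.Unary.Unique.Propositional.Properties as Unique
open import Data.Maybe using (Maybe; just; nothing)
open import Data.Nat as ℕ using (ℕ; zero; suc)
import Data.Nat.Properties as ℕ
open import Data.Product using (∃-syntax; _×_; _,_; proj₁; proj₂)
open import Data.Rational as ℚ using (½; 0ℚ; 1ℚ)
import Data.Rational.Properties as ℚ
open import Data.Rational.Unnormalised using (mkℚᵘ; *≡*)
import Data.Rational.Unnormalised.Properties as ℚᵘ
open import Data.Sum using (_⊎_; inj₁; inj₂)
open import Data.Vec as Vec using (Vec; []; _∷_; lookup; replicate; zipWith; foldr; fromList)
open import Data.Vec.Properties using (lookup-map; lookup-zipWith; lookup-replicate; lookup∘update; lookup∘update′; tabulate∘lookup; tabulate-cong; ∷-injective)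
import Data.Vec.Relation.Unary.All as VAll
open import Function using (_∘_; id)
open import Relation.Nullary using (¬_; Dec; yes; no; does)
open import Relation.Nullary.Decidable using (_×-dec_; ¬?)
open import Relation.Binary.Construct.Closure.ReflexiveTransitive as Star using (Star; ε; _◅_; _◅◅_)
open import Relation.Binary.Definitions using (DecidableEquality)
open import Relation.Binary.PropositionalEquality using (_≡_; _≢_; refl; sym; trans; cong; cong₂; subst; module ≡-Reasoning)
open import Relation.Binary.Structures using (IsTotalOrder)
open ≡-Reasoning

-- In terms of B(a , b) = Σ a_i b_i / v_i the values found on the circuit read n(x) B(y - x , p - x)
-- = 1, for every edge x y and every third vertex p. The circuit thus behaves like an orthocentric
-- system, in which each point is the orthocentre of the others. Integrality is what makes small
-- configurations close up: roots have entries ± 1, so a further vertex would solve 2 P = ± 1 or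
-- make an even number equal to 3. Once all vertices of the circuit are known, its first and mixed
-- moments are contradictory.
--
-- The obstacle is that the support of n need not be connected, while the vertices off the support
-- cannot be deleted because paths may run through them. Contracting them along a tree extends to a
-- linear map, but with rational entries and possibly long images of roots. Its saving feature is
-- that it fixes e_a whenever v_a ≠ 0, so that rounding the other images does not disturb the
-- circuit. A root could then still shrink to a single ± e_a; the coordinate sum, which is always 0
-- or 2, forbids this.
--
-- The linear algebra stays integral: dual functionals carry a common nonzero factor D, which is
-- cancelled at the end.

module Combinatorial where
  open import Data.Integer using (_+_; _*_; _-_; -_; _≟_)
  open import Data.Integer.Properties using (+-identityˡ; +-identityʳ; +-comm; *-identityˡ; *-identityʳ; *-zeroˡ; *-zeroʳ; *-comm; *-assoc; *-distribˡ-+; i≡j⇒i-j≡0; i-j≡0⇒i≡j; i*j≡0⇒i≡0∨j≡0)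
  open import Data.Integer.Tactic.RingSolver using (solve-∀)

  -- Finite sums and linear arithmetic over the integers.

  private variable
    X Y : Set

  abstract
    ∑ : List X → (X → ℤ) → ℤ
    ∑ []      F = 0ℤ
    ∑ (x ∷ L) F = F x + ∑ L F

    ∑-∷ : (x : X) (L : List X) (F : X → ℤ) → ∑ (x ∷ L) F ≡ F x + ∑ L F
    ∑-∷ x L F = refl

    ∑-map : (f : X → Y) (L : List X) (F : Y → ℤ) → ∑ (List.map f L) F ≡ ∑ L (λ x → F (f x))
    ∑-map f []      F = refl
    ∑-map f (x ∷ L) F = cong (F (f x) +_) (∑-map f L F)

    ∑-cong : (L : List X) {F G : X → ℤ} → (∀ {x} → x ∈ L → F x ≡ G x) → ∑ L F ≡ ∑ L G
    ∑-cong []      eq = refl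
    ∑-cong (x ∷ L) eq = cong₂ _+_ (eq (here refl)) (∑-cong L (λ x∈L → eq (there x∈L)))

    ∑-zero : (L : List X) {F : X → ℤ} → (∀ {x} → x ∈ L → F x ≡ 0ℤ) → ∑ L F ≡ 0ℤ
    ∑-zero []      eq = refl
    ∑-zero (x ∷ L) eq = trans (cong₂ _+_ (eq (here refl)) (∑-zero L (λ x∈L → eq (there x∈L)))) refl

    ∑-+ : (L : List X) (F G : X → ℤ) → ∑ L (λ x → F x + G x) ≡ ∑ L F + ∑ L G
    ∑-+ []      F G = refl
    ∑-+ (x ∷ L) F G = trans (cong (F x + G x +_) (∑-+ L F G)) (interchange (F x) (G x) (∑ L F) (∑ L G))
      where
      interchange : ∀ a b c d → a + b + (c + d) ≡ a + c + (b + d)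
      interchange = solve-∀

    ∑-* : (L : List X) (c : ℤ) (F : X → ℤ) → ∑ L (λ x → c * F x) ≡ c * ∑ L F
    ∑-* []      c F = sym (*-zeroʳ c)
    ∑-* (x ∷ L) c F = trans (cong (c * F x +_) (∑-* L c F)) (sym (*-distribˡ-+ c (F x) (∑ L F)))

    ∑-swap : (L : List X) (M : List Y) (F : X → Y → ℤ) →
             ∑ L (λ x → ∑ M (F x)) ≡ ∑ M (λ y → ∑ L (λ x → F x y))
    ∑-swap []      M F = sym (∑-zero M (λ _ → refl))
    ∑-swap (x ∷ L) M F = trans (cong (∑ M (F x) +_) (∑-swap L M F)) (sym (∑-+ M (F x) _))

    ∑-only : {L : List X} {F : X → ℤ} {y : X} → Unique L → y ∈ L →
             (∀ {x} → x ∈ L → x ≢ y → F x ≡ 0ℤ) → ∑ L F ≡ F y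
    ∑-only {L = x ∷ L} {F} (x∉L ∷ _) (here refl) off =
      trans (cong (F x +_) (∑-zero L λ z∈L → off (there z∈L) λ z≡x → All.lookup x∉L z∈L (sym z≡x)))
            (+-identityʳ (F x))
    ∑-only {L = x ∷ L} {F} (x∉L ∷ u) (there y∈L) off =
      trans (cong₂ _+_ (off (here refl) (All.lookup x∉L y∈L)) (∑-only u y∈L λ z∈L → off (there z∈L)))
            (+-identityˡ _)

  indicator : {P : Set} → Dec P → ℤ
  indicator (yes _) = 1ℤ
  indicator (no  _) = 0ℤ

  indicator-yes : {P : Set} (d : Dec P) → P → indicator d ≡ 1ℤ
  indicator-yes (yes _) _ = refl
  indicator-yes (no ¬p) p = ⊥-elim (¬p p)

  indicator-no : {P : Set} (d : Dec P) → ¬ P → indicator d ≡ 0ℤ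
  indicator-no (yes p) ¬p = ⊥-elim (¬p p)
  indicator-no (no _)  _  = refl

  -- Linear arithmetic by certificates: an equation follows from others once its
  -- difference is exhibited as a combination of their differences.

  by₁ : ∀ {x y a b} c → a ≡ b → x - y ≡ c * (a - b) → x ≡ y
  by₁ {x} {y} {a} c refl eq = i-j≡0⇒i≡j x y (trans eq (vanish c a))
    where
    vanish : ∀ c a → c * (a - a) ≡ 0ℤ
    vanish = solve-∀

  by₂ : ∀ {x y a b a′ b′} c c′ → a ≡ b → a′ ≡ b′ →
        x - y ≡ c * (a - b) + c′ * (a′ - b′) → x ≡ y
  by₂ {x} {y} {a} {_} {a′} c c′ refl refl eq = i-j≡0⇒i≡j x y (trans eq (vanish c a c′ a′))
    where
    vanish : ∀ c a c′ a′ → c * (a - a) + c′ * (a′ - a′) ≡ 0ℤ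
    vanish = solve-∀

  *-nonzero : ∀ {a b} → a ≢ 0ℤ → b ≢ 0ℤ → a * b ≢ 0ℤ
  *-nonzero {a} a≢0 b≢0 ab≡0 with i*j≡0⇒i≡0∨j≡0 a ab≡0
  ... | inj₁ a≡0 = a≢0 a≡0
  ... | inj₂ b≡0 = b≢0 b≡0

  *-cancel-0 : ∀ {a b} → a ≢ 0ℤ → a * b ≡ 0ℤ → b ≡ 0ℤ
  *-cancel-0 {a} a≢0 ab≡0 with i*j≡0⇒i≡0∨j≡0 a ab≡0
  ... | inj₁ a≡0 = ⊥-elim (a≢0 a≡0)
  ... | inj₂ b≡0 = b≡0

  -- Affine functionals and affine independence.

  abstract
    coords : ∀ m → List (Fin m)
    coords = allFin

    coords-unique : ∀ m → Unique (coords m)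
    coords-unique = Unique.allFin⁺

    ∈-coords : ∀ {m} (k : Fin m) → k ∈ coords m
    ∈-coords = ∈-allFin

    coords-suc : ∀ m → coords (suc m) ≡ zero ∷ map suc (coords m)
    coords-suc m = cong (zero ∷_) (sym (map-tabulate id suc))

  ∑-coords : ∀ {m} (F : Fin (suc m) → ℤ) → ∑ (coords (suc m)) F ≡ F zero + ∑ (coords m) (λ k → F (suc k))
  ∑-coords {m} F = trans (cong (λ K → ∑ K F) (coords-suc m))
    (trans (∑-∷ zero _ F) (cong (F zero +_) (∑-map suc (coords m) F)))

  δ : ∀ {m} → Fin m → Fin m → ℤ
  δ i k = indicator (i Fin.≟ k)

  δ-same : ∀ {m} (i : Fin m) → δ i i ≡ 1ℤ
  δ-same i = indicator-yes (i Fin.≟ i) refl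

  δ-diff : ∀ {m} {i k : Fin m} → i ≢ k → δ i k ≡ 0ℤ
  δ-diff {i = i} {k} = indicator-no (i Fin.≟ k)

  ∑δ : ∀ {m} (F : Fin m → ℤ) (i : Fin m) → ∑ (coords m) (λ k → F k * δ i k) ≡ F i
  ∑δ {m} F i = trans (∑-only (coords-unique m) (∈-coords i) (λ {k} _ k≢i →
                        trans (cong (F k *_) (δ-diff (λ i≡k → k≢i (sym i≡k)))) (*-zeroʳ (F k))))
                     (trans (cong (F i *_) (δ-same i)) (*-identityʳ (F i)))

  -- Homogeneous coordinates: affine functionals on ℤ^m are linear in these.
  hom : ∀ {m} → Zm m → Fin (suc m) → ℤ
  hom p zero    = 1ℤ
  hom p (suc k) = lookup p k

  Functional : ℕ → Set
  Functional m = Fin (suc m) → ℤ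

  app : ∀ {m} → Functional m → Zm m → ℤ
  app {m} f p = ∑ (coords (suc m)) (λ k → f k * hom p k)

  ∑-app : ∀ {m} (L : List (Zm m)) (r : Zm m → ℤ) (f : Functional m) →
          ∑ L (λ p → r p * app f p) ≡ ∑ (coords (suc m)) (λ k → f k * ∑ L (λ p → r p * hom p k))
  ∑-app {m} L r f = begin
    ∑ L (λ p → r p * app f p)
      ≡⟨ ∑-cong L (λ {p} _ → sym (∑-* (coords (suc m)) (r p) _)) ⟩
    ∑ L (λ p → ∑ (coords (suc m)) (λ k → r p * (f k * hom p k)))
      ≡⟨ ∑-swap L (coords (suc m)) _ ⟩
    ∑ (coords (suc m)) (λ k → ∑ L (λ p → r p * (f k * hom p k)))
      ≡⟨ ∑-cong (coords (suc m)) (λ {k} _ →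
           trans (∑-cong L (λ {p} _ → exchange (r p) (f k) (hom p k))) (∑-* L (f k) _)) ⟩
    ∑ (coords (suc m)) (λ k → f k * ∑ L (λ p → r p * hom p k)) ∎
    where
    exchange : ∀ a b c → a * (b * c) ≡ b * (a * c)
    exchange = solve-∀

  -- An affine relation: Σ r(p) = 0 and Σ r(p) p = 0.
  Relation : ∀ {m} → (Zm m → ℤ) → List (Zm m) → Set
  Relation r L = ∀ k → ∑ L (λ p → r p * hom p k) ≡ 0ℤ

  relation-app : ∀ {m} {L : List (Zm m)} {r} → Relation r L → ∀ f → ∑ L (λ p → r p * app f p) ≡ 0ℤ
  relation-app {m} {L} {r} rel f =
    trans (∑-app L r f) (∑-zero (coords (suc m)) (λ {k} _ → trans (cong (f k *_) (rel k)) (*-zeroʳ (f k))))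

  -- Affine independence, as the existence of integral dual functionals.
  record Dual {m} (L : List (Zm m)) : Set where
    field
      D   : ℤ
      D≢0 : D ≢ 0ℤ
      φ   : Zm m → Functional m
      on  : ∀ {p} → p ∈ L → app (φ p) p ≡ D
      off : ∀ {p p′} → p ∈ L → p′ ∈ L → p ≢ p′ → app (φ p) p′ ≡ 0ℤ

    -- Lagrange interpolation: Σ G(p′) φ(p′) agrees with G on L up to the common factor D.
    expand : Unique L → ∀ {p} → p ∈ L → (G : Zm m → ℤ) → ∑ L (λ p′ → G p′ * app (φ p′) p) ≡ G p * D
    expand u {p} p∈L G = trans (∑-only u p∈L λ {p′} p′∈L p′≢p → trans (cong (G p′ *_) (off p′∈L p∈L p′≢p)) (*-zeroʳ (G p′)))
                           (cong (G p *_) (on p∈L))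

  app-∑ : ∀ {m} (L : List (Zm m)) (G : Zm m → ℤ) (φ : Zm m → Functional m) (u : Zm m) →
          app (λ k → ∑ L (λ p → G p * φ p k)) u ≡ ∑ L (λ p → G p * app (φ p) u)
  app-∑ {m} L G φ u = begin
    ∑ K (λ k → ∑ L (λ p → G p * φ p k) * hom u k)
      ≡⟨ ∑-cong K (λ {k} _ → trans (*-comm _ (hom u k)) (sym (∑-* L (hom u k) _))) ⟩
    ∑ K (λ k → ∑ L (λ p → hom u k * (G p * φ p k)))
      ≡⟨ ∑-swap K L _ ⟩
    ∑ L (λ p → ∑ K (λ k → hom u k * (G p * φ p k)))
      ≡⟨ ∑-cong L (λ {p} _ → trans (∑-cong K (λ {k} _ → reorder (hom u k) (G p) (φ p k))) (∑-* K (G p) _)) ⟩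
    ∑ L (λ p → G p * app (φ p) u) ∎
    where
    K = coords (suc m)
    reorder : ∀ a b c → a * (b * c) ≡ b * (c * a)
    reorder = solve-∀

  app-combine : ∀ {m} a (f : Functional m) b g u → app (λ k → a * f k + b * g k) u ≡ a * app f u + b * app g u
  app-combine {m} a f b g u =
    trans (∑-cong K (λ {k} _ → distribute a (f k) b (g k) (hom u k)))
          (trans (∑-+ K _ _) (cong₂ _+_ (∑-* K a _) (∑-* K b _)))
    where
    K = coords (suc m)
    distribute : ∀ a f b g h → (a * f + b * g) * h ≡ a * (f * h) + b * (g * h)
    distribute = solve-∀

  coordinate : ∀ {m} → Fin (suc m) → Functional m
  coordinate k j = δ k j

  app-coordinate : ∀ {m} k (u : Zm m) → app (coordinate k) u ≡ hom u k
  app-coordinate k u = trans (∑-cong (coords _) (λ {j} _ → *-comm (δ k j) (hom u j))) (∑δ (hom u) k)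

  module _ {m : ℕ} {L : List (Zm m)} {q : Zm m} (unique : Unique L) (q∉L : q ∉ L) (dual : Dual L) where
    open Dual dual

    private
      -- D times the k-th homogeneous coordinate minus its Lagrange interpolant on L, hence zero on
      -- L. The values at q decide whether q lies in the affine span of L.
      ψ : Fin (suc m) → Functional m
      ψ k j = D * coordinate k j + -1ℤ * ∑ L (λ p → hom p k * φ p j)

      app-ψ : ∀ k u → app (ψ k) u ≡ D * hom u k + -1ℤ * ∑ L (λ p → hom p k * app (φ p) u)
      app-ψ k u = trans (app-combine D (coordinate k) -1ℤ _ u)
        (cong₂ (λ a b → D * a + -1ℤ * b) (app-coordinate k u) (app-∑ L (λ p → hom p k) φ u))

      ψ-L : ∀ k {p} → p ∈ L → app (ψ k) p ≡ 0ℤ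
      ψ-L k {p} p∈L = trans (app-ψ k p)
        (trans (cong (λ a → D * hom p k + -1ℤ * a) (expand unique p∈L (λ p → hom p k))) (cancel D (hom p k)))
        where
        cancel : ∀ D h → D * h + -1ℤ * (h * D) ≡ 0ℤ
        cancel = solve-∀

      -- The coefficients of D q - Σ φ_p(q) p, which is the vector of residuals `ψ k` at q. They
      -- form a relation exactly when all residuals vanish there.
      coefficient : Zm m → ℤ
      coefficient p with p ≟v q
      ... | yes _ = D
      ... | no  _ = - app (φ p) q

      coefficient-q : coefficient q ≡ D
      coefficient-q with q ≟v q
      ... | yes _  = refl
      ... | no q≢q = ⊥-elim (q≢q refl)

      coefficient-L : ∀ {p} → p ∈ L → coefficient p ≡ - app (φ p) q
      coefficient-L {p} p∈L with p ≟v q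
      ... | yes refl = ⊥-elim (q∉L p∈L)
      ... | no _     = refl

      moment : ∀ k → ∑ (q ∷ L) (λ p → coefficient p * hom p k) ≡ app (ψ k) q
      moment k = begin
        ∑ (q ∷ L) (λ p → coefficient p * hom p k)
          ≡⟨ ∑-∷ q L _ ⟩
        coefficient q * hom q k + ∑ L (λ p → coefficient p * hom p k)
          ≡⟨ cong₂ _+_ (cong (_* hom q k) coefficient-q)
               (trans (∑-cong L (λ {p} p∈L → trans (cong (_* hom p k) (coefficient-L p∈L)) (flip (app (φ p) q) (hom p k))))
                      (∑-* L -1ℤ _)) ⟩
        D * hom q k + -1ℤ * ∑ L (λ p → hom p k * app (φ p) q)
          ≡⟨ sym (app-ψ k q) ⟩
        app (ψ k) q ∎
        where
        flip : ∀ a h → - a * h ≡ -1ℤ * (h * a)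
        flip = solve-∀

      extended : ∀ k → app (ψ k) q ≢ 0ℤ → Dual (q ∷ L)
      extended k ψq≢0 = record
        { D = c * D ; D≢0 = *-nonzero ψq≢0 D≢0 ; φ = φ′ ; on = on′ ; off = off′ }
        where
        c = app (ψ k) q
        φ′ : Zm m → Functional m
        φ′ p with p ≟v q
        ... | yes _ = λ j → D * ψ k j + 0ℤ * ψ k j
        -- The multiple of `ψ k` clears the value at q. On L, where `ψ k` is zero, `φ p` is merely
        -- scaled by c.
        ... | no  _ = λ j → c * φ p j + - app (φ p) q * ψ k j
        φ′-q : ∀ u → app (φ′ q) u ≡ D * app (ψ k) u
        φ′-q u with q ≟v q
        ... | yes _  = trans (app-combine D (ψ k) 0ℤ (ψ k) u) (+-identityʳ _)
        ... | no q≢q = ⊥-elim (q≢q refl)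
        φ′-L : ∀ {p} → p ∈ L → ∀ u → app (φ′ p) u ≡ c * app (φ p) u + - app (φ p) q * app (ψ k) u
        φ′-L {p} p∈L u with p ≟v q
        ... | yes refl = ⊥-elim (q∉L p∈L)
        ... | no _     = app-combine c (φ p) (- app (φ p) q) (ψ k) u
        φ′-LL : ∀ {p p′} → p ∈ L → p′ ∈ L → app (φ′ p) p′ ≡ c * app (φ p) p′
        φ′-LL {p} {p′} p∈L p′∈L = trans (φ′-L p∈L p′) (trans
          (cong (λ z → c * app (φ p) p′ + - app (φ p) q * z) (ψ-L k p′∈L))
          (trans (cong (c * app (φ p) p′ +_) (*-zeroʳ (- app (φ p) q))) (+-identityʳ _)))
        on′ : ∀ {p} → p ∈ q ∷ L → app (φ′ p) p ≡ c * D
        on′ (here refl) = trans (φ′-q q) (*-comm D c)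
        on′ (there p∈L) = trans (φ′-LL p∈L p∈L) (cong (c *_) (on p∈L))
        cancel : ∀ c a → c * a + - a * c ≡ 0ℤ
        cancel = solve-∀
        off′ : ∀ {p p′} → p ∈ q ∷ L → p′ ∈ q ∷ L → p ≢ p′ → app (φ′ p) p′ ≡ 0ℤ
        off′ (here refl) (here refl)  p≢p′ = ⊥-elim (p≢p′ refl)
        off′ (here refl) (there p′∈L) p≢p′ = trans (φ′-q _) (trans (cong (D *_) (ψ-L k p′∈L)) (*-zeroʳ D))
        off′ {p} (there p∈L) (here refl)  p≢p′ = trans (φ′-L p∈L q) (cancel c (app (φ p) q))
        off′ (there p∈L) (there p′∈L) p≢p′ = trans (φ′-LL p∈L p′∈L) (trans (cong (c *_) (off p∈L p′∈L p≢p′)) (*-zeroʳ c))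

    -- A step of fraction-free Gaussian elimination. A residual that is nonzero at q separates q
    -- from L; if there is none, q is an affine combination of L and its own coefficient in the
    -- relation is D.
    eliminate : Dual (q ∷ L) ⊎ ∃[ n ] (Relation n (q ∷ L) × n q ≢ 0ℤ)
    eliminate with all? (λ k → app (ψ k) q ≟ 0ℤ)
    ... | yes zero-ψ = inj₂ (coefficient , (λ k → trans (moment k) (zero-ψ k)) , λ nq≡0 → D≢0 (trans (sym coefficient-q) nq≡0))
    ... | no ¬zero-ψ with ¬∀⟶∃¬ (suc m) _ (λ k → app (ψ k) q ≟ 0ℤ) ¬zero-ψ
    ...   | k , ψq≢0 = inj₁ (extended k ψq≢0)

  lookup-ext : ∀ {X : Set} {n} {u w : Vec X n} → (∀ k → lookup u k ≡ lookup w k) → u ≡ w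
  lookup-ext {u = u} {w} eq = trans (sym (tabulate∘lookup u)) (trans (tabulate-cong eq) (tabulate∘lookup w))

  ∑-combine₄ : ∀ {A : Set} (L : List A) a b c d (F G H K : A → ℤ) →
    ∑ L (λ p → a * F p + (b * G p + (c * H p + d * K p))) ≡ a * ∑ L F + (b * ∑ L G + (c * ∑ L H + d * ∑ L K))
  ∑-combine₄ L a b c d F G H K =
    trans (∑-+ L _ _) (cong₂ _+_ (∑-* L a F)
      (trans (∑-+ L _ _) (cong₂ _+_ (∑-* L b G)
        (trans (∑-+ L _ _) (cong₂ _+_ (∑-* L c H) (∑-* L d K))))))

  ∑-indicator : ∀ {m} {L : List (Zm m)} {y} → Unique L → y ∈ L → (G : Zm m → ℤ) →
                ∑ L (λ p → indicator (p ≟v y) * G p) ≡ G y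
  ∑-indicator {y = y} u y∈L G =
    trans (∑-only u y∈L (λ {p} _ p≢y → trans (cong (_* G p) (indicator-no (p ≟v y) p≢y)) (*-zeroˡ (G p))))
          (trans (cong (_* G y) (indicator-yes (y ≟v y) refl)) (*-identityˡ (G y)))

  ∑-only₂ : ∀ {m} {L : List (Zm m)} {F : Zm m → ℤ} {y z} → Unique L → y ∈ L → z ∈ L → y ≢ z →
            (∀ {p} → p ∈ L → p ≢ y → p ≢ z → F p ≡ 0ℤ) → ∑ L F ≡ F y + F z
  ∑-only₂ {L = L} {F} {y} {z} u y∈L z∈L y≢z off = begin
    ∑ L F                                        ≡⟨ ∑-cong L (λ {p} _ → split (F p) (indicator (p ≟v z))) ⟩
    ∑ L (λ p → rest p + indicator (p ≟v z) * F p) ≡⟨ ∑-+ L rest _ ⟩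
    ∑ L rest + ∑ L (λ p → indicator (p ≟v z) * F p)
      ≡⟨ cong₂ _+_ (∑-only u y∈L rest-off) (∑-indicator u z∈L F) ⟩
    rest y + F z
      ≡⟨ cong (λ c → F y - c * F y + F z) (indicator-no (y ≟v z) y≢z) ⟩
    F y - 0ℤ * F y + F z                         ≡⟨ cong (_+ F z) (+-identityʳ (F y)) ⟩
    F y + F z                                    ∎
    where
    rest : Zm _ → ℤ
    rest p = F p - indicator (p ≟v z) * F p
    split : ∀ a c → a ≡ a - c * a + c * a
    split = solve-∀
    rest-off : ∀ {p} → p ∈ L → p ≢ y → rest p ≡ 0ℤ
    rest-off {p} p∈L p≢y with p ≟v z
    ... | yes refl = i≡j⇒i-j≡0 (sym (*-identityˡ (F p)))
    ... | no p≢z   = trans (+-identityʳ (F p)) (off p∈L p≢y p≢z)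

  -- Signs, parity and roots of type D.

  Sign : ℤ → Set
  Sign s = s ≡ 1ℤ ⊎ s ≡ -1ℤ

  sign-square : ∀ {s} → Sign s → s * s ≡ 1ℤ
  sign-square (inj₁ refl) = refl
  sign-square (inj₂ refl) = refl

  sign-nonzero : ∀ {s} → Sign s → s ≢ 0ℤ
  sign-nonzero (inj₁ refl) ()
  sign-nonzero (inj₂ refl) ()

  sign-neg : ∀ {s} → Sign s → Sign (- s)
  sign-neg (inj₁ refl) = inj₂ refl
  sign-neg (inj₂ refl) = inj₁ refl

  sign-cases : ∀ {s t} → Sign s → Sign t → t ≡ s ⊎ t ≡ - s
  sign-cases (inj₁ refl) (inj₁ refl) = inj₁ refl
  sign-cases (inj₁ refl) (inj₂ refl) = inj₂ refl
  sign-cases (inj₂ refl) (inj₁ refl) = inj₂ refl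
  sign-cases (inj₂ refl) (inj₂ refl) = inj₁ refl

  no-half : (P : ℤ) → P + P ≢ 1ℤ
  no-half (ℤ.+ zero)        ()
  no-half (ℤ.+ suc k)     eq with trans (sym (ℕ.+-suc k k)) (ℕ.suc-injective (ℤ.+-injective eq))
  ... | ()
  no-half ℤ.-[1+ k ]      ()

  sign-not-double : ∀ {c} → Sign c → (P : ℤ) → P + P ≢ c
  sign-not-double (inj₁ refl) P eq = no-half P eq
  sign-not-double (inj₂ refl) P eq = no-half (- P) (by₁ -1ℤ eq (certificate P))
    where
    certificate : ∀ P → - P + - P - 1ℤ ≡ -1ℤ * (P + P - -1ℤ)
    certificate = solve-∀

  sign-sum-even : ∀ {a c} → Sign a → Sign c → ∃[ h ] a + c ≡ h + h
  sign-sum-even (inj₁ refl) (inj₁ refl) = 1ℤ , refl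
  sign-sum-even (inj₁ refl) (inj₂ refl) = 0ℤ , refl
  sign-sum-even (inj₂ refl) (inj₁ refl) = 0ℤ , refl
  sign-sum-even (inj₂ refl) (inj₂ refl) = -1ℤ , refl

  -- y - x is the root s e_i + t e_j of type D.
  record Link {m} (x y : Zm m) (i j : Fin m) (s t : ℤ) : Set where
    field
      i≢j    : i ≢ j
      sign-s : Sign s
      sign-t : Sign t
      shift  : ∀ k → lookup y k ≡ lookup x k + (s * δ i k + t * δ j k)

    at-i : lookup y i - lookup x i ≡ s
    at-i = begin
      lookup y i - lookup x i ≡⟨ cong (_- lookup x i) (shift i) ⟩
      lookup x i + (s * δ i i + t * δ j i) - lookup x i
        ≡⟨ cong₂ (λ a b → lookup x i + (s * a + t * b) - lookup x i) (δ-same i) (δ-diff (λ j≡i → i≢j (sym j≡i))) ⟩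
      lookup x i + (s * 1ℤ + t * 0ℤ) - lookup x i ≡⟨ simplify (lookup x i) s t ⟩
      s ∎
      where
      simplify : ∀ a s t → a + (s * 1ℤ + t * 0ℤ) - a ≡ s
      simplify = solve-∀

    at-j : lookup y j - lookup x j ≡ t
    at-j = begin
      lookup y j - lookup x j ≡⟨ cong (_- lookup x j) (shift j) ⟩
      lookup x j + (s * δ i j + t * δ j j) - lookup x j
        ≡⟨ cong₂ (λ a b → lookup x j + (s * a + t * b) - lookup x j) (δ-diff i≢j) (δ-same j) ⟩
      lookup x j + (s * 0ℤ + t * 1ℤ) - lookup x j ≡⟨ simplify (lookup x j) s t ⟩
      t ∎
      where
      simplify : ∀ a s t → a + (s * 0ℤ + t * 1ℤ) - a ≡ t
      simplify = solve-∀

    at-other : ∀ {k} → k ≢ i → k ≢ j → lookup y k ≡ lookup x k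
    at-other {k} k≢i k≢j = begin
      lookup y k ≡⟨ shift k ⟩
      lookup x k + (s * δ i k + t * δ j k)
        ≡⟨ cong₂ (λ a b → lookup x k + (s * a + t * b)) (δ-diff (λ i≡k → k≢i (sym i≡k))) (δ-diff (λ j≡k → k≢j (sym j≡k))) ⟩
      lookup x k + (s * 0ℤ + t * 0ℤ) ≡⟨ simplify (lookup x k) s t ⟩
      lookup x k ∎
      where
      simplify : ∀ a s t → a + (s * 0ℤ + t * 0ℤ) ≡ a
      simplify = solve-∀

    moves-i : lookup y i ≢ lookup x i
    moves-i eq = sign-nonzero sign-s (trans (sym at-i) (i≡j⇒i-j≡0 eq))

    moves-j : lookup y j ≢ lookup x j
    moves-j eq = sign-nonzero sign-t (trans (sym at-j) (i≡j⇒i-j≡0 eq))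

    distinct : x ≢ y
    distinct x≡y = moves-i (cong (λ p → lookup p i) (sym x≡y))

  link-swap : ∀ {m} {x y : Zm m} {i j s t} → Link x y i j s t → Link x y j i t s
  link-swap {x = x} {i = i} {j} {s} {t} l = record
    { i≢j = λ j≡i → i≢j (sym j≡i) ; sign-s = sign-t ; sign-t = sign-s
    ; shift = λ k → trans (shift k) (cong (lookup x k +_) (+-comm (s * δ i k) (t * δ j k))) }
    where open Link l

  link-reverse : ∀ {m} {x y : Zm m} {i j s t} → Link x y i j s t → Link y x i j (- s) (- t)
  link-reverse {x = x} {y} {i} {j} {s} {t} l = record
    { i≢j = i≢j ; sign-s = sign-neg sign-s ; sign-t = sign-neg sign-t
    ; shift = λ k → by₁ -1ℤ (shift k) (back (lookup x k) (lookup y k) s t (δ i k) (δ j k)) }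
    where
    open Link l
    back : ∀ x y s t a b → x - (y + (- s * a + - t * b)) ≡ -1ℤ * (y - (x + (s * a + t * b)))
    back = solve-∀

  Adj : ∀ {m} → Zm m → Zm m → Set
  Adj x y = ∃[ i ] ∃[ j ] ∃[ s ] ∃[ t ] Link x y i j s t

  -- y = x + 2 e_i, the configuration which makes a translate contain -2 e_i.
  Doubled : ∀ {m} → Zm m → Zm m → Set
  Doubled x y = ∃[ i ] (∀ k → lookup y k ≡ lookup x k + (1ℤ + 1ℤ) * δ i k)

  -- The diagonal part of resonance is omitted: it follows from this one because the
  -- coordinate sum takes only the values 0 and 2.
  Resonant : ∀ {m} → List (Zm m) → Set
  Resonant L = ∀ r → Relation r L → ∀ i j → i ≢ j → ∑ L (λ p → r p * (lookup p i * lookup p j)) ≡ 0ℤ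

  -- Circuits and their moments.

  module _ {m : ℕ} {L : List (Zm m)} {q : Zm m} (unique : Unique (q ∷ L)) (dual : Dual L) where
    open Dual dual

    -- Applying `φ p` to the relation kills all terms but those of q and p. So r(q) determines r.
    relation-at : ∀ {r} → Relation r (q ∷ L) → ∀ {p} → p ∈ L → r q * app (φ p) q + r p * D ≡ 0ℤ
    relation-at {r} rel {p} p∈L = trans (cong (r q * app (φ p) q +_) (sym
             (trans (∑-only (tail unique) p∈L (λ {p′} p′∈L p′≢p →
                       trans (cong (r p′ *_) (off p∈L p′∈L (λ p≡p′ → p′≢p (sym p≡p′)))) (*-zeroʳ (r p′))))
                    (cong (r p *_) (on p∈L)))))
           (trans (sym (∑-∷ q L _)) (relation-app {L = q ∷ L} {r = r} rel (φ p)))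

    -- As L is independent, the relations on `q ∷ L` have dimension at most one. Values at x and p
    -- are compared through the value at q; then D and n(q) are cancelled.
    relations-proportional : ∀ {n r} → Relation n (q ∷ L) → Relation r (q ∷ L) → n q ≢ 0ℤ →
                             ∀ {x p} → x ∈ q ∷ L → p ∈ q ∷ L → n x * r p ≡ r x * n p
    relations-proportional {n} {r} relation rel nq≢0 {x} {p} x∈ p∈ =
      i-j≡0⇒i≡j _ _ (*-cancel-0 nq≢0 (trans (certificate (n q) (n x) (n p) (r q) (r x) (r p))
        (trans (cong₂ (λ a b → n x * a - n p * b) (i≡j⇒i-j≡0 (through-q p∈)) (i≡j⇒i-j≡0 (through-q x∈)))
               (zeros (n x) (n p)))))
      where
      certificate : ∀ nq nx np rq rx rp → nq * (nx * rp - rx * np) ≡ nx * (nq * rp - rq * np) - np * (nq * rx - rq * nx)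
      certificate = solve-∀
      zeros : ∀ a b → a * 0ℤ - b * 0ℤ ≡ 0ℤ
      zeros = solve-∀
      certificate-q : ∀ D nq np rq rp f → D * (nq * rp - rq * np) ≡ nq * (rq * f + rp * D) - rq * (nq * f + np * D)
      certificate-q = solve-∀
      through-q : ∀ {p} → p ∈ q ∷ L → n q * r p ≡ r q * n p
      through-q (here refl) = *-comm (n q) (r q)
      through-q {p} (there p∈L) =
        i-j≡0⇒i≡j _ _ (*-cancel-0 D≢0 (trans (certificate-q D (n q) (n p) (r q) (r p) (app (φ p) q))
          (trans (cong₂ (λ a b → n q * a - r q * b) (relation-at {r} rel p∈L) (relation-at {n} relation p∈L))
                 (zeros (n q) (r q)))))

  module Circuit {m : ℕ} {M : List (Zm m)} (unique : Unique M) {n : Zm m → ℤ} (relation : Relation n M)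
                 (proportional : ∀ {r : Zm m → ℤ} → Relation r M → ∀ {x p : Zm m} → x ∈ M → p ∈ M → n x * r p ≡ r x * n p)
                 (resonant : Resonant M) (undoubled : ∀ {x y : Zm m} → x ∈ M → y ∈ M → ¬ Doubled x y) where

    infix 4 _∈S
    record _∈S (p : Zm m) : Set where
      constructor _,S_
      field
        ∈M  : p ∈ M
        n≢0 : n p ≢ 0ℤ
    open _∈S

    v : Fin m → ℤ
    v i = ∑ M (λ p → n p * (lookup p i * lookup p i))

    second : ∀ i k → ∑ M (λ p → n p * (lookup p i * lookup p k)) ≡ v i * δ i k
    second i k with i Fin.≟ k
    ... | yes refl = sym (*-identityʳ (v i))
    ... | no i≢k   = trans (resonant n relation i k i≢k) (sym (*-zeroʳ (v i)))

    -- Moments of the weights n(p) (p_i - x_i): total mass 0 and vector moment v_i e_i. They do not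
    -- depend on the base point x because n is a relation.
    moments : Fin m → Fin (suc m) → ℤ
    moments i zero    = 0ℤ
    moments i (suc k) = v i * δ i k

    moment : ∀ x i k → ∑ M (λ p → n p * (lookup p i - lookup x i) * hom p k) ≡ moments i k
    moment x i k = begin
      ∑ M (λ p → n p * (lookup p i - lookup x i) * hom p k)
        ≡⟨ ∑-cong M (λ {p} _ → distribute (n p) (lookup p i) (lookup x i) (hom p k)) ⟩
      ∑ M (λ p → n p * (lookup p i * hom p k) + - lookup x i * (n p * hom p k))
        ≡⟨ trans (∑-+ M _ _) (cong₂ _+_ (top k) (trans (∑-* M (- lookup x i) _) (cong (- lookup x i *_) (relation k)))) ⟩
      moments i k + - lookup x i * 0ℤ
        ≡⟨ drop (moments i k) (lookup x i) ⟩
      moments i k ∎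
      where
      distribute : ∀ n p x h → n * (p - x) * h ≡ n * (p * h) + - x * (n * h)
      distribute = solve-∀
      drop : ∀ a x → a + - x * 0ℤ ≡ a
      drop = solve-∀
      top : ∀ k → ∑ M (λ p → n p * (lookup p i * hom p k)) ≡ moments i k
      top zero    = trans (∑-cong M (λ {p} _ → cong (n p *_) (*-identityʳ (lookup p i)))) (relation (suc i))
      top (suc k) = second i k

    first-moment : ∀ x i → ∑ M (λ p → n p * (lookup p i - lookup x i)) ≡ 0ℤ
    first-moment x i = trans (∑-cong M (λ _ → sym (*-identityʳ _))) (moment x i zero)

    second-moment : ∀ x i k → ∑ M (λ p → n p * ((lookup p i - lookup x i) * (lookup p k - lookup x k))) ≡ v i * δ i k
    second-moment x i k = begin
      ∑ M (λ p → n p * ((lookup p i - lookup x i) * (lookup p k - lookup x k)))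
        ≡⟨ ∑-cong M (λ {p} _ → distribute (n p) (lookup p i) (lookup x i) (lookup p k) (lookup x k)) ⟩
      ∑ M (λ p → n p * (lookup p i - lookup x i) * lookup p k + - lookup x k * (n p * (lookup p i - lookup x i)))
        ≡⟨ trans (∑-+ M _ _) (cong₂ _+_ (moment x i (suc k)) (trans (∑-* M (- lookup x k) _) (cong (- lookup x k *_) (first-moment x i)))) ⟩
      v i * δ i k + - lookup x k * 0ℤ
        ≡⟨ drop (v i * δ i k) (lookup x k) ⟩
      v i * δ i k ∎
      where
      distribute : ∀ n p x p′ x′ → n * ((p - x) * (p′ - x′)) ≡ n * (p - x) * p′ + - x′ * (n * (p - x))
      distribute = solve-∀
      drop : ∀ a x → a + - x * 0ℤ ≡ a
      drop = solve-∀

    second-moment-0 : ∀ x {i k} → i ≢ k → ∑ M (λ p → n p * ((lookup p i - lookup x i) * (lookup p k - lookup x k))) ≡ 0ℤ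
    second-moment-0 x {i} {k} i≢k = trans (second-moment x i k) (trans (cong (v i *_) (δ-diff i≢k)) (*-zeroʳ (v i)))

    -- For v_i = 0 the weights n(p) (p_i - x_i) are themselves a relation. It vanishes at x, hence,
    -- being proportional to n, on the whole circuit.
    v-zero-constant : ∀ {i} → v i ≡ 0ℤ → ∀ {x p} → x ∈S → p ∈S → lookup p i ≡ lookup x i
    v-zero-constant {i} vi≡0 {x} {p} x∈S p∈S =
      i-j≡0⇒i≡j _ _ (*-cancel-0 (n≢0 p∈S) (*-cancel-0 (n≢0 x∈S)
        (trans (proportional {r} rel (∈M x∈S) (∈M p∈S)) (trans (cong (_* n p) r-x) (*-zeroˡ (n p))))))
      where
      r : Zm m → ℤ
      r p = n p * (lookup p i - lookup x i)
      rel : Relation r M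
      rel zero    = moment x i zero
      rel (suc k) = trans (moment x i (suc k)) (trans (cong (_* δ i k) vi≡0) (*-zeroˡ (δ i k)))
      r-x : r x ≡ 0ℤ
      r-x = self (n x) (lookup x i)
        where
        self : ∀ n a → n * (a - a) ≡ 0ℤ
        self = solve-∀

    v-nonzero : ∀ {i x p} → x ∈S → p ∈S → lookup p i ≢ lookup x i → v i ≢ 0ℤ
    v-nonzero x∈S p∈S p≢x vi≡0 = p≢x (v-zero-constant vi≡0 x∈S p∈S)

    -- The relation with p-th coefficient n(p) ⟨w , p - x⟩, where w is chosen such
    -- that its moment is v_i v_j (y - x), is proportional to n once y and x are corrected.
    power : ∀ {x y i j s t} → x ∈S → y ∈S → Link x y i j s t → ∀ {p} → p ∈S → p ≢ x → p ≢ y →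
            n x * (v j * s * (lookup p i - lookup x i) + v i * t * (lookup p j - lookup x j)) ≡ v i * v j
    power {x} {y} {i} {j} {s} {t} x∈S y∈S l {p} p∈S p≢x p≢y =
      i-j≡0⇒i≡j _ _ (*-cancel-0 (n≢0 p∈S)
        (by₁ 1ℤ (trans (cong (n x *_) (sym r-p)) (trans (proportional {r} rel (∈M x∈S) (∈M p∈S)) (cong (_* n p) r-x)))
             (certificate (n x) (n p) (v j * s * (lookup p i - lookup x i) + v i * t * (lookup p j - lookup x j)) (v i * v j))))
      where
      open Link l
      certificate : ∀ nx np F V → np * (nx * F - V) - 0ℤ ≡ 1ℤ * (nx * (np * F) - V * np)
      certificate = solve-∀
      r : Zm m → ℤ
      -- Here w = v_j s e_i + v_i t e_j, which is v_i v_j times diag(v)⁻¹ (y - x). The point masses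
      -- at y and x cancel the moment v_i v_j (y - x).
      r p = v j * s * (n p * (lookup p i - lookup x i)) + (v i * t * (n p * (lookup p j - lookup x j))
            + (- (v i * v j) * indicator (p ≟v y) + v i * v j * indicator (p ≟v x)))
      r-p : r p ≡ n p * (v j * s * (lookup p i - lookup x i) + v i * t * (lookup p j - lookup x j))
      r-p = trans (cong₂ (λ a b → v j * s * (n p * (lookup p i - lookup x i)) + (v i * t * (n p * (lookup p j - lookup x j))
                      + (- (v i * v j) * a + v i * v j * b))) (indicator-no (p ≟v y) p≢y) (indicator-no (p ≟v x) p≢x))
                  (collect (v j * s) (v i * t) (n p) (lookup p i - lookup x i) (lookup p j - lookup x j) (v i * v j))
        where
        collect : ∀ a b n d e V → a * (n * d) + (b * (n * e) + (- V * 0ℤ + V * 0ℤ)) ≡ n * (a * d + b * e)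
        collect = solve-∀
      r-x : r x ≡ v i * v j
      r-x = trans (cong₂ (λ a b → v j * s * (n x * (lookup x i - lookup x i)) + (v i * t * (n x * (lookup x j - lookup x j))
                      + (- (v i * v j) * a + v i * v j * b))) (indicator-no (x ≟v y) distinct) (indicator-yes (x ≟v x) refl))
                  (collect (v j * s) (v i * t) (n x) (lookup x i) (lookup x j) (v i * v j))
        where
        collect : ∀ a b n d e V → a * (n * (d - d)) + (b * (n * (e - e)) + (- V * 0ℤ + V * 1ℤ)) ≡ V
        collect = solve-∀
      total : ∀ k → v j * s * moments i k + (v i * t * moments j k + (- (v i * v j) * hom y k + v i * v j * hom x k)) ≡ 0ℤ
      total zero    = collect (v j * s) (v i * t) (v i * v j)
        where
        collect : ∀ a b V → a * 0ℤ + (b * 0ℤ + (- V * 1ℤ + V * 1ℤ)) ≡ 0ℤ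
        collect = solve-∀
      total (suc k) = trans (cong (λ a → v j * s * (v i * δ i k) + (v i * t * (v j * δ j k) + (- (v i * v j) * a + v i * v j * lookup x k))) (shift k))
                            (collect (v i) (v j) s t (δ i k) (δ j k) (lookup x k))
        where
        collect : ∀ vi vj s t a b x → vj * s * (vi * a) + (vi * t * (vj * b) + (- (vi * vj) * (x + (s * a + t * b)) + vi * vj * x)) ≡ 0ℤ
        collect = solve-∀
      rel : Relation r M
      rel k = begin
        ∑ M (λ p → r p * hom p k)
          ≡⟨ ∑-cong M (λ {p} _ → distribute (v j * s) (n p * (lookup p i - lookup x i)) (v i * t) (n p * (lookup p j - lookup x j))
                 (v i * v j) (indicator (p ≟v y)) (indicator (p ≟v x)) (hom p k)) ⟩
        ∑ M (λ p → v j * s * (n p * (lookup p i - lookup x i) * hom p k) + (v i * t * (n p * (lookup p j - lookup x j) * hom p k)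
            + (- (v i * v j) * (indicator (p ≟v y) * hom p k) + v i * v j * (indicator (p ≟v x) * hom p k))))
          ≡⟨ ∑-combine₄ M (v j * s) (v i * t) (- (v i * v j)) (v i * v j) _ _ _ _ ⟩
        _ ≡⟨ cong₂ _+_ (cong (v j * s *_) (moment x i k)) (cong₂ _+_ (cong (v i * t *_) (moment x j k))
               (cong₂ _+_ (cong (- (v i * v j) *_) (∑-indicator unique (∈M y∈S) (λ p → hom p k)))
                          (cong (v i * v j *_) (∑-indicator unique (∈M x∈S) (λ p → hom p k))))) ⟩
        v j * s * moments i k + (v i * t * moments j k + (- (v i * v j) * hom y k + v i * v j * hom x k))
          ≡⟨ total k ⟩
        0ℤ ∎
        where
        distribute : ∀ a A b B V c d h → (a * A + (b * B + (- V * c + V * d))) * h ≡ a * (A * h) + (b * (B * h) + (- V * (c * h) + V * (d * h)))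
        distribute = solve-∀

    module _ {x y i j s t} (x∈S : x ∈S) (y∈S : y ∈S) (l : Link x y i j s t) where
      open Link l

      v-i≢0 : v i ≢ 0ℤ
      v-i≢0 = v-nonzero x∈S y∈S moves-i

      v-j≢0 : v j ≢ 0ℤ
      v-j≢0 = v-nonzero x∈S y∈S moves-j

      -- Orthogonality of y - x and p - p′ for the form Σ a_k b_k / v_k: by `power` both sides,
      -- multiplied by n(x), are v_i v_j.
      level : ∀ {p p′} → p ∈S → p ≢ x → p ≢ y → p′ ∈S → p′ ≢ x → p′ ≢ y →
              v j * s * (lookup p i - lookup x i) + v i * t * (lookup p j - lookup x j) ≡
              v j * s * (lookup p′ i - lookup x i) + v i * t * (lookup p′ j - lookup x j)
      level p∈S p≢x p≢y p′∈S p′≢x p′≢y = i-j≡0⇒i≡j _ _ (*-cancel-0 (n≢0 x∈S)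
        (by₂ 1ℤ -1ℤ (power x∈S y∈S l p∈S p≢x p≢y) (power x∈S y∈S l p′∈S p′≢x p′≢y) (certificate (n x) _ _ (v i * v j))))
        where
        certificate : ∀ n a b V → n * (a - b) - 0ℤ ≡ 1ℤ * (n * a - V) + -1ℤ * (n * b - V)
        certificate = solve-∀

      -- A root on i and j is orthogonal to p - p′ and both of its coefficients are nonzero, so p -
      -- p′ cannot have exactly one of these two entries zero.
      linked-coordinates : ∀ {p p′} → p ∈S → p ≢ x → p ≢ y → p′ ∈S → p′ ≢ x → p′ ≢ y →
                           lookup p i ≡ lookup p′ i → lookup p j ≡ lookup p′ j
      linked-coordinates {p} {p′} p∈S p≢x p≢y p′∈S p′≢x p′≢y eq =
        i-j≡0⇒i≡j _ _ (*-cancel-0 (*-nonzero v-i≢0 (sign-nonzero sign-t))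
          (by₂ 1ℤ (- (v j * s)) (level p∈S p≢x p≢y p′∈S p′≢x p′≢y) eq
            (certificate (v j * s) (v i * t) (lookup p i) (lookup p′ i) (lookup x i) (lookup p j) (lookup p′ j) (lookup x j))))
        where
        certificate : ∀ a b p p′ x r r′ y →
          b * (r - r′) - 0ℤ ≡ 1ℤ * (a * (p - x) + b * (r - y) - (a * (p′ - x) + b * (r′ - y))) + - a * (p - p′)
        certificate = solve-∀

      -- Otherwise p - x would be orthogonal to y - x, whereas `power` gives a nonzero product. In
      -- particular any two edges of the circuit at x share an index.
      meets : ∀ {p} → p ∈S → p ≢ x → p ≢ y → lookup p i ≡ lookup x i → lookup p j ≢ lookup x j
      meets {p} p∈S p≢x p≢y eq-i eq-j = *-nonzero v-i≢0 v-j≢0 (trans (sym (power x∈S y∈S l p∈S p≢x p≢y))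
        (trans (cong₂ (λ a b → n x * (v j * s * (a - lookup x i) + v i * t * (b - lookup x j))) eq-i eq-j)
               (vanish (n x) (v j * s) (v i * t) (lookup x i) (lookup x j))))
        where
        vanish : ∀ n a b c d → n * (a * (c - c) + b * (d - d)) ≡ 0ℤ
        vanish = solve-∀

    undoubled-sign : ∀ {x y i s} → x ∈ M → y ∈ M → Sign s → ¬ (∀ k → lookup y k ≡ lookup x k + (s + s) * δ i k)
    undoubled-sign {i = i} x∈M y∈M (inj₁ refl) eq = undoubled x∈M y∈M (i , eq)
    undoubled-sign {x} {y} {i} x∈M y∈M (inj₂ refl) eq =
      undoubled y∈M x∈M (i , λ k → by₁ -1ℤ (eq k) (certificate (lookup x k) (lookup y k) (δ i k)))
      where
      certificate : ∀ x y d → x - (y + (1ℤ + 1ℤ) * d) ≡ -1ℤ * (y - (x + (-1ℤ + -1ℤ) * d))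
      certificate = solve-∀

    support : ∀ {p} → p ∈ M → (n p ≡ 0ℤ) ⊎ p ∈S
    support {p} p∈M with n p ≟ 0ℤ
    ... | yes np≡0 = inj₁ np≡0
    ... | no  np≢0 = inj₂ (p∈M ,S np≢0)

    -- Two roots at x with the same indices and no doubling must be opposite; then
    -- the circuit is x, y, z.
    no-parallel-adjacent : ∀ {x y z i j s t s′ t′} → x ∈S → y ∈S → z ∈S →
                           Link x y i j s t → Link x z i j s′ t′ → y ≢ z → ⊥
    no-parallel-adjacent {x} {y} {z} {i} {j} {s} {t} x∈S y∈S z∈S l l′ y≢z
      with sign-cases (Link.sign-s l) (Link.sign-s l′) | sign-cases (Link.sign-t l) (Link.sign-t l′)
    ... | inj₁ refl | inj₁ refl = y≢z (lookup-ext λ k → trans (Link.shift l k) (sym (Link.shift l′ k)))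
    ... | inj₁ refl | inj₂ refl = undoubled-sign (∈M y∈S) (∈M z∈S) (Link.sign-t l′) λ k →
            by₂ 1ℤ -1ℤ (Link.shift l′ k) (Link.shift l k) (certificate (lookup x k) (lookup y k) (lookup z k) s t (δ i k) (δ j k))
      where
      certificate : ∀ x y z s t a b → z - (y + (- t + - t) * b) ≡
                    1ℤ * (z - (x + (s * a + - t * b))) + -1ℤ * (y - (x + (s * a + t * b)))
      certificate = solve-∀
    ... | inj₂ refl | inj₁ refl = undoubled-sign (∈M y∈S) (∈M z∈S) (Link.sign-s l′) λ k →
            by₂ 1ℤ -1ℤ (Link.shift l′ k) (Link.shift l k) (certificate (lookup x k) (lookup y k) (lookup z k) s t (δ i k) (δ j k))
      where
      certificate : ∀ x y z s t a b → z - (y + (- s + - s) * a) ≡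
                    1ℤ * (z - (x + (- s * a + t * b))) + -1ℤ * (y - (x + (s * a + t * b)))
      certificate = solve-∀
    -- For opposite roots the two instances of `power` at a further vertex have opposite left sides
    -- and the same nonzero right side. With only x, y and z left, the first moment gives n(y) =
    -- n(z) and the mixed one n(y) = - n(z).
    ... | inj₂ refl | inj₂ refl = n≢0 y∈S (*-cancel-0 {1ℤ + 1ℤ} (λ ()) (*-cancel-0 (*-nonzero (sign-nonzero sign-s) (sign-nonzero sign-t)) twice))
      where
      open Link l
      module l′ = Link l′
      outside : ∀ {p} → p ∈S → p ≢ x → p ≢ y → p ≢ z → ⊥
      outside {p} p∈S p≢x p≢y p≢z = *-nonzero (v-i≢0 x∈S y∈S l) (v-j≢0 x∈S y∈S l)
        (*-cancel-0 {1ℤ + 1ℤ} (λ ()) (by₂ -1ℤ -1ℤ (power x∈S y∈S l p∈S p≢x p≢y) (power x∈S z∈S l′ p∈S p≢x p≢z)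
          (certificate (n x) (v i) (v j) s t (lookup p i - lookup x i) (lookup p j - lookup x j))))
        where
        certificate : ∀ n vi vj s t P Q → (1ℤ + 1ℤ) * (vi * vj) - 0ℤ ≡
          -1ℤ * (n * (vj * s * P + vi * t * Q) - vi * vj) + -1ℤ * (n * (vj * - s * P + vi * - t * Q) - vi * vj)
        certificate = solve-∀
      off-yz : (G : Zm m → ℤ) → G x ≡ 0ℤ → ∀ {p} → p ∈ M → p ≢ y → p ≢ z → n p * G p ≡ 0ℤ
      off-yz G Gx≡0 {p} p∈M p≢y p≢z with p ≟v x | support p∈M
      ... | yes refl | _          = trans (cong (n p *_) Gx≡0) (*-zeroʳ (n p))
      ... | no _     | inj₁ np≡0  = trans (cong (_* G p) np≡0) (*-zeroˡ (G p))
      ... | no p≢x   | inj₂ p∈S   = ⊥-elim (outside p∈S p≢x p≢y p≢z)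
      first : n y * s + n z * - s ≡ 0ℤ
      first = trans (cong₂ (λ a b → n y * a + n z * b) (sym at-i) (sym l′.at-i))
        (trans (sym (∑-only₂ unique (∈M y∈S) (∈M z∈S) y≢z (off-yz (λ p → lookup p i - lookup x i) (i≡j⇒i-j≡0 {lookup x i} refl))))
               (first-moment x i))
      mixed : n y * (s * t) + n z * (- s * - t) ≡ 0ℤ
      mixed = trans (cong₂ (λ a b → n y * a + n z * b) (cong₂ _*_ (sym at-i) (sym at-j)) (cong₂ _*_ (sym l′.at-i) (sym l′.at-j)))
        (trans (sym (∑-only₂ unique (∈M y∈S) (∈M z∈S) y≢z (off-yz (λ p → (lookup p i - lookup x i) * (lookup p j - lookup x j))
                 (trans (cong (_* (lookup x j - lookup x j)) (i≡j⇒i-j≡0 {lookup x i} refl)) (*-zeroˡ (lookup x j - lookup x j))))))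
               (second-moment-0 x i≢j))
      twice : s * t * ((1ℤ + 1ℤ) * n y) ≡ 0ℤ
      twice = by₂ t 1ℤ first mixed (certificate s t (n y) (n z))
        where
        certificate : ∀ s t a b → s * t * ((1ℤ + 1ℤ) * a) - 0ℤ ≡ t * (a * s + b * - s - 0ℤ) + 1ℤ * (a * (s * t) + b * (- s * - t) - 0ℤ)
        certificate = solve-∀

    vanish-off : ∀ {p} → (n p ≡ 0ℤ ⊎ p ∈S) → (G : Zm m → ℤ) → (p ∈S → ⊥) → n p * G p ≡ 0ℤ
    vanish-off {p} (inj₁ np≡0) G _ = trans (cong (_* G p) np≡0) (*-zeroˡ (G p))
    vanish-off     (inj₂ p∈S)  G ¬p = ⊥-elim (¬p p∈S)

    -- Disjoint parallel edges x q and z u joined by an edge x z: the circuit is x, q, z, u.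
    no-parallel-disjoint : ∀ {x q z u i j k s t s′ t′ c d} → x ∈S → q ∈S → z ∈S → u ∈S →
      Link x q i j s t → Link z u i j s′ t′ → Link x z i k c d → k ≢ j →
      q ≢ z → q ≢ u → x ≢ u → ⊥
    no-parallel-disjoint {x} {q} {z} {u} {i} {j} {k} {s} {t} {s′} {t′} {c} {d} x∈S q∈S z∈S u∈S l l′ l″ k≢j q≢z q≢u x≢u =
      *-nonzero (n≢0 u∈S) (*-nonzero (sign-nonzero l′.sign-s) (sign-nonzero l″.sign-t)) final
      where
      module l = Link l
      module l′ = Link l′
      module l″ = Link l″
      x≢z = l″.distinct
      k≢i : k ≢ i
      k≢i k≡i = l″.i≢j (sym k≡i)
      vi≢0 = v-i≢0 x∈S q∈S l
      vj≢0 = v-j≢0 x∈S q∈S l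
      z-j : lookup z j ≡ lookup x j
      z-j = l″.at-other (λ j≡i → l.i≢j (sym j≡i)) (λ j≡k → k≢j (sym j≡k))
      outside : ∀ {p} → p ∈S → p ≢ x → p ≢ q → p ≢ z → p ≢ u → ⊥
      outside {p} p∈S p≢x p≢q p≢z p≢u = cases (sign-cases l.sign-s l′.sign-s) (sign-cases l.sign-t l′.sign-t)
        where
        P = lookup p i - lookup x i
        Q = lookup p j - lookup x j
        -- Along the edge x q the vertex p is compared with z; for `β`, along the edge z u, it is
        -- compared with x.
        α : v j * s * P + v i * t * Q ≡ v j * s * c
        α = trans (level x∈S q∈S l p∈S p≢x p≢q z∈S (λ z≡x → x≢z (sym z≡x)) (λ z≡q → q≢z (sym z≡q)))
          (trans (cong₂ (λ a b → v j * s * a + v i * t * b) l″.at-i (i≡j⇒i-j≡0 z-j))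
                 (trans (cong (v j * s * c +_) (*-zeroʳ (v i * t))) (+-identityʳ _)))
        β : v j * s′ * P + v i * t′ * Q ≡ 0ℤ
        β = by₁ 1ℤ (level z∈S u∈S l′ p∈S p≢z p≢u x∈S x≢z x≢u)
          (certificate (v j * s′) (v i * t′) (lookup p i) (lookup x i) (lookup z i) (lookup p j) (lookup x j) (lookup z j))
          where
          certificate : ∀ a b p x z p′ x′ z′ → a * (p - x) + b * (p′ - x′) - 0ℤ ≡
            1ℤ * (a * (p - z) + b * (p′ - z′) - (a * (x - z) + b * (x′ - z′)))
          certificate = solve-∀
        vjs≢0 = *-nonzero vj≢0 (sign-nonzero l.sign-s)
        same : v j * s * P + v i * t * Q ≡ 0ℤ → ⊥
        same γ = *-nonzero vjs≢0 (sign-nonzero l″.sign-s) (trans (sym α) γ)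
        -- If the two roots differ in just one relative sign, adding the equations eliminates Q and
        -- leaves 2 P = c, where c = ± 1.
        orthogonal : v j * s * P + v i * - t * Q ≡ 0ℤ → ⊥
        orthogonal γ = sign-not-double l″.sign-s P (i-j≡0⇒i≡j _ _ (*-cancel-0 vjs≢0
            (by₂ 1ℤ 1ℤ α γ (certificate (v j * s) (v i) t P Q c))))
          where
          certificate : ∀ a b t P Q c → a * (P + P - c) - 0ℤ ≡ 1ℤ * (a * P + b * t * Q - a * c) + 1ℤ * (a * P + b * - t * Q - 0ℤ)
          certificate = solve-∀
        negate : ∀ a s b t P Q → a * s * P + b * t * Q - 0ℤ ≡ -1ℤ * (a * - s * P + b * - t * Q - 0ℤ)
        negate = solve-∀
        negate′ : ∀ a s b t P Q → a * s * P + b * - t * Q - 0ℤ ≡ -1ℤ * (a * - s * P + b * t * Q - 0ℤ)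
        negate′ = solve-∀
        cases : s′ ≡ s ⊎ s′ ≡ - s → t′ ≡ t ⊎ t′ ≡ - t → ⊥
        cases (inj₁ refl) (inj₁ refl) = same β
        cases (inj₂ refl) (inj₂ refl) = same (by₁ -1ℤ β (negate (v j) s (v i) t P Q))
        cases (inj₁ refl) (inj₂ refl) = orthogonal β
        cases (inj₂ refl) (inj₁ refl) = orthogonal (by₁ -1ℤ β (negate′ (v j) s (v i) t P Q))
      off-zu : (G : Zm m → ℤ) → G x ≡ 0ℤ → G q ≡ 0ℤ → ∀ {p} → p ∈ M → p ≢ z → p ≢ u → n p * G p ≡ 0ℤ
      off-zu G Gx≡0 Gq≡0 {p} p∈M p≢z p≢u with p ≟v x | p ≟v q
      ... | yes refl | _        = trans (cong (n p *_) Gx≡0) (*-zeroʳ (n p))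
      ... | no _     | yes refl = trans (cong (n p *_) Gq≡0) (*-zeroʳ (n p))
      ... | no p≢x   | no p≢q   = vanish-off (support p∈M) G λ p∈S → outside p∈S p≢x p≢q p≢z p≢u
      K : Zm m → ℤ
      K p = lookup p k - lookup x k
      IK : Zm m → ℤ
      IK p = (lookup p i - lookup x i) * K p
      K-x : K x ≡ 0ℤ
      K-x = i≡j⇒i-j≡0 {lookup x k} refl
      K-q : K q ≡ 0ℤ
      K-q = i≡j⇒i-j≡0 (l.at-other k≢i k≢j)
      K-u : K u ≡ d
      K-u = trans (cong (_- lookup x k) (l′.at-other k≢i k≢j)) l″.at-j
      u-i : lookup u i - lookup x i ≡ s′ + c
      u-i = by₂ 1ℤ 1ℤ l′.at-i l″.at-i (certificate (lookup u i) (lookup x i) (lookup z i) s′ c)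
        where
        certificate : ∀ u x z s c → u - x - (s + c) ≡ 1ℤ * (u - z - s) + 1ℤ * (z - x - c)
        certificate = solve-∀
      -- Only z and u differ from x in coordinate k, both by d. The first moment makes n(z) and n(u)
      -- opposite; their different i-coordinates then contradict the mixed moment.
      first : n z * d + n u * d ≡ 0ℤ
      first = trans (cong₂ (λ a b → n z * a + n u * b) (sym l″.at-j) (sym K-u))
        (trans (sym (∑-only₂ unique (∈M z∈S) (∈M u∈S) l′.distinct (off-zu K K-x K-q))) (first-moment x k))
      mixed : n z * (c * d) + n u * ((s′ + c) * d) ≡ 0ℤ
      mixed = trans (cong₂ (λ a b → n z * a + n u * b) (cong₂ _*_ (sym l″.at-i) (sym l″.at-j)) (cong₂ _*_ (sym u-i) (sym K-u)))
        (trans (sym (∑-only₂ unique (∈M z∈S) (∈M u∈S) l′.distinct (off-zu IK (times-0 (lookup x i - lookup x i) K-x) (times-0 (lookup q i - lookup x i) K-q))))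
               (second-moment-0 x l″.i≢j))
        where
        times-0 : ∀ a {b} → b ≡ 0ℤ → a * b ≡ 0ℤ
        times-0 a refl = *-zeroʳ a
      final : n u * (s′ * d) ≡ 0ℤ
      final = by₂ (- c) 1ℤ first mixed (certificate (n z) (n u) s′ c d)
        where
        certificate : ∀ a b s c d → b * (s * d) - 0ℤ ≡ - c * (a * d + b * d - 0ℤ) + 1ℤ * (a * (c * d) + b * ((s + c) * d) - 0ℤ)
        certificate = solve-∀

    -- Three edges at x on the index pairs ij, ik, jk: a further vertex of the
    -- circuit would solve a linear system having only half-integral solutions.
    no-triangle : ∀ {x q u w i j k a b c d e f} → x ∈S → q ∈S → u ∈S → w ∈S →
      Link x q i j a b → Link x u i k c d → Link x w j k e f → ⊥
    no-triangle {x} {q} {u} {w} {i} {j} {k} {a} {b} {c} {d} {e} {f} x∈S q∈S u∈S w∈S lq lu lw =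
      *-nonzero (n≢0 q∈S) (*-nonzero (sign-nonzero lq.sign-s) (sign-nonzero lq.sign-t)) single
      where
      module lq = Link lq
      module lu = Link lu
      module lw = Link lw
      j≢i : j ≢ i
      j≢i j≡i = lq.i≢j (sym j≡i)
      q-k = i≡j⇒i-j≡0 (lq.at-other {k} (λ k≡i → lu.i≢j (sym k≡i)) (λ k≡j → lw.i≢j (sym k≡j)))
      u-j = i≡j⇒i-j≡0 (lu.at-other {j} j≢i lw.i≢j)
      w-i = i≡j⇒i-j≡0 (lw.at-other {i} lq.i≢j lu.i≢j)
      u≢q : u ≢ q
      u≢q refl = sign-nonzero lq.sign-t (trans (sym lq.at-j) u-j)
      w≢q : w ≢ q
      w≢q refl = sign-nonzero lq.sign-s (trans (sym lq.at-i) w-i)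
      w≢u : w ≢ u
      w≢u refl = sign-nonzero lu.sign-s (trans (sym lu.at-i) w-i)
      q≢x : q ≢ x
      q≢x q≡x = lq.distinct (sym q≡x)
      u≢x : u ≢ x
      u≢x u≡x = lu.distinct (sym u≡x)
      w≢x : w ≢ x
      w≢x w≡x = lw.distinct (sym w≡x)
      at : ∀ A B {g h g′ h′} → g ≡ g′ → h ≡ h′ → A * g + B * h ≡ A * g′ + B * h′
      at A B refl refl = refl
      -- Equating the two right sides gives W b = V a c e, so both weights become V times a sign and
      -- V can be divided out. The polynomial `rest` collects the multiples of 1 - a², 1 - c² and 1
      -- - e².
      normalise : ∀ {V W a b c e P Q} → V ≢ 0ℤ → Sign a → Sign c → Sign e →
                  V * a * P + W * b * Q ≡ V * a * c + W * b * 0ℤ →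
                  V * a * P + W * b * Q ≡ V * a * 0ℤ + W * b * e → c * P + e * Q ≡ 1ℤ
      normalise {V} {W} {a} {b} {c} {e} {P} {Q} V≢0 sa sc se h₁ h₂ = i-j≡0⇒i≡j _ _ (*-cancel-0 V≢0
        (trans (certificate V W a b c e P Q)
          (trans (cong₂ (λ x y → a * c * x + (y - x) * e * a * c * Q + rest (1ℤ - a * a) (1ℤ - c * c) (1ℤ - e * e))
                   (i≡j⇒i-j≡0 h₁) (i≡j⇒i-j≡0 h₂))
          (trans (cong (λ r → a * c * 0ℤ + (0ℤ - 0ℤ) * e * a * c * Q + r)
                   (trans (cong₂ (λ x y → rest x y (1ℤ - e * e)) (one sa) (one sc)) (cong (rest 0ℤ 0ℤ) (one se))))
                 (zeros V W a b c e P Q)))))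
        where
        rest : ℤ → ℤ → ℤ → ℤ
        rest A C E = - (W * b * a * c * Q * E) + V * c * P * A + (V * e * Q - V) * (A + a * a * C)
        one : ∀ {s} → Sign s → 1ℤ - s * s ≡ 0ℤ
        one ss = i≡j⇒i-j≡0 (sym (sign-square ss))
        certificate : ∀ V W a b c e P Q → V * (c * P + e * Q - 1ℤ) ≡
          a * c * (V * a * P + W * b * Q - (V * a * c + W * b * 0ℤ))
          + (V * a * P + W * b * Q - (V * a * 0ℤ + W * b * e) - (V * a * P + W * b * Q - (V * a * c + W * b * 0ℤ))) * e * a * c * Q
          + (- (W * b * a * c * Q * (1ℤ - e * e)) + V * c * P * (1ℤ - a * a) + (V * e * Q - V) * (1ℤ - a * a + a * a * (1ℤ - c * c)))
        certificate = solve-∀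
        zeros : ∀ V W a b c e P Q → a * c * 0ℤ + (0ℤ - 0ℤ) * e * a * c * Q
          + (- (W * b * a * c * Q * 0ℤ) + V * c * P * 0ℤ + (V * e * Q - V) * (0ℤ + a * a * 0ℤ)) ≡ 0ℤ
        zeros = solve-∀
      outside : ∀ {p} → p ∈S → p ≢ x → p ≢ q → p ≢ u → p ≢ w → ⊥
      outside {p} p∈S p≢x p≢q p≢u p≢w with sign-sum-even lq.sign-s lu.sign-s | sign-sum-even lq.sign-t lw.sign-s | sign-sum-even lu.sign-t lw.sign-t
      -- The sum of `eq₁`, `eq₂` and `eq₃` has the even coefficients a + c, b + e, d + f on its left
      -- and 3 on its right. Subtracting 2 turns it into a double equal to 1.
      ... | h , eh | h′ , eh′ | h″ , eh″ = no-half (h * P + h′ * Q + h″ * R - 1ℤ)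
        (trans (certificate₁ h h′ h″ P Q R) (trans (cong₂ (λ x y → x * P + y * Q + (h″ + h″) * R - 1ℤ - 1ℤ) (sym eh) (sym eh′))
          (trans (cong (λ x → (a + c) * P + (b + e) * Q + x * R - 1ℤ - 1ℤ) (sym eh″))
          (trans (certificate₂ a b c d e f P Q R) (trans (cong₂ (λ x y → x + y + (b * Q + d * R) - 1ℤ - 1ℤ) eq₁ eq₂)
                 (cong (λ x → 1ℤ + 1ℤ + x - 1ℤ - 1ℤ) eq₃))))))
        where
        P = lookup p i - lookup x i
        Q = lookup p j - lookup x j
        R = lookup p k - lookup x k
        eq₁ : c * P + e * Q ≡ 1ℤ
        eq₁ = normalise {W = v i} {b = b} (v-j≢0 x∈S q∈S lq) lq.sign-s lu.sign-s lw.sign-s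
          (trans (level x∈S q∈S lq p∈S p≢x p≢q u∈S u≢x u≢q) (at (v j * a) (v i * b) lu.at-i u-j))
          (trans (level x∈S q∈S lq p∈S p≢x p≢q w∈S w≢x w≢q) (at (v j * a) (v i * b) w-i lw.at-i))
        eq₂ : a * P + f * R ≡ 1ℤ
        eq₂ = normalise {W = v i} {b = d} (v-j≢0 x∈S u∈S lu) lu.sign-s lq.sign-s lw.sign-t
          (trans (level x∈S u∈S lu p∈S p≢x p≢u q∈S q≢x (λ q≡u → u≢q (sym q≡u))) (at (v k * c) (v i * d) lq.at-i q-k))
          (trans (level x∈S u∈S lu p∈S p≢x p≢u w∈S w≢x w≢u) (at (v k * c) (v i * d) w-i lw.at-j))
        eq₃ : b * Q + d * R ≡ 1ℤ
        eq₃ = normalise {W = v j} {b = f} (v-j≢0 x∈S w∈S lw) lw.sign-s lq.sign-t lu.sign-t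
          (trans (level x∈S w∈S lw p∈S p≢x p≢w q∈S q≢x (λ q≡w → w≢q (sym q≡w))) (at (v k * e) (v j * f) lq.at-j q-k))
          (trans (level x∈S w∈S lw p∈S p≢x p≢w u∈S u≢x (λ u≡w → w≢u (sym u≡w))) (at (v k * e) (v j * f) u-j lu.at-j))
        certificate₁ : ∀ h h′ h″ P Q R → h * P + h′ * Q + h″ * R - 1ℤ + (h * P + h′ * Q + h″ * R - 1ℤ) ≡
                       (h + h) * P + (h′ + h′) * Q + (h″ + h″) * R - 1ℤ - 1ℤ
        certificate₁ = solve-∀
        certificate₂ : ∀ a b c d e f P Q R → (a + c) * P + (b + e) * Q + (d + f) * R - 1ℤ - 1ℤ ≡
                       c * P + e * Q + (a * P + f * R) + (b * Q + d * R) - 1ℤ - 1ℤ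
        certificate₂ = solve-∀
      G : Zm m → ℤ
      G p = (lookup p i - lookup x i) * (lookup p j - lookup x j)
      -- The mixed moment of i and j sees q alone: u keeps coordinate j, w keeps coordinate i, and
      -- there is no further circuit vertex.
      off-q : ∀ {p} → p ∈ M → p ≢ q → n p * G p ≡ 0ℤ
      off-q {p} p∈M p≢q with p ≟v x | p ≟v u | p ≟v w
      ... | yes refl | _ | _ = trans (cong (n p *_) (trans (cong (_* (lookup x j - lookup x j)) (i≡j⇒i-j≡0 {lookup x i} refl)) (*-zeroˡ (lookup x j - lookup x j)))) (*-zeroʳ (n p))
      ... | no _ | yes refl | _ = trans (cong (n p *_) (trans (cong ((lookup p i - lookup x i) *_) u-j) (*-zeroʳ (lookup p i - lookup x i)))) (*-zeroʳ (n p))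
      ... | no _ | no _ | yes refl = trans (cong (n p *_) (trans (cong (_* (lookup p j - lookup x j)) w-i) (*-zeroˡ (lookup p j - lookup x j)))) (*-zeroʳ (n p))
      ... | no p≢x | no p≢u | no p≢w = vanish-off (support p∈M) G λ p∈S → outside p∈S p≢x p≢q p≢u p≢w
      single : n q * (a * b) ≡ 0ℤ
      single = trans (cong (n q *_) (cong₂ _*_ (sym lq.at-i) (sym lq.at-j)))
        (trans (sym (∑-only unique (∈M q∈S) off-q)) (second-moment-0 x lq.i≢j))

  -- Growing a connected graph and retracting it to the circuit.

  adj-sym : ∀ {m} {x y : Zm m} → Adj x y → Adj y x
  adj-sym (i , j , s , t , l) = i , j , - s , - t , link-reverse l

  EdgeIn : ∀ {m} → List (Zm m) → Zm m → Zm m → Set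
  EdgeIn L x y = x ∈ L × y ∈ L × Adj x y

  data Grown {m} (s : Zm m) : List (Zm m) → Set where
    seed : Grown s (s ∷ [])
    grow : ∀ {L x y} → Grown s L → y ∉ L → x ∈ L → Adj x y → Grown s (y ∷ L)

  grown-unique : ∀ {m} {s : Zm m} {L} → Grown s L → Unique L
  grown-unique seed             = [] ∷ []
  grown-unique (grow g y∉L _ _) = ¬Any⇒All¬ _ y∉L ∷ grown-unique g

  grown-connected : ∀ {m} {s : Zm m} {L} → Grown s L → ∀ {p} → p ∈ L → Star (EdgeIn L) s p
  grown-connected seed (here refl) = ε
  grown-connected (grow g _ x∈L x~y) (here refl) =
    Star.map (λ (a , b , e) → there a , there b , e) (grown-connected g x∈L) ◅◅ (there x∈L , here refl , x~y) ◅ ε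
  grown-connected (grow g _ _ _) (there p∈L) = Star.map (λ (a , b , e) → there a , there b , e) (grown-connected g p∈L)

  path : ∀ {m} {s : Zm m} {L} → Grown s L → ∀ {x y} → x ∈ L → y ∈ L → Star (EdgeIn L) x y
  path g x∈L y∈L = Star.reverse (λ (a , b , e) → b , a , adj-sym e) (grown-connected g x∈L) ◅◅ grown-connected g y∈L

  grow-along : ∀ {m} {s : Zm m} {B L x y} → Grown s L → L ⊆ B → x ∈ L → Star (EdgeIn B) x y →
               ∃[ L′ ] (Grown s L′ × L ⊆ L′ × L′ ⊆ B × y ∈ L′)
  grow-along g L⊆B x∈L ε = _ , g , id , L⊆B , x∈L
  grow-along {L = L} g L⊆B x∈L (_◅_ {j = z} (_ , z∈B , e) rest) with DecMembership._∈?_ _≟v_ z L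
  ... | yes z∈L = grow-along g L⊆B z∈L rest
  ... | no  z∉L with grow-along (grow g z∉L x∈L e) (λ { (here refl) → z∈B ; (there p∈L) → L⊆B p∈L }) (here refl) rest
  ...   | L′ , g′ , L⊆L′ , L′⊆B , y∈L′ = L′ , g′ , L⊆L′ ∘ there , L′⊆B , y∈L′

  grow-all : ∀ {m} {s : Zm m} {B L} → Grown s L → L ⊆ B → s ∈ L → (Q : List (Zm m)) → (∀ {p} → p ∈ Q → Star (EdgeIn B) s p) →
             ∃[ L′ ] (Grown s L′ × L ⊆ L′ × L′ ⊆ B × Q ⊆ L′)
  grow-all g L⊆B s∈L []      paths = _ , g , id , L⊆B , λ ()
  grow-all g L⊆B s∈L (p ∷ Q) paths with grow-all g L⊆B s∈L Q (paths ∘ there)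
  ... | L₁ , g₁ , L⊆L₁ , L₁⊆B , Q⊆L₁ with grow-along g₁ L₁⊆B (L⊆L₁ s∈L) (paths (here refl))
  ...   | L₂ , g₂ , L₁⊆L₂ , L₂⊆B , p∈L₂ = L₂ , g₂ , L₁⊆L₂ ∘ L⊆L₁ , L₂⊆B , λ { (here refl) → p∈L₂ ; (there r∈Q) → L₁⊆L₂ (Q⊆L₁ r∈Q) }

  spanning : ∀ {m} {s : Zm m} {B} → s ∈ B → (∀ {p} → p ∈ B → Star (EdgeIn B) s p) → ∃[ L ] (Grown s L × L ⊆ B × B ⊆ L)
  spanning s∈B paths with grow-all seed (λ { (here refl) → s∈B }) (here refl) _ paths
  ... | L , g , _ , L⊆B , B⊆L = L , g , L⊆B , B⊆L

  -- Applied with g a coordinate, to find an edge moving it, and with g the test for being x, to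
  -- find an edge leaving x.
  changing-edge : ∀ {m} {X : Set} (_≟X_ : DecidableEquality X) {L : List (Zm m)} (g : Zm m → X) {x y} →
                  Star (EdgeIn L) x y → g x ≢ g y → ∃[ a ] ∃[ b ] (EdgeIn L a b × g a ≢ g b)
  changing-edge _≟X_ g ε gx≢gy = ⊥-elim (gx≢gy refl)
  changing-edge _≟X_ g {x} (_◅_ {j = z} e rest) gx≢gy with g x ≟X g z
  ... | no gx≢gz  = x , z , e , gx≢gz
  ... | yes gx≡gz = changing-edge _≟X_ g rest (λ gz≡gy → gx≢gy (trans gx≡gz gz≡gy))

  -- ρ moves every vertex along a tree to the nearest ancestor at which n is nonzero.
  data Chain {m} (L : List (Zm m)) (ρ : Zm m → Zm m) : Zm m → Set where
    stop : ∀ {p} → p ∈ L → ρ p ≡ p → Chain L ρ p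
    next : ∀ {p p′} → p ∈ L → p′ ∈ L → Adj p′ p → ρ p′ ≡ ρ p → Chain L ρ p′ → Chain L ρ p

  record Retraction {m} (n : Zm m → ℤ) (L : List (Zm m)) : Set where
    field
      ρ     : Zm m → Zm m
      into  : ∀ {p} → p ∈ L → ρ p ∈ L × n (ρ p) ≢ 0ℤ
      fixes : ∀ {p} → p ∈ L → n p ≢ 0ℤ → ρ p ≡ p
      chain : ∀ {p} → p ∈ L → Chain L ρ p

  module _ {m : ℕ} (ρ : Zm m → Zm m) (y z : Zm m) where
    update : Zm m → Zm m
    update p with p ≟v y
    ... | yes _ = z
    ... | no  _ = ρ p

    update-same : update y ≡ z
    update-same with y ≟v y
    ... | yes _  = refl
    ... | no y≢y = ⊥-elim (y≢y refl)

    update-other : ∀ {L p} → y ∉ L → p ∈ L → update p ≡ ρ p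
    update-other {p = p} y∉L p∈L with p ≟v y
    ... | yes refl = ⊥-elim (y∉L p∈L)
    ... | no _     = refl

    update-chain : ∀ {L p} → y ∉ L → Chain L ρ p → Chain (y ∷ L) update p
    update-chain y∉L (stop p∈L eq) = stop (there p∈L) (trans (update-other y∉L p∈L) eq)
    update-chain y∉L (next p∈L p′∈L e eq c) = next (there p∈L) (there p′∈L) e
      (trans (update-other y∉L p′∈L) (trans eq (sym (update-other y∉L p∈L)))) (update-chain y∉L c)

  -- The root is on the circuit, so an ancestor on the circuit always exists. A new vertex stays put
  -- or, if n vanishes there, goes where its parent goes.
  retraction : ∀ {m} {n : Zm m → ℤ} {s L} → n s ≢ 0ℤ → Grown s L → Retraction n L
  retraction {s = s} ns≢0 seed = record
    { ρ = id ; into = λ { (here refl) → here refl , ns≢0 } ; fixes = λ _ _ → refl ; chain = λ { (here refl) → stop (here refl) refl } }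
  retraction {n = n} ns≢0 (grow {L} {x} {y} g y∉L x∈L x~y) = extend (n y ≟ 0ℤ)
    where
    open Retraction (retraction {n = n} ns≢0 g)
    module _ {z} (z∈ : z ∈ y ∷ L) (nz≢0 : n z ≢ 0ℤ) where
      ρ′ = update ρ y z
      into′ : ∀ {p} → p ∈ y ∷ L → ρ′ p ∈ y ∷ L × n (ρ′ p) ≢ 0ℤ
      into′ (here refl) rewrite update-same ρ y z = z∈ , nz≢0
      into′ (there p∈L) rewrite update-other ρ y z y∉L p∈L = there (proj₁ (into p∈L)) , proj₂ (into p∈L)
    extend : Dec (n y ≡ 0ℤ) → Retraction n (y ∷ L)
    extend (no ny≢0) = record
      { ρ = ρ′ y∈ ny≢0 ; into = into′ y∈ ny≢0
      ; fixes = λ { (here refl) _ → update-same ρ y y ; (there p∈L) np≢0 → trans (update-other ρ y y y∉L p∈L) (fixes p∈L np≢0) }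
      ; chain = λ { (here refl) → stop y∈ (update-same ρ y y) ; (there p∈L) → update-chain ρ y y y∉L (chain p∈L) } }
      where
      y∈ : y ∈ y ∷ L
      y∈ = here refl
    extend (yes ny≡0) = record
      { ρ = ρ′ z∈ nz≢0 ; into = into′ z∈ nz≢0
      ; fixes = λ { (here refl) ny≢0 → ⊥-elim (ny≢0 ny≡0) ; (there p∈L) np≢0 → trans (update-other ρ y z y∉L p∈L) (fixes p∈L np≢0) }
      ; chain = λ { (here refl) → next (here refl) (there x∈L) x~y (trans (update-other ρ y z y∉L x∈L) (sym (update-same ρ y z)))
                                    (update-chain ρ y z y∉L (chain x∈L))
                  ; (there p∈L) → update-chain ρ y z y∉L (chain p∈L) } }
      where
      z = ρ x
      z∈ : z ∈ y ∷ L
      z∈ = there (proj₁ (into x∈L))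
      nz≢0 = proj₂ (into x∈L)

  chain-map : ∀ {m} {L L′ : List (Zm m)} {ρ p} → L′ ⊆ L → Chain L′ ρ p → Chain L ρ p
  chain-map sub (stop p∈L′ eq)            = stop (sub p∈L′) eq
  chain-map sub (next p∈L′ p′∈L′ e eq c) = next (sub p∈L′) (sub p′∈L′) e eq (chain-map sub c)

  -- The original root may lie off the circuit, so the same vertices are grown anew from s.
  retraction-from : ∀ {m} {n : Zm m → ℤ} {L s₀ s} → Grown s₀ L → s ∈ L → n s ≢ 0ℤ → Retraction n L
  retraction-from {n = n} g s∈L ns≢0 with spanning s∈L (path g s∈L)
  ... | L′ , g′ , L′⊆L , L⊆L′ = record
    { ρ = ρ ; into = λ p∈L → L′⊆L (proj₁ (into (L⊆L′ p∈L))) , proj₂ (into (L⊆L′ p∈L))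
    ; fixes = λ p∈L → fixes (L⊆L′ p∈L) ; chain = λ p∈L → chain-map L′⊆L (chain (L⊆L′ p∈L)) }
    where open Retraction (retraction {n = n} ns≢0 g′)

  -- Contraction to the circuit by a rounded linear map.

  indicator-cong : ∀ {P Q : Set} (d : Dec P) (d′ : Dec Q) → (P → Q) → (Q → P) → indicator d ≡ indicator d′
  indicator-cong (yes p) d′ f g = sym (indicator-yes d′ (f p))
  indicator-cong (no ¬p) d′ f g = sym (indicator-no d′ (λ q → ¬p (g q)))

  δ-sym : ∀ {m} (i k : Fin m) → δ i k ≡ δ k i
  δ-sym i k = indicator-cong (i Fin.≟ k) (k Fin.≟ i) sym sym

  δ-suc : ∀ {m} (i k : Fin m) → δ (suc i) (suc k) ≡ δ i k
  δ-suc i k = indicator-cong (suc i Fin.≟ suc k) (i Fin.≟ k) (λ { refl → refl }) (cong suc)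

  hom-link : ∀ {m} {x y : Zm m} {i j s t} → Link x y i j s t → ∀ k → hom y k ≡ hom x k + (s * δ (suc i) k + t * δ (suc j) k)
  hom-link {s = s} {t} l zero = sym (collect s t)
    where
    collect : ∀ s t → 1ℤ + (s * 0ℤ + t * 0ℤ) ≡ 1ℤ
    collect = solve-∀
  hom-link {x = x} {i = i} {j} {s} {t} l (suc k) = trans (Link.shift l k)
    (sym (cong₂ (λ a b → lookup x k + (s * a + t * b)) (δ-suc i k) (δ-suc j k)))

  app-link : ∀ {m} (f : Functional m) {x y i j s t} → Link x y i j s t → app f y ≡ app f x + (s * f (suc i) + t * f (suc j))
  app-link {m} f {x} {y} {i} {j} {s} {t} l = begin
    app f y
      ≡⟨ ∑-cong K (λ {k} _ → trans (cong (f k *_) (hom-link l k)) (distribute (f k) (hom x k) s (δ (suc i) k) t (δ (suc j) k))) ⟩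
    ∑ K (λ k → f k * hom x k + (s * (f k * δ (suc i) k) + t * (f k * δ (suc j) k)))
      ≡⟨ trans (∑-+ K _ _) (cong (app f x +_) (trans (∑-+ K _ _) (cong₂ _+_
           (trans (∑-* K s _) (cong (s *_) (∑δ f (suc i)))) (trans (∑-* K t _) (cong (t *_) (∑δ f (suc j))))))) ⟩
    app f x + (s * f (suc i) + t * f (suc j)) ∎
    where
    K = coords (suc m)
    distribute : ∀ f h s a t b → f * (h + (s * a + t * b)) ≡ f * h + (s * (f * a) + t * (f * b))
    distribute = solve-∀

  -- Rounds D e_i to e_i, - D e_i to - e_i and everything else to 0.
  module Truncation {m : ℕ} {D : ℤ} (D≢0 : D ≢ 0ℤ) where
    positive? : (r : Fin m → ℤ) (i : Fin m) → Dec (∀ k → r k ≡ D * δ i k)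
    positive? r i = all? (λ k → r k ≟ D * δ i k)

    negative? : (r : Fin m → ℤ) (i : Fin m) → Dec (∀ k → r k ≡ - (D * δ i k))
    negative? r i = all? (λ k → r k ≟ - (D * δ i k))

    trunc : (Fin m → ℤ) → Fin m → ℤ
    trunc r k = indicator (positive? r k) - indicator (negative? r k)

    trunc-cong : ∀ {r r′} → (∀ k → r k ≡ r′ k) → ∀ k → trunc r k ≡ trunc r′ k
    trunc-cong {r} {r′} eq k = cong₂ _-_
      (indicator-cong (positive? r k) (positive? r′ k) (λ p l → trans (sym (eq l)) (p l)) (λ p l → trans (eq l) (p l)))
      (indicator-cong (negative? r k) (negative? r′ k) (λ p l → trans (sym (eq l)) (p l)) (λ p l → trans (eq l) (p l)))

    neg-swap : ∀ {a b c} → a ≡ - b → b ≡ c → a ≡ - c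
    neg-swap refl refl = refl

    neg-swap′ : ∀ {a b c} → b ≡ - a → b ≡ - c → a ≡ c
    neg-swap′ {a} {b} {c} p q = by₁ -1ℤ (trans (sym p) q) (certificate a c)
      where
      certificate : ∀ a c → a - c ≡ -1ℤ * (- a - - c)
      certificate = solve-∀

    -- On a contracted edge the images of e_i and e_j are equal or opposite. Rounding preserves this
    -- by `trunc-cong` and by its oddness, so the edge stays contracted.
    trunc-neg : ∀ {r r′} → (∀ k → r′ k ≡ - r k) → ∀ k → trunc r′ k ≡ - trunc r k
    trunc-neg {r} {r′} eq k = trans (cong₂ _-_
      (indicator-cong (positive? r′ k) (negative? r k) (λ p l → neg-swap (back l) (p l)) (λ p l → neg-swap′ (back l) (p l)))
      (indicator-cong (negative? r′ k) (positive? r k) (λ p l → neg-swap′ (eq l) (p l)) (λ p l → neg-swap (eq l) (p l))))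
      (flip (indicator (negative? r k)) (indicator (positive? r k)))
      where
      back : ∀ l → r l ≡ - r′ l
      back l = by₁ 1ℤ (eq l) (certificate (r l) (r′ l))
        where
        certificate : ∀ a b → a - - b ≡ 1ℤ * (b - - a)
        certificate = solve-∀
      flip : ∀ a b → a - b ≡ - (b - a)
      flip = solve-∀

    trunc-unit : ∀ {r i} → (∀ k → r k ≡ D * δ i k) → ∀ k → trunc r k ≡ δ i k
    trunc-unit {r} {i} eq k with i Fin.≟ k
    ... | yes refl = cong₂ _-_ (indicator-yes (positive? r i) eq) (indicator-no (negative? r i) not-negative)
      where
      r-i : r i ≡ D
      r-i = trans (eq i) (trans (cong (D *_) (δ-same i)) (*-identityʳ D))
      not-negative : ¬ (∀ k → r k ≡ - (D * δ i k))
      not-negative neg = D≢0 (*-cancel-0 {1ℤ + 1ℤ} (λ ())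
        (by₂ 1ℤ -1ℤ (trans (neg i) (cong (λ a → - (D * a)) (δ-same i))) r-i (certificate D (r i))))
        where
        certificate : ∀ D r → (1ℤ + 1ℤ) * D - 0ℤ ≡ 1ℤ * (r - - (D * 1ℤ)) + -1ℤ * (r - D)
        certificate = solve-∀
    ... | no i≢k = cong₂ _-_ (indicator-no (positive? r k) λ p → D≢0 (trans (sym (D* (δ-same k))) (trans (sym (p k)) r-k)))
                             (indicator-no (negative? r k) λ p → D≢0 (neg-swap′ {D} {0ℤ} {0ℤ} (trans (sym r-k) (trans (p k) (cong -_ (D* (δ-same k))))) refl))
      where
      r-k : r k ≡ 0ℤ
      r-k = trans (eq k) (trans (cong (D *_) (δ-diff i≢k)) (*-zeroʳ D))
      D* : ∀ {b} → b ≡ 1ℤ → D * b ≡ D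
      D* refl = *-identityʳ D

    trunc-shape : ∀ r → (∀ k → trunc r k ≡ 0ℤ) ⊎ ∃[ i ] ∃[ c ] (Sign c × ∀ k → trunc r k ≡ c * δ i k)
    trunc-shape r with any? (positive? r)
    ... | yes (i , eq) = inj₂ (i , 1ℤ , inj₁ refl , λ k → trans (trunc-unit eq k) (sym (*-identityˡ (δ i k))))
    ... | no ¬positive with any? (negative? r)
    ...   | yes (i , eq) = inj₂ (i , -1ℤ , inj₂ refl , λ k → trans (trunc-neg {λ l → D * δ i l} {r} eq k)
                             (trans (cong -_ (trunc-unit {λ l → D * δ i l} (λ _ → refl) k)) (minus (δ i k))))
      where
      minus : ∀ a → - a ≡ -1ℤ * a
      minus = solve-∀
    ...   | no ¬negative = inj₁ λ k → cong₂ _-_ (indicator-no (positive? r k) (λ p → ¬positive (k , p)))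
                                                 (indicator-no (negative? r k) (λ p → ¬negative (k , p)))

  size : ∀ {m} → Zm m → ℤ
  size {m} p = ∑ (coords m) (lookup p)

  Layered : ∀ {m} → Zm m → Set
  Layered p = size p ≡ 0ℤ ⊎ size p ≡ 1ℤ + 1ℤ

  -- The coordinate sum would change by ± 1, while its only values are 0 and 2.
  not-unit : ∀ {m} {x y : Zm m} {i c} → Layered x → Layered y → Sign c → ¬ (∀ k → lookup y k ≡ lookup x k + c * δ i k)
  not-unit {m} {x} {y} {i} {c} layer-x layer-y sc eq = cases layer-x layer-y sc size-y
    where
    size-y : size y ≡ size x + c
    size-y = trans (∑-cong (coords m) (λ {k} _ → eq k)) (trans (∑-+ (coords m) (lookup x) _)
               (cong (size x +_) (∑δ (λ _ → c) i)))
    cases : ∀ {a b c} → a ≡ 0ℤ ⊎ a ≡ 1ℤ + 1ℤ → b ≡ 0ℤ ⊎ b ≡ 1ℤ + 1ℤ → Sign c → b ≢ a + c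
    cases (inj₁ refl) (inj₁ refl) (inj₁ refl) ()
    cases (inj₁ refl) (inj₁ refl) (inj₂ refl) ()
    cases (inj₁ refl) (inj₂ refl) (inj₁ refl) ()
    cases (inj₁ refl) (inj₂ refl) (inj₂ refl) ()
    cases (inj₂ refl) (inj₁ refl) (inj₁ refl) ()
    cases (inj₂ refl) (inj₁ refl) (inj₂ refl) ()
    cases (inj₂ refl) (inj₂ refl) (inj₁ refl) ()
    cases (inj₂ refl) (inj₂ refl) (inj₂ refl) ()

  sign-* : ∀ a b → Sign a → Sign b → Sign (a * b)
  sign-* _ _ (inj₁ refl) (inj₁ refl) = inj₁ refl
  sign-* _ _ (inj₁ refl) (inj₂ refl) = inj₂ refl
  sign-* _ _ (inj₂ refl) (inj₁ refl) = inj₂ refl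
  sign-* _ _ (inj₂ refl) (inj₂ refl) = inj₁ refl

  module Retract {m : ℕ} {L : List (Zm m)} {q : Zm m} (unique : Unique (q ∷ L)) (dual : Dual L)
                 (resonant : Resonant (q ∷ L)) (undoubled : ∀ {x y : Zm m} → x ∈ q ∷ L → y ∈ q ∷ L → ¬ Doubled x y)
                 (layered : ∀ {x : Zm m} → x ∈ q ∷ L → Layered x)
                 {n : Zm m → ℤ} (relation : Relation n (q ∷ L)) (nq≢0 : n q ≢ 0ℤ) (ret : Retraction n L) where
    open Dual dual
    open Retraction ret
    open Circuit unique {n} relation
      (λ {r} rel → relations-proportional unique dual {n} {r} relation rel nq≢0) resonant undoubled public
    open Truncation {m} D≢0

    private
      displacement : Zm m → Fin m → ℤ
      displacement p k = lookup (ρ p) k - lookup p k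

    -- D times the k-th coordinate of the image of e_a under the linear part of
    -- the affine map taking every p in L to ρ p.
    image : Fin m → Fin m → ℤ
    image a k = D * δ a k + ∑ L (λ p → displacement p k * φ p (suc a))

    -- The interpolated affine map takes x and y to the same point, so its linear part kills y - x.
    image-link : ∀ {x y i j s t} → x ∈ L → y ∈ L → Link x y i j s t → ρ x ≡ ρ y → ∀ k → s * image i k + t * image j k ≡ 0ℤ
    image-link {x} {y} {i} {j} {s} {t} x∈L y∈L l ρx≡ρy k = begin
      s * image i k + t * image j k
        ≡⟨ distribute s t D (δ i k) (δ j k) (∑ L (term i)) (∑ L (term j)) ⟩
      D * (s * δ i k + t * δ j k) + (s * ∑ L (term i) + t * ∑ L (term j))
        ≡⟨ cong₂ _+_ (cong (D *_) step-k) sums ⟩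
      D * (lookup y k - lookup x k) + (displacement y k * D + -1ℤ * (displacement x k * D))
        ≡⟨ cong (λ z → D * (lookup y k - lookup x k) + ((lookup z k - lookup y k) * D + -1ℤ * (displacement x k * D))) (sym ρx≡ρy) ⟩
      D * (lookup y k - lookup x k) + ((lookup (ρ x) k - lookup y k) * D + -1ℤ * ((lookup (ρ x) k - lookup x k) * D))
        ≡⟨ collect D (lookup y k) (lookup x k) (lookup (ρ x) k) ⟩
      0ℤ ∎
      where
      term : Fin m → Zm m → ℤ
      term a p = displacement p k * φ p (suc a)
      distribute : ∀ s t D a b A B → s * (D * a + A) + t * (D * b + B) ≡ D * (s * a + t * b) + (s * A + t * B)
      distribute = solve-∀
      collect : ∀ D y x r → D * (y - x) + ((r - y) * D + -1ℤ * ((r - x) * D)) ≡ 0ℤ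
      collect = solve-∀
      step-k : s * δ i k + t * δ j k ≡ lookup y k - lookup x k
      step-k = by₁ -1ℤ (Link.shift l k) (certificate (lookup x k) (lookup y k) (s * δ i k + t * δ j k))
        where
        certificate : ∀ x y d → d - (y - x) ≡ -1ℤ * (y - (x + d))
        certificate = solve-∀
      pointwise : ∀ p → s * term i p + t * term j p ≡ displacement p k * app (φ p) y + -1ℤ * (displacement p k * app (φ p) x)
      pointwise p = sym (trans (cong (λ a → displacement p k * a + -1ℤ * (displacement p k * app (φ p) x)) (app-link (φ p) l))
                         (certificate (displacement p k) (app (φ p) x) s t (φ p (suc i)) (φ p (suc j))))
        where
        certificate : ∀ d x s t a b → d * (x + (s * a + t * b)) + -1ℤ * (d * x) ≡ s * (d * a) + t * (d * b)
        certificate = solve-∀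
      sums : s * ∑ L (term i) + t * ∑ L (term j) ≡ displacement y k * D + -1ℤ * (displacement x k * D)
      sums = begin
        s * ∑ L (term i) + t * ∑ L (term j)
          ≡⟨ sym (trans (∑-+ L _ _) (cong₂ _+_ (∑-* L s (term i)) (∑-* L t (term j)))) ⟩
        ∑ L (λ p → s * term i p + t * term j p)
          ≡⟨ ∑-cong L (λ {p} _ → pointwise p) ⟩
        ∑ L (λ p → displacement p k * app (φ p) y + -1ℤ * (displacement p k * app (φ p) x))
          ≡⟨ trans (∑-+ L _ _) (cong (∑ L (λ p → displacement p k * app (φ p) y) +_) (∑-* L -1ℤ _)) ⟩
        ∑ L (λ p → displacement p k * app (φ p) y) + -1ℤ * ∑ L (λ p → displacement p k * app (φ p) x)
          ≡⟨ cong₂ (λ a b → a + -1ℤ * b) (expand (tail unique) y∈L (λ p → displacement p k)) (expand (tail unique) x∈L (λ p → displacement p k)) ⟩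
        displacement y k * D + -1ℤ * (displacement x k * D) ∎

    -- `φ o` is zero at the circuit vertices: in L by duality, at q because n(o) = 0 in the
    -- relation. Evaluated on the weights n(p) (p_a - q_a), whose moment is v_a e_a, it gives 0 on
    -- one side and v_a times its a-th coefficient on the other.
    dual-vanishes : ∀ {a o} → v a ≢ 0ℤ → o ∈ L → n o ≡ 0ℤ → φ o (suc a) ≡ 0ℤ
    dual-vanishes {a} {o} va≢0 o∈L no≡0 = *-cancel-0 va≢0 (begin
      v a * φ o (suc a)
        ≡⟨ *-comm (v a) (φ o (suc a)) ⟩
      φ o (suc a) * v a
        ≡⟨ sym (trans (∑-cong (coords (suc m)) (λ {k} _ → moments-δ k)) (∑δ (λ k → φ o k * v a) (suc a))) ⟩
      ∑ (coords (suc m)) (λ k → φ o k * moments a k)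
        ≡⟨ sym (∑-cong (coords (suc m)) (λ {k} _ → cong (φ o k *_) (moment q a k))) ⟩
      ∑ (coords (suc m)) (λ k → φ o k * ∑ (q ∷ L) (λ p → n p * (lookup p a - lookup q a) * hom p k))
        ≡⟨ sym (∑-app (q ∷ L) (λ p → n p * (lookup p a - lookup q a)) (φ o)) ⟩
      ∑ (q ∷ L) (λ p → n p * (lookup p a - lookup q a) * app (φ o) p)
        ≡⟨ ∑-zero (q ∷ L) terms ⟩
      0ℤ ∎)
      where
      moments-δ : ∀ k → φ o k * moments a k ≡ φ o k * v a * δ (suc a) k
      moments-δ zero    = trans (*-zeroʳ (φ o zero)) (sym (*-zeroʳ (φ o zero * v a)))
      moments-δ (suc k) = trans (cong (λ d → φ o (suc k) * (v a * d)) (sym (δ-suc a k))) (sym (*-assoc (φ o (suc k)) (v a) (δ (suc a) (suc k))))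
      φo-q : app (φ o) q ≡ 0ℤ
      φo-q = *-cancel-0 nq≢0 (trans (sym (trans (cong (n q * app (φ o) q +_) (trans (cong (_* D) no≡0) (*-zeroˡ D))) (+-identityʳ _)))
                                    (relation-at unique dual {n} relation o∈L))
      terms : ∀ {p} → p ∈ q ∷ L → n p * (lookup p a - lookup q a) * app (φ o) p ≡ 0ℤ
      terms (here refl) = trans (cong (n q * (lookup q a - lookup q a) *_) φo-q) (*-zeroʳ (n q * (lookup q a - lookup q a)))
      terms {p} (there p∈L) with o ≟v p
      ... | yes refl = trans (cong (λ z → z * (lookup o a - lookup q a) * app (φ o) o) no≡0) (*-zeroˡ (app (φ o) o))
      ... | no o≢p   = trans (cong (n p * (lookup p a - lookup q a) *_) (off o∈L p∈L o≢p)) (*-zeroʳ (n p * (lookup p a - lookup q a)))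

    -- Circuit vertices have no displacement, and the dual functionals of the other vertices do not
    -- see e_a.
    image-unit : ∀ {a} → v a ≢ 0ℤ → ∀ k → image a k ≡ D * δ a k
    image-unit {a} va≢0 k = trans (cong (D * δ a k +_) (∑-zero L terms)) (+-identityʳ _)
      where
      terms : ∀ {p} → p ∈ L → displacement p k * φ p (suc a) ≡ 0ℤ
      terms {p} p∈L with n p ≟ 0ℤ
      ... | yes np≡0 = trans (cong (displacement p k *_) (dual-vanishes va≢0 p∈L np≡0)) (*-zeroʳ (displacement p k))
      ... | no np≢0  = trans (cong (_* φ p (suc a)) (i≡j⇒i-j≡0 (cong (λ z → lookup z k) (fixes p∈L np≢0)))) (*-zeroˡ (φ p (suc a)))

    -- The rounded images define an integral linear map still contracting every
    -- tree edge but sending roots to vectors of ℓ¹-norm at most 2.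
    unit : Fin m → Fin m → ℤ
    unit a = trunc (image a)

    unit-link : ∀ {x y i j s t} → x ∈ L → y ∈ L → Link x y i j s t → ρ x ≡ ρ y → ∀ k → s * unit i k + t * unit j k ≡ 0ℤ
    unit-link {i = i} {j} {s} x∈L y∈L l ρx≡ρy k = cases (sign-cases (Link.sign-s l) (Link.sign-t l)) (image-link x∈L y∈L l ρx≡ρy)
      where
      cases : ∀ {t} → t ≡ s ⊎ t ≡ - s → (∀ k → s * image i k + t * image j k ≡ 0ℤ) → s * unit i k + t * unit j k ≡ 0ℤ
      cases (inj₁ refl) killed = trans (cong (λ z → s * unit i k + s * z) (trunc-neg {image i} {image j} opposite k)) (cancel s (unit i k))
        where
        cancel : ∀ s u → s * u + s * - u ≡ 0ℤ
        cancel = solve-∀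
        opposite : ∀ k → image j k ≡ - image i k
        opposite k = i-j≡0⇒i≡j _ _ (*-cancel-0 (sign-nonzero (Link.sign-s l)) (trans (certificate s (image i k) (image j k)) (killed k)))
          where
          certificate : ∀ s a b → s * (b - - a) ≡ s * a + s * b
          certificate = solve-∀
      cases (inj₂ refl) killed = trans (cong (λ z → s * unit i k + - s * z) (trunc-cong {image j} {image i} same k)) (cancel s (unit i k))
        where
        cancel : ∀ s u → s * u + - s * u ≡ 0ℤ
        cancel = solve-∀
        same : ∀ k → image j k ≡ image i k
        same k = i-j≡0⇒i≡j _ _ (*-cancel-0 (sign-nonzero (sign-neg (Link.sign-s l))) (trans (certificate s (image i k) (image j k)) (killed k)))
          where
          certificate : ∀ s a b → - s * (b - a) ≡ s * a + - s * b
          certificate = solve-∀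

    T : Zm m → Fin m → ℤ
    T p k = ∑ (coords m) (λ a → lookup p a * unit a k)

    T-link : ∀ {x y i j s t} → Link x y i j s t → ∀ k → T y k ≡ T x k + (s * unit i k + t * unit j k)
    T-link {x} {y} {i} {j} {s} {t} l k = begin
      T y k
        ≡⟨ ∑-cong (coords m) (λ {a} _ → trans (cong (_* unit a k) (Link.shift l a)) (distribute (lookup x a) s (δ i a) t (δ j a) (unit a k))) ⟩
      ∑ (coords m) (λ a → lookup x a * unit a k + (s * (unit a k * δ i a) + t * (unit a k * δ j a)))
        ≡⟨ trans (∑-+ (coords m) _ _) (cong (T x k +_) (trans (∑-+ (coords m) _ _) (cong₂ _+_
             (trans (∑-* (coords m) s _) (cong (s *_) (∑δ (λ a → unit a k) i)))
             (trans (∑-* (coords m) t _) (cong (t *_) (∑δ (λ a → unit a k) j)))))) ⟩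
      T x k + (s * unit i k + t * unit j k) ∎
      where
      distribute : ∀ x s a t b u → (x + (s * a + t * b)) * u ≡ x * u + (s * (u * a) + t * (u * b))
      distribute = solve-∀

    T-chain : ∀ {p} → Chain L ρ p → ∀ k → T p k ≡ T (ρ p) k
    T-chain (stop _ ρp≡p) k = cong (λ z → T z k) (sym ρp≡p)
    T-chain {p} (next {p′ = p′} p∈L p′∈L (_ , _ , _ , _ , l) eq c) k = begin
      T p k        ≡⟨ T-link l k ⟩
      T p′ k + _   ≡⟨ cong (T p′ k +_) (unit-link p′∈L p∈L l eq k) ⟩
      T p′ k + 0ℤ  ≡⟨ +-identityʳ (T p′ k) ⟩
      T p′ k       ≡⟨ T-chain c k ⟩
      T (ρ p′) k   ≡⟨ cong (λ z → T z k) eq ⟩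
      T (ρ p) k    ∎

    -- Circuit vertices differ only in coordinates a with v_a ≠ 0, and for those `unit a` is e_a.
    T-S : ∀ {x y} → x ∈S → y ∈S → ∀ k → T y k - T x k ≡ lookup y k - lookup x k
    T-S {x} {y} x∈S y∈S k = begin
      T y k - T x k
        ≡⟨ cong (T y k +_) (sym (-1* (T x k))) ⟩
      T y k + -1ℤ * T x k
        ≡⟨ sym (trans (∑-+ (coords m) _ _) (cong (T y k +_) (∑-* (coords m) -1ℤ _))) ⟩
      ∑ (coords m) (λ a → lookup y a * unit a k + -1ℤ * (lookup x a * unit a k))
        ≡⟨ ∑-cong (coords m) (λ {a} _ → trans (factor (lookup y a) (lookup x a) (unit a k)) (pointwise a)) ⟩
      ∑ (coords m) (λ a → (lookup y a - lookup x a) * δ k a)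
        ≡⟨ ∑δ (λ a → lookup y a - lookup x a) k ⟩
      lookup y k - lookup x k ∎
      where
      -1* : ∀ a → -1ℤ * a ≡ - a
      -1* = solve-∀
      factor : ∀ y x u → y * u + -1ℤ * (x * u) ≡ (y - x) * u
      factor = solve-∀
      pointwise : ∀ a → (lookup y a - lookup x a) * unit a k ≡ (lookup y a - lookup x a) * δ k a
      pointwise a = cases (lookup y a ≟ lookup x a)
        where
        cases : Dec (lookup y a ≡ lookup x a) → (lookup y a - lookup x a) * unit a k ≡ (lookup y a - lookup x a) * δ k a
        cases (yes eq) = trans (cong (_* unit a k) (i≡j⇒i-j≡0 eq)) (trans (*-zeroˡ (unit a k)) (sym (trans (cong (_* δ k a) (i≡j⇒i-j≡0 eq)) (*-zeroˡ (δ k a)))))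
        cases (no neq) = cong ((lookup y a - lookup x a) *_) (trans (trunc-unit {image a} (image-unit (v-nonzero x∈S y∈S neq)) k) (δ-sym a k))

    -- The edge p p′ shrinks to y - x = s `unit i` + t `unit j`, each summand being 0 or ± e_a.
    -- Exactly one nonzero summand is excluded by the coordinate sum, and a total of ± 2 e_a by
    -- `undoubled`; a point or a root remains.
    short : ∀ {p p′ x y} → x ∈S → y ∈S → (∀ k → T p k ≡ T x k) → (∀ k → T p′ k ≡ T y k) → Adj p p′ → x ≡ y ⊎ Adj x y
    short {p} {p′} {x} {y} x∈S y∈S Tp Tp′ (i , j , s , t , l) = cases (trunc-shape (image i)) (trunc-shape (image j))
      where
      open Link l using (sign-s; sign-t)
      y-k : ∀ k → lookup y k ≡ lookup x k + (s * unit i k + t * unit j k)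
      y-k k = by₂ -1ℤ 1ℤ (T-S x∈S y∈S k) (trans (sym (Tp′ k)) (trans (T-link l k) (cong (_+ (s * unit i k + t * unit j k)) (Tp k))))
        (certificate (lookup x k) (lookup y k) (T x k) (T y k) (s * unit i k + t * unit j k))
        where
        certificate : ∀ x y a b d → y - (x + d) ≡ -1ℤ * (b - a - (y - x)) + 1ℤ * (b - (a + d))
        certificate = solve-∀
      layer-x = layered (_∈S.∈M x∈S)
      layer-y = layered (_∈S.∈M y∈S)
      Shape : (Fin m → ℤ) → Set
      Shape u = (∀ k → u k ≡ 0ℤ) ⊎ ∃[ a ] ∃[ c ] (Sign c × ∀ k → u k ≡ c * δ a k)
      cases : Shape (unit i) → Shape (unit j) → x ≡ y ⊎ Adj x y
      cases (inj₁ zero-i) (inj₁ zero-j) = inj₁ (lookup-ext λ k → sym (trans (y-k k)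
        (trans (cong₂ (λ a b → lookup x k + (s * a + t * b)) (zero-i k) (zero-j k)) (drop (lookup x k) s t))))
        where
        drop : ∀ x s t → x + (s * 0ℤ + t * 0ℤ) ≡ x
        drop = solve-∀
      cases (inj₁ zero-i) (inj₂ (b , c , sc , unit-j)) = ⊥-elim (not-unit {x = x} {y} {i = b} {c = t * c} layer-x layer-y (sign-* t c sign-t sc) λ k → trans (y-k k)
        (trans (cong₂ (λ a b → lookup x k + (s * a + t * b)) (zero-i k) (unit-j k)) (drop (lookup x k) s t c (δ b k))))
        where
        drop : ∀ x s t c d → x + (s * 0ℤ + t * (c * d)) ≡ x + t * c * d
        drop = solve-∀
      cases (inj₂ (b , c , sc , unit-i)) (inj₁ zero-j) = ⊥-elim (not-unit {x = x} {y} {i = b} {c = s * c} layer-x layer-y (sign-* s c sign-s sc) λ k → trans (y-k k)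
        (trans (cong₂ (λ a b → lookup x k + (s * a + t * b)) (unit-i k) (zero-j k)) (drop (lookup x k) s t c (δ b k))))
        where
        drop : ∀ x s t c d → x + (s * (c * d) + t * 0ℤ) ≡ x + s * c * d
        drop = solve-∀
      cases (inj₂ (a , c , sc , unit-i)) (inj₂ (b , d , sd , unit-j)) = resolve (a Fin.≟ b)
        where
        y-k′ : ∀ k → lookup y k ≡ lookup x k + (s * c * δ a k + t * d * δ b k)
        y-k′ k = trans (y-k k) (trans (cong₂ (λ u v → lookup x k + (s * u + t * v)) (unit-i k) (unit-j k))
                                      (reassociate (lookup x k) s t c (δ a k) d (δ b k)))
          where
          reassociate : ∀ x s t c a d b → x + (s * (c * a) + t * (d * b)) ≡ x + (s * c * a + t * d * b)
          reassociate = solve-∀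
        same : ∀ e f → Sign e → f ≡ e ⊎ f ≡ - e → (∀ k → lookup y k ≡ lookup x k + (e * δ a k + f * δ a k)) → x ≡ y ⊎ Adj x y
        same e f se (inj₁ refl) eq = ⊥-elim (undoubled-sign {x} {y} {a} {e} (_∈S.∈M x∈S) (_∈S.∈M y∈S) se λ k → trans (eq k) (double (lookup x k) e (δ a k)))
          where
          double : ∀ x e d → x + (e * d + e * d) ≡ x + (e + e) * d
          double = solve-∀
        same e f se (inj₂ refl) eq = inj₁ (lookup-ext λ k → sym (trans (eq k) (cancel (lookup x k) e (δ a k))))
          where
          cancel : ∀ x e d → x + (e * d + - e * d) ≡ x
          cancel = solve-∀
        resolve : Dec (a ≡ b) → x ≡ y ⊎ Adj x y
        resolve (yes refl) = same (s * c) (t * d) (sign-* s c sign-s sc) (sign-cases (sign-* s c sign-s sc) (sign-* t d sign-t sd)) y-k′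
        resolve (no a≢b)   = inj₂ (a , b , s * c , t * d , record { i≢j = a≢b ; sign-s = sign-* s c sign-s sc ; sign-t = sign-* t d sign-t sd ; shift = y-k′ })

  -- The circuit near the neighbour of the last vertex.

  link-unmoved : ∀ {m} {x y : Zm m} {i j s t k} → Link x y i j s t → lookup y k ≢ lookup x k → k ≢ i → k ≡ j
  link-unmoved {j = j} {k = k} l moved k≢i with k Fin.≟ j
  ... | yes k≡j = k≡j
  ... | no k≢j  = ⊥-elim (moved (Link.at-other l k≢i k≢j))

  orient : ∀ {m} {x y : Zm m} {i} → Adj x y → lookup y i ≢ lookup x i → ∃[ k ] ∃[ s ] ∃[ t ] Link x y i k s t
  orient {i = i} (a , b , s , t , l) moved with i Fin.≟ a
  ... | yes refl = b , s , t , l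
  ... | no i≢a with link-unmoved l moved i≢a
  ...   | refl = a , t , s , link-swap l

  module Contradiction {m : ℕ} {L : List (Zm m)} {q : Zm m} (unique : Unique (q ∷ L)) (dual : Dual L)
                 (resonant : Resonant (q ∷ L)) (undoubled : ∀ {x y : Zm m} → x ∈ q ∷ L → y ∈ q ∷ L → ¬ Doubled x y)
                 (layered : ∀ {x : Zm m} → x ∈ q ∷ L → Layered x)
                 {n : Zm m → ℤ} (relation : Relation n (q ∷ L)) (nq≢0 : n q ≢ 0ℤ)
                 {s₀ : Zm m} (grown : Grown s₀ L) (q∉L : q ∉ L) {p₀ : Zm m} (p₀∈L : p₀ ∈ L) (p₀~q : Adj p₀ q) (ret : Retraction n L) where
    open Retract unique dual resonant undoubled layered {n} relation nq≢0 ret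
    open Retraction ret

    record _∈S′ (p : Zm m) : Set where
      constructor in-S′
      field
        ∈L  : p ∈ L
        n≢0 : n p ≢ 0ℤ
    open _∈S′

    into-S : ∀ {p} → p ∈S′ → p ∈S
    into-S p∈ = there (∈L p∈) ,S n≢0 p∈

    q∈S : q ∈S
    q∈S = here refl ,S nq≢0

    ρ-S′ : ∀ {p} → p ∈ L → ρ p ∈S′
    ρ-S′ p∈L = in-S′ (proj₁ (into p∈L)) (proj₂ (into p∈L))

    ≢q : ∀ {p} → p ∈S′ → p ≢ q
    ≢q p∈ refl = q∉L (∈L p∈)

    x : Zm m
    x = ρ p₀

    x∈ : x ∈S′
    x∈ = ρ-S′ p₀∈L

    not-equal : {X : Set} {a b : Zm m} → a ≢ b → a ≡ b ⊎ X → X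
    not-equal a≢b (inj₁ a≡b) = ⊥-elim (a≢b a≡b)
    not-equal a≢b (inj₂ e)   = e

    -- The map T is defined on all of ℤ^m, so it also shortens the edge from p₀ to q, whose end q is
    -- on the circuit and represents itself.
    x~q : Adj x q
    x~q = not-equal (≢q x∈) (short (into-S x∈) q∈S (T-chain (chain p₀∈L)) (λ _ → refl) p₀~q)

    -- This is how connectedness of the circuit without q is used: a path in L is pushed forward by
    -- ρ, and each of its edges becomes a root or a point.
    changing : {X : Set} (_≟X_ : DecidableEquality X) (g : Zm m → X) → ∀ {a b} → a ∈S′ → b ∈S′ → g a ≢ g b →
               ∃[ u ] ∃[ w ] (u ∈S′ × w ∈S′ × Adj u w × g u ≢ g w)
    changing _≟X_ g {a} {b} a∈ b∈ ga≢gb = result (changing-edge _≟X_ (g ∘ ρ) (path grown (∈L a∈) (∈L b∈)) different)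
      where
      different : g (ρ a) ≢ g (ρ b)
      different eq = ga≢gb (trans (cong g (sym (fixes (∈L a∈) (n≢0 a∈)))) (trans eq (cong g (fixes (∈L b∈) (n≢0 b∈)))))
      result : ∃[ u ] ∃[ w ] (EdgeIn L u w × g (ρ u) ≢ g (ρ w)) → ∃[ u ] ∃[ w ] (u ∈S′ × w ∈S′ × Adj u w × g u ≢ g w)
      result (u , w , (u∈L , w∈L , e) , gu≢gw) = ρ u , ρ w , ρ-S′ u∈L , ρ-S′ w∈L ,
        not-equal (λ eq → gu≢gw (cong g eq)) (short (into-S (ρ-S′ u∈L)) (into-S (ρ-S′ w∈L)) (T-chain (chain u∈L)) (T-chain (chain w∈L)) e) , gu≢gw

    -- Otherwise only q would contribute to the i-th moment of n.
    other-moved : ∀ {i} → lookup q i ≢ lookup x i → ∃[ p ] (p ∈S′ × lookup p i ≢ lookup x i)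
    other-moved {i} q-moved = search (Any.any? (λ p → ¬? (n p ≟ 0ℤ) ×-dec ¬? (lookup p i ≟ lookup x i)) L)
      where
      search : Dec (Any.Any (λ p → n p ≢ 0ℤ × lookup p i ≢ lookup x i) L) → ∃[ p ] (p ∈S′ × lookup p i ≢ lookup x i)
      search (yes any) with find any
      ... | p , p∈L , np≢0 , moved = p , in-S′ p∈L np≢0 , moved
      search (no none) = ⊥-elim (*-nonzero nq≢0 (λ eq → q-moved (i-j≡0⇒i≡j _ _ eq))
        (trans (sym (∑-only unique (here refl) rest)) (first-moment x i)))
        where
        rest : ∀ {p} → p ∈ q ∷ L → p ≢ q → n p * (lookup p i - lookup x i) ≡ 0ℤ
        rest (here refl) p≢q = ⊥-elim (p≢q refl)
        rest {p} (there p∈L) _ with n p ≟ 0ℤ | lookup p i ≟ lookup x i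
        ... | yes np≡0 | _      = trans (cong (_* (lookup p i - lookup x i)) np≡0) (*-zeroˡ (lookup p i - lookup x i))
        ... | no _     | yes eq = trans (cong (n p *_) (i≡j⇒i-j≡0 eq)) (*-zeroʳ (n p))
        ... | no np≢0  | no neq = ⊥-elim (none (lose p∈L (np≢0 , neq)))

    Spoke : Fin m → Fin m → Set
    Spoke i j = ∃[ u ] ∃[ k ] ∃[ c ] ∃[ d ] (u ∈S′ × k ≢ j × Link x u i k c d)

    module _ {i j s t} (l : Link x q i j s t) where
      private
        module l = Link l
        j≢i : j ≢ i
        j≢i j≡i = l.i≢j (sym j≡i)

      spoke-at : ∀ {u} → u ∈S′ → Adj x u → lookup u i ≢ lookup x i → Spoke i j
      spoke-at {u} u∈ e moved = build-spoke (orient e moved)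
        where
        build-spoke : ∃[ k ] ∃[ c ] ∃[ d ] Link x u i k c d → Spoke i j
        build-spoke (k , c , d , l′) = decide (k Fin.≟ j)
          where
          decide : Dec (k ≡ j) → Spoke i j
          decide (yes refl) = ⊥-elim (no-parallel-adjacent (into-S x∈) q∈S (into-S u∈) l l′ (λ q≡u → ≢q u∈ (sym q≡u)))
          decide (no k≢j)   = u , k , c , d , u∈ , k≢j , l′

      -- By `meets` the edge x z has an index in common with x q. With exactly one in common
      -- `no-parallel-disjoint` applies, with both `no-parallel-adjacent`.
      no-parallel-at : ∀ {z u s′ t′} → z ∈S′ → u ∈S′ → Link z u i j s′ t′ → x ≢ u → Adj x z → ⊥
      no-parallel-at {z} {u} z∈ u∈ l′ x≢u e = decide (lookup z i ≟ lookup x i) (lookup z j ≟ lookup x j)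
        where
        x≢z : x ≢ z
        x≢z refl = no-parallel-adjacent (into-S x∈) q∈S (into-S u∈) l l′ (λ q≡u → ≢q u∈ (sym q≡u))
        decide : Dec (lookup z i ≡ lookup x i) → Dec (lookup z j ≡ lookup x j) → ⊥
        decide (yes eq-i) (yes eq-j) = meets (into-S x∈) q∈S l (into-S z∈) (λ z≡x → x≢z (sym z≡x)) (≢q z∈) eq-i eq-j
        decide (no moved-i) (yes eq-j) = finish (orient e moved-i)
          where
          finish : ∃[ k ] ∃[ c ] ∃[ d ] Link x z i k c d → ⊥
          finish (k , c , d , l″) = no-parallel-disjoint (into-S x∈) q∈S (into-S z∈) (into-S u∈) l l′ l″
            (λ { refl → Link.moves-j l″ eq-j }) (λ q≡z → ≢q z∈ (sym q≡z)) (λ q≡u → ≢q u∈ (sym q≡u)) x≢u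
        decide (yes eq-i) (no moved-j) = finish (orient e moved-j)
          where
          finish : ∃[ k ] ∃[ c ] ∃[ d ] Link x z j k c d → ⊥
          finish (k , c , d , l″) = no-parallel-disjoint (into-S x∈) q∈S (into-S z∈) (into-S u∈) (link-swap l) (link-swap l′) l″
            (λ { refl → Link.moves-j l″ eq-i }) (λ q≡z → ≢q z∈ (sym q≡z)) (λ q≡u → ≢q u∈ (sym q≡u)) x≢u
        decide (no moved-i) (no moved-j) = finish (orient e moved-i)
          where
          finish : ∃[ k ] ∃[ c ] ∃[ d ] Link x z i k c d → ⊥
          finish (k , c , d , l″) = parallel (link-unmoved l″ moved-j j≢i) l″
            where
            parallel : ∀ {k} → j ≡ k → Link x z i k c d → ⊥
            parallel refl l″ = no-parallel-adjacent (into-S x∈) q∈S (into-S z∈) l l″ (λ q≡z → ≢q z∈ (sym q≡z))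

      -- Some circuit edge joins x to a vertex w other than q. If w is not an end of the edge z u,
      -- then that edge links the coordinates i and j of w and x: the step from x to w moves both or
      -- neither, so it is parallel or orthogonal to x q.
      no-parallel : ∀ {z u s′ t′} → z ∈S′ → u ∈S′ → x ≢ z → x ≢ u → Link z u i j s′ t′ → ⊥
      no-parallel {z} {u} z∈ u∈ x≢z x≢u l′ =
        leave (changing Bool._≟_ (λ p → does (p ≟v x)) x∈ z∈ (λ eq → x≢z (sym (same-side (sym eq)))))
        where
        same-side : ∀ {p} → does (p ≟v x) ≡ does (x ≟v x) → p ≡ x
        same-side {p} eq with p ≟v x | x ≟v x
        ... | yes p≡x | _      = p≡x
        ... | no _    | no x≢x = ⊥-elim (x≢x refl)
        same-side () | no _ | yes _
        at-x : ∀ {w} → w ∈S′ → Adj x w → ⊥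
        at-x {w} w∈ e = decide (w ≟v z) (w ≟v u)
          where
          decide : Dec (w ≡ z) → Dec (w ≡ u) → ⊥
          decide (yes refl) _          = no-parallel-at z∈ u∈ l′ x≢u e
          decide (no _)     (yes refl) = no-parallel-at u∈ z∈ (link-reverse l′) x≢z e
          decide (no w≢z)   (no w≢u)   = sides (lookup w i ≟ lookup x i)
            where
            x≢w : x ≢ w
            x≢w = Link.distinct (proj₂ (proj₂ (proj₂ (proj₂ e))))
            j-from-i : lookup w i ≡ lookup x i → lookup w j ≡ lookup x j
            j-from-i = linked-coordinates (into-S z∈) (into-S u∈) l′ (into-S w∈) w≢z w≢u (into-S x∈) x≢z x≢u
            i-from-j : lookup w j ≡ lookup x j → lookup w i ≡ lookup x i
            i-from-j = linked-coordinates (into-S z∈) (into-S u∈) (link-swap l′) (into-S w∈) w≢z w≢u (into-S x∈) x≢z x≢u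
            sides : Dec (lookup w i ≡ lookup x i) → ⊥
            sides (yes eq-i)   = meets (into-S x∈) q∈S l (into-S w∈) (λ w≡x → x≢w (sym w≡x)) (≢q w∈) eq-i (j-from-i eq-i)
            sides (no moved-i) = finish (orient e moved-i)
              where
              finish : ∃[ k ] ∃[ c ] ∃[ d ] Link x w i k c d → ⊥
              finish (k , c , d , l″) = parallel (link-unmoved l″ (λ eq-j → moved-i (i-from-j eq-j)) j≢i) l″
                where
                parallel : ∀ {k} → j ≡ k → Link x w i k c d → ⊥
                parallel refl l″ = no-parallel-adjacent (into-S x∈) q∈S (into-S w∈) l l″ (λ q≡w → ≢q w∈ (sym q≡w))
        leave : ∃[ a ] ∃[ b ] (a ∈S′ × b ∈S′ × Adj a b × does (a ≟v x) ≢ does (b ≟v x)) → ⊥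
        leave (a , b , a∈ , b∈ , e , differ) = decide (a ≟v x) (b ≟v x) differ
          where
          decide : (d : Dec (a ≡ x)) (d′ : Dec (b ≡ x)) → does d ≢ does d′ → ⊥
          decide (yes refl) _          _      = at-x b∈ e
          decide (no _)     (yes refl) _      = at-x a∈ (adj-sym e)
          decide (no _)     (no _)     differ = differ refl

      -- An edge of the circuit without q moves coordinate i. If it avoided x, then
      -- `linked-coordinates` for x q would make it move j too, against `no-parallel`.
      spoke : Spoke i j
      spoke = from-moved (other-moved l.moves-i)
        where
        from-edge : ∃[ z ] ∃[ u ] (z ∈S′ × u ∈S′ × Adj z u × lookup z i ≢ lookup u i) → Spoke i j
        from-edge (z , u , z∈ , u∈ , e , moved) = decide (z ≟v x) (u ≟v x)
          where
          decide : Dec (z ≡ x) → Dec (u ≡ x) → Spoke i j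
          decide (yes refl) _          = spoke-at u∈ e (λ eq → moved (sym eq))
          decide (no _)     (yes refl) = spoke-at z∈ (adj-sym e) moved
          decide (no z≢x)   (no u≢x)   = ⊥-elim (finish (orient e (λ eq → moved (sym eq))))
            where
            moved-j : lookup u j ≢ lookup z j
            moved-j eq = moved (linked-coordinates (into-S x∈) q∈S (link-swap l) (into-S z∈) z≢x (≢q z∈) (into-S u∈) u≢x (≢q u∈) (sym eq))
            finish : ∃[ k ] ∃[ c ] ∃[ d ] Link z u i k c d → ⊥
            finish (k , c , d , l′) = parallel (link-unmoved l′ moved-j j≢i) l′
              where
              parallel : ∀ {k} → j ≡ k → Link z u i k c d → ⊥
              parallel refl l′ = no-parallel z∈ u∈ (λ x≡z → z≢x (sym x≡z)) (λ x≡u → u≢x (sym x≡u)) l′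
        from-moved : ∃[ p ] (p ∈S′ × lookup p i ≢ lookup x i) → Spoke i j
        from-moved (p , p∈ , moved) = from-edge (changing _≟_ (λ p → lookup p i) x∈ p∈ (λ eq → moved (sym eq)))

    contradiction : ⊥
    contradiction = at-link x~q
      where
      at-link : Adj x q → ⊥
      at-link (i , j , s , t , l) = two-spokes (spoke l) (spoke (link-swap l))
        where
        module l = Link l
        two-spokes : Spoke i j → Spoke j i → ⊥
        two-spokes (u , k , c , d , u∈ , k≢j , lu) (w , k′ , e , f , w∈ , k′≢i , lw) = decide (k Fin.≟ k′) lu lw
          where
          decide : Dec (k ≡ k′) → Link x u i k c d → Link x w j k′ e f → ⊥
          decide (yes refl) lu lw = no-triangle (into-S x∈) q∈S (into-S u∈) (into-S w∈) l lu lw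
          -- The index pairs {i , k} and {j , k′} are now disjoint although both edges are at x.
          decide (no k≢k′) lu lw = meets (into-S x∈) (into-S u∈) lu (into-S w∈) (λ w≡x → Link.distinct lw (sym w≡x))
            (λ w≡u → Link.moves-i lu (trans (cong (λ z → lookup z i) (sym w≡u)) w-i)) w-i w-k
            where
            w-i : lookup w i ≡ lookup x i
            w-i = Link.at-other lw l.i≢j (λ i≡k′ → k′≢i (sym i≡k′))
            w-k : lookup w k ≡ lookup x k
            w-k = Link.at-other lw k≢j k≢k′

  -- Resonant graphs without doubled pairs are affinely independent.

  ∑-extend : ∀ {m} {B L : List (Zm m)} → Unique B → L ⊆ B → (r G : Zm m → ℤ) →
             ∑ B (λ b → ∑ L (λ p → indicator (b ≟v p) * r p) * G b) ≡ ∑ L (λ p → r p * G p)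
  ∑-extend {B = B} {L} unique L⊆B r G = begin
    ∑ B (λ b → ∑ L (λ p → indicator (b ≟v p) * r p) * G b)
      ≡⟨ ∑-cong B (λ {b} _ → trans (*-comm _ (G b)) (sym (∑-* L (G b) _))) ⟩
    ∑ B (λ b → ∑ L (λ p → G b * (indicator (b ≟v p) * r p)))
      ≡⟨ ∑-swap B L _ ⟩
    ∑ L (λ p → ∑ B (λ b → G b * (indicator (b ≟v p) * r p)))
      ≡⟨ ∑-cong L (λ {p} p∈L → trans (∑-cong B (λ {b} _ → reorder (G b) (indicator (b ≟v p)) (r p)))
           (∑-indicator unique (L⊆B p∈L) (λ b → r p * G b))) ⟩
    ∑ L (λ p → r p * G p) ∎
    where
    reorder : ∀ g d r → g * (d * r) ≡ d * (r * g)
    reorder = solve-∀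

  -- A relation on L is extended by zero to B; the sum over L of indicators expresses this
  -- extension.
  resonant-⊆ : ∀ {m} {B L : List (Zm m)} → Unique B → L ⊆ B → Resonant B → Resonant L
  resonant-⊆ {L = L} unique L⊆B resonant r rel i j i≢j =
    trans (sym (∑-extend unique L⊆B r (λ p → lookup p i * lookup p j)))
          (resonant (λ b → ∑ L (λ p → indicator (b ≟v p) * r p)) (λ k → trans (∑-extend unique L⊆B r (λ p → hom p k)) (rel k)) i j i≢j)

  -- A relation created by q is refuted by `Contradiction`, whose retraction needs a circuit vertex
  -- inside L. There is one because the coefficients of n add up to 0 and n(q) ≠ 0.
  independent : ∀ {m} {s : Zm m} {L} → Grown s L → Resonant L → (∀ {x y} → x ∈ L → y ∈ L → ¬ Doubled x y) →
                (∀ {x} → x ∈ L → Layered x) → Dual L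
  independent {s = s} seed _ _ _ = record
    { D = 1ℤ ; D≢0 = λ () ; φ = λ _ → coordinate zero
    ; on = λ {p} _ → app-coordinate zero p ; off = λ { (here refl) (here refl) p≢p → ⊥-elim (p≢p refl) } }
  independent (grow {L} {x} {q} g q∉L x∈L x~q) resonant undoubled layered = conclude (eliminate (tail unique) q∉L dual)
    where
    unique : Unique (q ∷ L)
    unique = grown-unique (grow g q∉L x∈L x~q)
    dual : Dual L
    dual = independent g (resonant-⊆ unique there resonant) (λ x∈ y∈ → undoubled (there x∈) (there y∈)) (λ x∈ → layered (there x∈))
    conclude : Dual (q ∷ L) ⊎ ∃[ n ] (Relation n (q ∷ L) × n q ≢ 0ℤ) → Dual (q ∷ L)
    conclude (inj₁ dual′) = dual′
    conclude (inj₂ (n , relation , nq≢0)) = search (Any.any? (λ p → ¬? (n p ≟ 0ℤ)) L)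
      where
      search : Dec (Any.Any (λ p → n p ≢ 0ℤ) L) → Dual (q ∷ L)
      search (yes any) with find any
      ... | s , s∈L , ns≢0 = ⊥-elim (Contradiction.contradiction unique dual resonant undoubled layered {n} relation nq≢0
                                       g q∉L x∈L x~q (retraction-from g s∈L ns≢0))
      search (no none) = ⊥-elim (nq≢0 (trans (sym (trans (∑-only unique (here refl) rest) (*-identityʳ (n q)))) (relation zero)))
        where
        rest : ∀ {p} → p ∈ q ∷ L → p ≢ q → n p * hom p zero ≡ 0ℤ
        rest (here refl) p≢q = ⊥-elim (p≢q refl)
        rest {p} (there p∈L) _ with n p ≟ 0ℤ
        ... | yes np≡0 = trans (cong (_* 1ℤ) np≡0) refl
        ... | no np≢0  = ⊥-elim (none (lose p∈L np≢0))

  -- From the group to roots: twisting vertices by their colour.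

  lookup-+v : ∀ {m} (a b : Zm m) k → lookup (a +v b) k ≡ lookup a k + lookup b k
  lookup-+v a b k = lookup-zipWith _+_ k a b

  lookup-·v : ∀ {m} c (a : Zm m) k → lookup (c ·v a) k ≡ c * lookup a k
  lookup-·v c a k = lookup-map k (c *_) a

  lookup--v : ∀ {m} (a : Zm m) k → lookup (-v a) k ≡ - lookup a k
  lookup--v a k = lookup-map k -_ a

  lookup-0v : ∀ {m} (k : Fin m) → lookup 0v k ≡ 0ℤ
  lookup-0v k = lookup-replicate k 0ℤ

  lookup-e : ∀ {m} (i k : Fin m) → lookup (e i) k ≡ δ i k
  lookup-e i k with i Fin.≟ k
  ... | yes refl = lookup∘update i (replicate _ 0ℤ) 1ℤ
  ... | no i≢k   = trans (lookup∘update′ (λ k≡i → i≢k (sym k≡i)) (replicate _ 0ℤ) 1ℤ) (lookup-0v k)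

  η-∑ : ∀ {m} (a : Zm m) → η a ≡ size a
  η-∑ {zero} []     = sym (∑-zero (coords zero) (λ {k} _ → ⊥-elim (no-index k)))
    where
    no-index : Fin zero → ⊥
    no-index ()
  η-∑ {suc m} (x ∷ a) = trans (cong (x +_) (η-∑ a)) (sym (∑-coords (lookup (x ∷ a))))

  η-+v : ∀ {m} (a b : Zm m) → η (a +v b) ≡ η a + η b
  η-+v []      []      = refl
  η-+v (x ∷ a) (y ∷ b) = trans (cong (x + y +_) (η-+v a b)) (interchange x y (η a) (η b))
    where
    interchange : ∀ a b c d → a + b + (c + d) ≡ a + c + (b + d)
    interchange = solve-∀

  η-·v : ∀ {m} c (a : Zm m) → η (c ·v a) ≡ c * η a
  η-·v c []      = sym (*-zeroʳ c)
  η-·v c (x ∷ a) = trans (cong (c * x +_) (η-·v c a)) (sym (*-distribˡ-+ c x (η a)))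

  η--v : ∀ {m} (a : Zm m) → η (-v a) ≡ - η a
  η--v []      = refl
  η--v (x ∷ a) = trans (cong (- x +_) (η--v a)) (negate x (η a))
    where
    negate : ∀ a b → - a + - b ≡ - (a + b)
    negate = solve-∀

  η-e : ∀ {m} (i : Fin m) → η (e i) ≡ 1ℤ
  η-e {m} i = trans (η-∑ (e i)) (trans (∑-cong (coords m) (λ {k} _ → trans (lookup-e i k) (sym (*-identityˡ (δ i k))))) (∑δ (λ _ → 1ℤ) i))

  -2ℤ : ℤ
  -2ℤ = -1ℤ + -1ℤ

  σ-black : ∀ {m} {a : Zm m} → η a ≡ 0ℤ → σ a ≡ 1ℤ
  σ-black {a = a} black with η a ≟ 0ℤ
  ... | yes _  = refl
  ... | no ¬0  = ⊥-elim (¬0 black)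

  σ-red : ∀ {m} {a : Zm m} → η a ≡ -2ℤ → σ a ≡ -1ℤ
  σ-red {a = a} red with η a ≟ 0ℤ
  ... | no _   = refl
  ... | yes η0 with trans (sym η0) red
  ...   | ()

  σ-sign : ∀ {m} (a : Zm m) → Sign (σ a)
  σ-sign a with η a ≟ 0ℤ
  ... | yes _ = inj₁ refl
  ... | no  _ = inj₂ refl

  -- In the coordinates σ(a) a the Cayley graph joins points differing by a root of type D.
  twist : ∀ {m} → Zm m → Zm m
  twist a = σ a ·v a

  lookup-twist : ∀ {m} (a : Zm m) k → lookup (twist a) k ≡ σ a * lookup a k
  lookup-twist a = lookup-·v (σ a) a

  η-twist : ∀ {m} {a : Zm m} → InG2 a → (η a ≡ 0ℤ × η (twist a) ≡ 0ℤ) ⊎ (η a ≡ -2ℤ × η (twist a) ≡ 1ℤ + 1ℤ)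
  η-twist {a = a} (inj₁ black) = inj₁ (black , trans (η-·v (σ a) a) (trans (cong (σ a *_) black) (*-zeroʳ (σ a))))
  η-twist {a = a} (inj₂ red)   = inj₂ (red , trans (η-·v (σ a) a) (cong₂ _*_ (σ-red {a = a} red) red))

  twist-layered : ∀ {m} {a : Zm m} → InG2 a → Layered (twist a)
  twist-layered {a = a} a∈G with η-twist {a = a} a∈G
  ... | inj₁ (_ , η0) = inj₁ (trans (sym (η-∑ (twist a))) η0)
  ... | inj₂ (_ , η2) = inj₂ (trans (sym (η-∑ (twist a))) η2)

  -- On twisted vertices the coordinate sum is 1 - σ, so the sign can be read off and undone.
  untwist : ∀ {m} → Zm m → Zm m
  untwist b = (1ℤ - η b) ·v b

  untwist-twist : ∀ {m} {a : Zm m} → InG2 a → untwist (twist a) ≡ a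
  untwist-twist {a = a} a∈G = lookup-ext λ k → trans (lookup-·v (1ℤ - η (twist a)) (twist a) k)
    (trans (cong ((1ℤ - η (twist a)) *_) (lookup-twist a k)) (unit (η-twist {a = a} a∈G) (lookup a k)))
    where
    unit : (η a ≡ 0ℤ × η (twist a) ≡ 0ℤ) ⊎ (η a ≡ -2ℤ × η (twist a) ≡ 1ℤ + 1ℤ) → ∀ z → (1ℤ - η (twist a)) * (σ a * z) ≡ z
    unit (inj₁ (black , η0)) z = trans (cong₂ (λ s t → (1ℤ - s) * (t * z)) η0 (σ-black {a = a} black)) (one z)
      where
      one : ∀ z → (1ℤ - 0ℤ) * (1ℤ * z) ≡ z
      one = solve-∀
    unit (inj₂ (red , η2)) z = trans (cong₂ (λ s t → (1ℤ - s) * (t * z)) η2 (σ-red {a = a} red)) (one z)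
      where
      one : ∀ z → (1ℤ - (1ℤ + 1ℤ)) * (-1ℤ * z) ≡ z
      one = solve-∀

  edge-colour : ∀ {m} {ℓ g : Zm m} → η (ℓ ⊙ g) ≡ η ℓ + σ ℓ * η g
  edge-colour {ℓ = ℓ} {g} = trans (η-+v ℓ (σ ℓ ·v g)) (cong (η ℓ +_) (η-·v (σ ℓ) g))

  module _ {m : ℕ} (i j : Fin m) where
    black-generator red-generator : Zm m
    black-generator = e i +v (-v e j)
    red-generator   = (-v e i) +v (-v e j)

    η-black-generator : η black-generator ≡ 0ℤ
    η-black-generator = trans (η-+v (e i) (-v e j)) (cong₂ _+_ (η-e i) (trans (η--v (e j)) (cong -_ (η-e j))))

    η-red-generator : η red-generator ≡ -2ℤ
    η-red-generator = trans (η-+v (-v e i) (-v e j)) (cong₂ _+_ (trans (η--v (e i)) (cong -_ (η-e i))) (trans (η--v (e j)) (cong -_ (η-e j))))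

    σ-black-generator : σ black-generator ≡ 1ℤ
    σ-black-generator = σ-black {a = black-generator} η-black-generator

    σ-red-generator : σ red-generator ≡ -1ℤ
    σ-red-generator = σ-red {a = red-generator} η-red-generator

    σ-black-edge : ∀ {g} → InG2 g → σ (black-generator ⊙ g) ≡ σ g
    σ-black-edge {g} = colours
      where
      h = black-generator ⊙ g
      η-h : η h ≡ η g
      η-h = trans (edge-colour {ℓ = black-generator} {g}) (trans (cong₂ (λ a b → a + b * η g) η-black-generator σ-black-generator) (one (η g)))
        where
        one : ∀ z → 0ℤ + 1ℤ * z ≡ z
        one = solve-∀
      colours : InG2 g → σ h ≡ σ g
      colours (inj₁ black) = trans (σ-black {a = h} (trans η-h black)) (sym (σ-black {a = g} black))
      colours (inj₂ red)   = trans (σ-red {a = h} (trans η-h red)) (sym (σ-red {a = g} red))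

    σ-red-edge : ∀ {g} → InG2 g → σ (red-generator ⊙ g) ≡ - σ g
    σ-red-edge {g} = colours
      where
      h = red-generator ⊙ g
      η-h : η h ≡ -2ℤ + -1ℤ * η g
      η-h = trans (edge-colour {ℓ = red-generator} {g}) (cong₂ (λ a b → a + b * η g) η-red-generator σ-red-generator)
      colours : InG2 g → σ h ≡ - σ g
      colours (inj₁ black) = trans (σ-red {a = h} (trans η-h (cong (λ z → -2ℤ + -1ℤ * z) black))) (cong -_ (sym (σ-black {a = g} black)))
      colours (inj₂ red)   = trans (σ-black {a = h} (trans η-h (cong (λ z → -2ℤ + -1ℤ * z) red))) (cong -_ (sym (σ-red {a = g} red)))

  -- For h = ℓ g one has σ(h) σ(ℓ) = σ(g), so `twist h` is `twist g` plus σ(h) ℓ, and ± ℓ is a root.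
  edge-adj : ∀ {m} {g h : Zm m} → InG2 g → Edge g h → Adj (twist g) (twist h)
  edge-adj {m} {g} g∈G (_ , (i , j , i≢j , inj₁ refl) , refl) = i , j , σ g , - σ g , record
    { i≢j = i≢j ; sign-s = σ-sign g ; sign-t = sign-neg (σ-sign g) ; shift = λ k → begin
        lookup (twist h) k
          ≡⟨ trans (lookup-twist h k) (cong₂ _*_ (σ-black-edge i j {g} g∈G) (trans (lookup-+v ℓ (σ ℓ ·v g) k)
               (cong₂ _+_ (trans (lookup-+v (e i) (-v e j) k) (cong₂ _+_ (lookup-e i k) (trans (lookup--v (e j) k) (cong -_ (lookup-e j k)))))
                          (trans (lookup-·v (σ ℓ) g k) (cong (_* lookup g k) (σ-black-generator i j)))))) ⟩
        σ g * (δ i k + - δ j k + 1ℤ * lookup g k)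
          ≡⟨ rearrange (σ g) (δ i k) (δ j k) (lookup g k) ⟩
        σ g * lookup g k + (σ g * δ i k + - σ g * δ j k)
          ≡⟨ cong (_+ (σ g * δ i k + - σ g * δ j k)) (sym (lookup-twist g k)) ⟩
        lookup (twist g) k + (σ g * δ i k + - σ g * δ j k) ∎ }
    where
    ℓ h : Zm m
    ℓ = black-generator i j
    h = ℓ ⊙ g
    rearrange : ∀ s a b g → s * (a + - b + 1ℤ * g) ≡ s * g + (s * a + - s * b)
    rearrange = solve-∀
  edge-adj {m} {g} g∈G (_ , (i , j , i≢j , inj₂ refl) , refl) = i , j , σ g , σ g , record
    { i≢j = i≢j ; sign-s = σ-sign g ; sign-t = σ-sign g ; shift = λ k → begin
        lookup (twist h) k
          ≡⟨ trans (lookup-twist h k) (cong₂ _*_ (σ-red-edge i j {g} g∈G) (trans (lookup-+v ℓ (σ ℓ ·v g) k)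
               (cong₂ _+_ (trans (lookup-+v (-v e i) (-v e j) k) (cong₂ _+_ (trans (lookup--v (e i) k) (cong -_ (lookup-e i k))) (trans (lookup--v (e j) k) (cong -_ (lookup-e j k)))))
                          (trans (lookup-·v (σ ℓ) g k) (cong (_* lookup g k) (σ-red-generator i j)))))) ⟩
        - σ g * (- δ i k + - δ j k + -1ℤ * lookup g k)
          ≡⟨ rearrange (σ g) (δ i k) (δ j k) (lookup g k) ⟩
        σ g * lookup g k + (σ g * δ i k + σ g * δ j k)
          ≡⟨ cong (_+ (σ g * δ i k + σ g * δ j k)) (sym (lookup-twist g k)) ⟩
        lookup (twist g) k + (σ g * δ i k + σ g * δ j k) ∎ }
    where
    ℓ h : Zm m
    ℓ = red-generator i j
    h = ℓ ⊙ g
    rearrange : ∀ s a b g → - s * (- a + - b + -1ℤ * g) ≡ s * g + (s * a + s * b)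
    rearrange = solve-∀

  -- Resonance and rank in twisted coordinates.

  ℤ→ℚ-+ : ∀ a b → ℤ→ℚ a ℚ.+ ℤ→ℚ b ≡ ℤ→ℚ (a + b)
  ℤ→ℚ-+ a b = ℚ.toℚᵘ-injective (ℚᵘ.≃-trans (ℚ.toℚᵘ-homo-+ (ℤ→ℚ a) (ℤ→ℚ b))
    (ℚᵘ.≃-trans (ℚᵘ.+-cong (ℚ.toℚᵘ-fromℚᵘ (mkℚᵘ a 0)) (ℚ.toℚᵘ-fromℚᵘ (mkℚᵘ b 0)))
    (ℚᵘ.≃-trans (*≡* (cross a b)) (ℚᵘ.≃-sym (ℚ.toℚᵘ-fromℚᵘ (mkℚᵘ (a + b) 0))))))
    where
    cross : ∀ a b → (a * 1ℤ + b * 1ℤ) * 1ℤ ≡ (a + b) * (1ℤ * 1ℤ)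
    cross = solve-∀

  ℤ→ℚ-* : ∀ a b → ℤ→ℚ a ℚ.* ℤ→ℚ b ≡ ℤ→ℚ (a * b)
  ℤ→ℚ-* a b = ℚ.toℚᵘ-injective (ℚᵘ.≃-trans (ℚ.toℚᵘ-homo-* (ℤ→ℚ a) (ℤ→ℚ b))
    (ℚᵘ.≃-trans (ℚᵘ.*-cong (ℚ.toℚᵘ-fromℚᵘ (mkℚᵘ a 0)) (ℚ.toℚᵘ-fromℚᵘ (mkℚᵘ b 0)))
    (ℚᵘ.≃-trans (*≡* (cross a b)) (ℚᵘ.≃-sym (ℚ.toℚᵘ-fromℚᵘ (mkℚᵘ (a * b) 0))))))
    where
    cross : ∀ a b → a * b * 1ℤ ≡ a * b * (1ℤ * 1ℤ)
    cross = solve-∀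

  ℤ→ℚ-zero : ∀ a → ℤ→ℚ a ≡ 0ℚ → a ≡ 0ℤ
  ℤ→ℚ-zero a eq with ℚ./-injective-≃ (mkℚᵘ a 0) (mkℚᵘ 0ℤ 0) eq
  ... | *≡* eq′ = trans (sym (*-identityʳ a)) eq′

  half-double : ∀ z → ½ ℚ.* ℤ→ℚ ((1ℤ + 1ℤ) * z + 0ℤ) ≡ ℤ→ℚ z
  half-double z = begin
    ½ ℚ.* ℤ→ℚ ((1ℤ + 1ℤ) * z + 0ℤ)    ≡⟨ cong (λ w → ½ ℚ.* ℤ→ℚ w) (+-identityʳ ((1ℤ + 1ℤ) * z)) ⟩
    ½ ℚ.* ℤ→ℚ ((1ℤ + 1ℤ) * z)         ≡⟨ cong (½ ℚ.*_) (sym (ℤ→ℚ-* (1ℤ + 1ℤ) z)) ⟩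
    ½ ℚ.* (ℤ→ℚ (1ℤ + 1ℤ) ℚ.* ℤ→ℚ z)   ≡⟨ sym (ℚ.*-assoc ½ (ℤ→ℚ (1ℤ + 1ℤ)) (ℤ→ℚ z)) ⟩
    1ℚ ℚ.* ℤ→ℚ z                      ≡⟨ ℚ.*-identityˡ (ℤ→ℚ z) ⟩
    ℤ→ℚ z                             ∎

  -- Off the diagonal the factor ½ cancels the 2 of the cross term, so these equations can be read
  -- over ℤ.
  Ccoef-off-diagonal : ∀ {m} (a : Zm m) {i j} → i ≢ j → Ccoef a i j ≡ ℤ→ℚ (σ a * (lookup a i * lookup a j))
  Ccoef-off-diagonal a {i} {j} i≢j = trans (cong (ℤ→ℚ (σ a) ℚ.*_) (trans (cong (λ z → ½ ℚ.* ℤ→ℚ z) coefficient) (half-double (lookup a i * lookup a j))))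
                                           (ℤ→ℚ-* (σ a) (lookup a i * lookup a j))
    where
    coefficient : sqCoef a i j + diagCoef a i j ≡ (1ℤ + 1ℤ) * (lookup a i * lookup a j) + 0ℤ
    coefficient with i Fin.≟ j
    ... | yes i≡j = ⊥-elim (i≢j i≡j)
    ... | no _    = refl

  vecOf : ∀ {A : Set} (N : List A) (f : A → ℤ) → Vec ℤ (length N)
  vecOf []      f = []
  vecOf (a ∷ N) f = f a ∷ vecOf N f

  lookup-combo-∷ : ∀ {m k} c (cs : Vec ℤ k) (w : Zm m) ws i → lookup (combo (c ∷ cs) (w ∷ ws)) i ≡ c * lookup w i + lookup (combo cs ws) i
  lookup-combo-∷ c cs w ws i = trans (lookup-+v (c ·v w) (combo cs ws) i) (cong (_+ lookup (combo cs ws) i) (lookup-·v c w i))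

  combo-vecOf : ∀ {m} (N : List (Zm m)) f k → lookup (combo (vecOf N f) (fromList N)) k ≡ ∑ N (λ a → f a * lookup a k)
  combo-vecOf []      f k = trans (lookup-0v k) (sym (∑-zero [] {λ a → f a * lookup a k} (λ ())))
  combo-vecOf (a ∷ N) f k = trans (lookup-combo-∷ (f a) (vecOf N f) a (fromList N) k)
    (trans (cong (f a * lookup a k +_) (combo-vecOf N f k)) (sym (∑-∷ a N (λ a → f a * lookup a k))))

  crel-vecOf : ∀ {m} (N : List (Zm m)) f {i j} → i ≢ j →
    Vec.foldr _ ℚ._+_ 0ℚ (Vec.zipWith (λ nk a → ℤ→ℚ nk ℚ.* Ccoef a i j) (vecOf N f) (fromList N)) ≡
    ℤ→ℚ (∑ N (λ a → f a * (σ a * (lookup a i * lookup a j))))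
  crel-vecOf []      f {i} {j} i≢j = cong ℤ→ℚ (sym (∑-zero [] {λ a → f a * (σ a * (lookup a i * lookup a j))} (λ ())))
  crel-vecOf (a ∷ N) f {i} {j} i≢j = trans (cong₂ ℚ._+_
      (trans (cong (ℤ→ℚ (f a) ℚ.*_) (Ccoef-off-diagonal a i≢j)) (ℤ→ℚ-* (f a) (σ a * (lookup a i * lookup a j))))
      (crel-vecOf N f i≢j))
    (trans (ℤ→ℚ-+ (f a * (σ a * (lookup a i * lookup a j))) (∑ N F)) (cong ℤ→ℚ (sym (∑-∷ a N F))))
    where
    F : Zm _ → ℤ
    F a = f a * (σ a * (lookup a i * lookup a j))

  ∑-nonzero : ∀ {m} (A : List (Zm m)) (F : Zm m → ℤ) → F 0v ≡ 0ℤ → ∑ (nonzero A) F ≡ ∑ A F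
  ∑-nonzero []      F F0 = refl
  ∑-nonzero (a ∷ A) F F0 with a ≟v 0v
  ... | yes refl = sym (trans (∑-∷ 0v A F) (trans (cong₂ _+_ F0 (sym (∑-nonzero A F F0))) (+-identityˡ (∑ (nonzero A) F))))
  ... | no _     = trans (∑-∷ a (nonzero A) F) (trans (cong (F a +_) (∑-nonzero A F F0)) (sym (∑-∷ a A F)))

  -- The coefficients r(`twist a`) σ(a) turn a relation of twisted vertices into one of A. The
  -- quadratic terms then agree, since both versions contain σ(a) twice.
  twist-resonant : ∀ {m} (A : List (Zm m)) →
    (∀ (n : Vec ℤ (length (nonzero A))) → combo n (fromList (nonzero A)) ≡ 0v → CRelZero n (fromList (nonzero A))) →
    Resonant (map twist A)
  twist-resonant {m} A crel r rel i j i≢j = begin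
    ∑ (map twist A) (λ b → r b * (lookup b i * lookup b j))
      ≡⟨ ∑-map twist A _ ⟩
    ∑ A (λ a → r (twist a) * (lookup (twist a) i * lookup (twist a) j))
      ≡⟨ ∑-cong A (λ {a} _ → trans (cong₂ (λ x y → r (twist a) * (x * y)) (lookup-twist a i) (lookup-twist a j))
           (rearrange (r (twist a)) (σ a) (lookup a i) (lookup a j))) ⟩
    ∑ A F
      ≡⟨ sym (∑-nonzero A F F-0) ⟩
    ∑ (nonzero A) F
      ≡⟨ ℤ→ℚ-zero _ (trans (sym (crel-vecOf (nonzero A) f i≢j)) (crel (vecOf (nonzero A) f) relation i j)) ⟩
    0ℤ ∎
    where
    f : Zm m → ℤ
    f a = r (twist a) * σ a
    F : Zm m → ℤ
    F a = f a * (σ a * (lookup a i * lookup a j))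
    o : Zm m
    o = 0v
    F-0 : F o ≡ 0ℤ
    F-0 = trans (cong (λ z → f o * (σ o * (z * lookup o j))) (lookup-0v i)) (zeros (f o) (σ o) (lookup o j))
      where
      zeros : ∀ f s z → f * (s * (0ℤ * z)) ≡ 0ℤ
      zeros = solve-∀
    rearrange : ∀ r s x y → r * (s * x * (s * y)) ≡ r * s * (s * (x * y))
    rearrange = solve-∀
    relation : combo (vecOf (nonzero A) f) (fromList (nonzero A)) ≡ 0v
    relation = lookup-ext λ k → begin
      lookup (combo (vecOf (nonzero A) f) (fromList (nonzero A))) k
        ≡⟨ combo-vecOf (nonzero A) f k ⟩
      ∑ (nonzero A) (λ a → f a * lookup a k)
        ≡⟨ ∑-nonzero A (λ a → f a * lookup a k) (trans (cong (f o *_) (lookup-0v k)) (*-zeroʳ (f o))) ⟩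
      ∑ A (λ a → f a * lookup a k)
        ≡⟨ ∑-cong A (λ {a} _ → trans (*-assoc (r (twist a)) (σ a) (lookup a k)) (cong (r (twist a) *_) (sym (lookup-twist a k)))) ⟩
      ∑ A (λ a → r (twist a) * lookup (twist a) k)
        ≡⟨ sym (∑-map twist A (λ b → r b * lookup b k)) ⟩
      ∑ (map twist A) (λ b → r b * lookup b k)
        ≡⟨ rel (suc k) ⟩
      0ℤ
        ≡⟨ sym (lookup-0v k) ⟩
      lookup 0v k ∎

  combo-zeros : ∀ {m} (N : List (Zm m)) → combo (replicate (length N) 0ℤ) (fromList N) ≡ 0v
  combo-zeros []      = refl
  combo-zeros (a ∷ N) = lookup-ext λ k → trans (lookup-combo-∷ 0ℤ (replicate (length N) 0ℤ) a (fromList N) k)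
    (trans (cong₂ _+_ (*-zeroˡ (lookup a k)) (cong (λ z → lookup z k) (combo-zeros N))) (+-identityˡ (lookup 0v k)))

  in-span : ∀ {m} {A : List (Zm m)} {a} → a ∈ A → InSpan A a
  in-span {A = a ∷ A} (here refl) = 1ℤ ∷ replicate (length A) 0ℤ , lookup-ext λ k →
    trans (lookup-combo-∷ 1ℤ (replicate (length A) 0ℤ) a (fromList A) k)
      (trans (cong₂ _+_ (*-identityˡ (lookup a k)) (trans (cong (λ z → lookup z k) (combo-zeros A)) (lookup-0v k))) (+-identityʳ (lookup a k)))
  in-span {A = b ∷ A} {a} (there a∈A) with in-span a∈A
  ... | c , eq = 0ℤ ∷ c , lookup-ext λ k → trans (lookup-combo-∷ 0ℤ c b (fromList A) k)
    (trans (cong₂ _+_ (*-zeroˡ (lookup b k)) (cong (λ z → lookup z k) eq)) (+-identityˡ (lookup a k)))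

  module _ {X : Set} where
    prefix : (N : List X) (r : ℕ) → r ℕ.≤ length N → Vec X r
    prefix N       zero    _           = []
    prefix (a ∷ N) (suc r) (ℕ.s≤s r≤N) = a ∷ prefix N r r≤N

    pad : (N : List X) (r : ℕ) → r ℕ.≤ length N → Vec ℤ r → Vec ℤ (length N)
    pad N       zero    _           _       = replicate (length N) 0ℤ
    pad (a ∷ N) (suc r) (ℕ.s≤s r≤N) (c ∷ cs) = c ∷ pad N r r≤N cs

    pad-zero : ∀ N r (r≤N : r ℕ.≤ length N) c → pad N r r≤N c ≡ replicate (length N) 0ℤ → c ≡ replicate r 0ℤ
    pad-zero N       zero    _           []       _  = refl
    pad-zero (a ∷ N) (suc r) (ℕ.s≤s r≤N) (c ∷ cs) eq with ∷-injective eq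
    ... | c≡0 , cs≡0 = cong₂ _∷_ c≡0 (pad-zero N r r≤N cs cs≡0)

    prefix-all : ∀ {P : X → Set} N r (r≤N : r ℕ.≤ length N) → (∀ {a} → a ∈ N → P a) → VAll.All P (prefix N r r≤N)
    prefix-all N       zero    _           p = VAll.[]
    prefix-all (a ∷ N) (suc r) (ℕ.s≤s r≤N) p = p (here refl) VAll.∷ prefix-all N r r≤N (p ∘ there)

  combo-pad : ∀ {m} (N : List (Zm m)) r (r≤N : r ℕ.≤ length N) c → combo (pad N r r≤N c) (fromList N) ≡ combo c (prefix N r r≤N)
  combo-pad N       zero    _           []       = combo-zeros N
  combo-pad (a ∷ N) (suc r) (ℕ.s≤s r≤N) (c ∷ cs) = cong ((c ·v a) +v_) (combo-pad N r r≤N cs)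

  -- With r below the number of nonzero vertices, the first r + 1 of them would be independent
  -- vectors in a span of rank r.
  not-degenerate : ∀ {m} (A : List (Zm m)) → LinIndep (fromList (nonzero A)) → ¬ Degenerate A
  not-degenerate A indep (r , (_ , dependent) , r<N) = dependent (prefix N (suc r) r<N)
    (prefix-all N (suc r) r<N (λ a∈N → in-span (proj₁ (∈-filter⁻ (λ a → ¬? (a ≟v 0v)) {xs = A} a∈N))))
    (λ c eq → pad-zero N (suc r) r<N c (indep (pad N (suc r) r<N c) (trans (combo-pad N (suc r) r<N c) eq)))
    where
    N = nonzero A

  weighted : ∀ {m k} → Vec ℤ k → Vec (Zm m) k → (Zm m → ℤ) → ℤ
  weighted []       []       F = 0ℤ
  weighted (c ∷ cs) (w ∷ ws) F = c * F w + weighted cs ws F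

  weighted-zero : ∀ {m} (N : List (Zm m)) c {F : Zm m → ℤ} → (∀ {a} → a ∈ N → F a ≡ 0ℤ) → weighted c (fromList N) F ≡ 0ℤ
  weighted-zero []      []       F0 = refl
  weighted-zero (a ∷ N) (c ∷ cs) F0 = trans (cong₂ _+_ (trans (cong (c *_) (F0 (here refl))) (*-zeroʳ c)) (weighted-zero N cs (F0 ∘ there))) refl

  linear : ∀ {m} → (Fin m → ℤ) → Zm m → ℤ
  linear {m} f a = ∑ (coords m) (λ k → f k * lookup a k)

  weighted-linear : ∀ {m k} (c : Vec ℤ k) (ws : Vec (Zm m) k) f → weighted c ws (linear f) ≡ linear f (combo c ws)
  weighted-linear {m} []       []       f = sym (∑-zero (coords m) (λ {k} _ → trans (cong (f k *_) (lookup-0v k)) (*-zeroʳ (f k))))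
  weighted-linear {m} (c ∷ cs) (w ∷ ws) f = begin
    c * linear f w + weighted cs ws (linear f)
      ≡⟨ cong₂ _+_ (sym (∑-* (coords m) c _)) (weighted-linear cs ws f) ⟩
    ∑ (coords m) (λ k → c * (f k * lookup w k)) + ∑ (coords m) (λ k → f k * lookup (combo cs ws) k)
      ≡⟨ sym (∑-+ (coords m) _ _) ⟩
    ∑ (coords m) (λ k → c * (f k * lookup w k) + f k * lookup (combo cs ws) k)
      ≡⟨ ∑-cong (coords m) (λ {k} _ → trans (distribute c (f k) (lookup w k) (lookup (combo cs ws) k))
                                             (cong (f k *_) (sym (lookup-combo-∷ c cs w ws k)))) ⟩
    linear f (combo (c ∷ cs) (w ∷ ws)) ∎
    where
    distribute : ∀ c f w z → c * (f * w) + f * z ≡ f * (c * w + z)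
    distribute = solve-∀

  linear-0v : ∀ {m} (f : Fin m → ℤ) → linear f 0v ≡ 0ℤ
  linear-0v {m} f = ∑-zero (coords m) (λ {k} _ → trans (cong (f k *_) (lookup-0v k)) (*-zeroʳ (f k)))

  linIndep-from-functionals : ∀ {m} (N : List (Zm m)) → Unique N →
    (∀ {a} → a ∈ N → ∃[ f ] (linear f a ≢ 0ℤ × (∀ {b} → b ∈ N → b ≢ a → linear f b ≡ 0ℤ))) → LinIndep (fromList N)
  linIndep-from-functionals []      _        _   []       _  = refl
  linIndep-from-functionals (a ∷ N) (a∉N ∷ u) functional (c ∷ cs) eq with functional (here refl)
  ... | f , fa≢0 , f-off = cong₂ _∷_ c≡0 (linIndep-from-functionals N u rest cs tail-eq)
    where
    c≡0 : c ≡ 0ℤ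
    c≡0 = *-cancel-0 fa≢0 (begin
      linear f a * c
        ≡⟨ *-comm (linear f a) c ⟩
      c * linear f a
        ≡⟨ sym (trans (cong (c * linear f a +_) (weighted-zero N cs (λ b∈N → f-off (there b∈N) (λ b≡a → All.lookup a∉N b∈N (sym b≡a))))) (+-identityʳ _)) ⟩
      weighted (c ∷ cs) (fromList (a ∷ N)) (linear f)
        ≡⟨ weighted-linear (c ∷ cs) (fromList (a ∷ N)) f ⟩
      linear f (combo (c ∷ cs) (fromList (a ∷ N)))
        ≡⟨ trans (cong (linear f) eq) (linear-0v f) ⟩
      0ℤ ∎)
    tail-eq : combo cs (fromList N) ≡ 0v
    tail-eq = lookup-ext λ k → begin
      lookup (combo cs (fromList N)) k
        ≡⟨ sym (+-identityˡ _) ⟩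
      0ℤ + lookup (combo cs (fromList N)) k
        ≡⟨ cong (_+ lookup (combo cs (fromList N)) k) (sym (trans (cong (_* lookup a k) c≡0) (*-zeroˡ (lookup a k)))) ⟩
      c * lookup a k + lookup (combo cs (fromList N)) k
        ≡⟨ sym (lookup-combo-∷ c cs a (fromList N) k) ⟩
      lookup (combo (c ∷ cs) (fromList (a ∷ N))) k
        ≡⟨ cong (λ z → lookup z k) eq ⟩
      lookup 0v k ∎
    rest : ∀ {a} → a ∈ N → ∃[ f ] (linear f a ≢ 0ℤ × (∀ {b} → b ∈ N → b ≢ a → linear f b ≡ 0ℤ))
    rest a∈N with functional (there a∈N)
    ... | f , f≢0 , off = f , f≢0 , off ∘ there

  -- The forbidden pair in a degenerate-resonant graph.

  module _ {m : ℕ} {A : List (Zm m)} (graph : CombGraph A) where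
    open CombGraph graph

    in-G₂ : ∀ {a} → a ∈ A → InG2 a
    in-G₂ = All.lookup inG2

    private
      B : List (Zm m)
      B = map twist A

    adjacent-adj : ∀ {g h} → g ∈ A → h ∈ A → Adjacent g h → Adj (twist g) (twist h)
    adjacent-adj {g} {h} g∈A h∈A (inj₁ edge) = edge-adj {g = g} {h} (in-G₂ g∈A) edge
    adjacent-adj {g} {h} g∈A h∈A (inj₂ edge) = adj-sym (edge-adj {g = h} {g} (in-G₂ h∈A) edge)

    reach-∈ : ∀ {h} → Reach A h → h ∈ A
    reach-∈ Reach.here             = has0
    reach-∈ (Reach.step _ h∈A _) = h∈A

    reach-path : ∀ {h} → Reach A h → Star (EdgeIn B) (twist 0v) (twist h)
    reach-path Reach.here = ε
    reach-path (Reach.step {g} {h} r h∈A adjacent) = reach-path r ◅◅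
      (∈-map⁺ twist (reach-∈ r) , ∈-map⁺ twist h∈A , adjacent-adj {g} {h} (reach-∈ r) h∈A adjacent) ◅ ε

    twist-injective : ∀ {a b} → a ∈ A → b ∈ A → twist a ≡ twist b → a ≡ b
    twist-injective {a} {b} a∈A b∈A eq = trans (sym (untwist-twist {a = a} (in-G₂ a∈A))) (trans (cong untwist eq) (untwist-twist {a = b} (in-G₂ b∈A)))

    twist-unique : Unique B
    twist-unique = go unique id
      where
      go : ∀ {N} → Unique N → (∀ {a} → a ∈ N → a ∈ A) → Unique (map twist N)
      go []        sub = []
      go {a ∷ N} (a∉N ∷ u) sub = All.tabulate (λ {b} b∈ eq → distinct b b∈ eq) ∷ go u (sub ∘ there)
        where
        distinct : ∀ b → b ∈ map twist N → twist a ≢ b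
        distinct b b∈ eq with ∈-map⁻ twist b∈
        ... | c , c∈N , refl = All.lookup a∉N c∈N (twist-injective (sub (here refl)) (sub (there c∈N)) eq)

    twist-0v : twist 0v ≡ 0v {m}
    twist-0v = lookup-ext λ k → trans (lookup-twist 0v k) (trans (cong (σ {m} 0v *_) (lookup-0v k)) (trans (*-zeroʳ (σ {m} 0v)) (sym (lookup-0v k))))

    -- The vertex 0 is its own twist, so the dual functional of any other vertex vanishes there and
    -- has no constant term. Affine independence of the twists is thereby linear independence, and
    -- the signs σ do not affect it.
    dual-linIndep : ∀ {L} → (∀ {b} → b ∈ B → b ∈ L) → Dual L → LinIndep (fromList (nonzero A))
    dual-linIndep {L} B⊆L dual = linIndep-from-functionals (nonzero A) (Unique.filter⁺ (λ a → ¬? (a ≟v 0v)) unique) functional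
      where
      open Dual dual
      in-L : ∀ {a} → a ∈ A → twist a ∈ L
      in-L a∈A = B⊆L (∈-map⁺ twist a∈A)
      0∈L : 0v ∈ L
      0∈L = subst (_∈ L) twist-0v (in-L has0)
      split : ∀ (f : Functional m) b → app f b ≡ f zero + linear (λ k → f (suc k)) b
      split f b = trans (∑-coords (λ k → f k * hom b k)) (cong (_+ linear (λ k → f (suc k)) b) (*-identityʳ (f zero)))
      functional : ∀ {a} → a ∈ nonzero A → ∃[ f ] (linear f a ≢ 0ℤ × (∀ {b} → b ∈ nonzero A → b ≢ a → linear f b ≡ 0ℤ))
      functional {a} a∈N = f , f-a , f-off
        where
        member : ∀ {b} → b ∈ nonzero A → b ∈ A × b ≢ 0v
        member b∈N = ∈-filter⁻ (λ a → ¬? (a ≟v 0v)) {xs = A} b∈N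
        a∈A = proj₁ (member a∈N)
        F = φ (twist a)
        f : Fin m → ℤ
        f k = F (suc k)
        F-zero : F zero ≡ 0ℤ
        F-zero = begin
          F zero                  ≡⟨ sym (+-identityʳ (F zero)) ⟩
          F zero + 0ℤ             ≡⟨ cong (F zero +_) (sym (linear-0v f)) ⟩
          F zero + linear f 0v    ≡⟨ sym (split F 0v) ⟩
          app F 0v                ≡⟨ off (in-L a∈A) 0∈L (λ eq → proj₂ (member a∈N) (twist-injective a∈A has0 (trans eq (sym twist-0v)))) ⟩
          0ℤ                      ∎
        σ-linear : ∀ b → σ b * linear f b ≡ app F (twist b)
        σ-linear b = begin
          σ b * linear f b
            ≡⟨ sym (∑-* (coords m) (σ b) _) ⟩
          ∑ (coords m) (λ k → σ b * (f k * lookup b k))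
            ≡⟨ ∑-cong (coords m) (λ {k} _ → trans (exchange (σ b) (f k) (lookup b k)) (cong (f k *_) (sym (lookup-twist b k)))) ⟩
          linear f (twist b)
            ≡⟨ sym (trans (split F (twist b)) (trans (cong (_+ linear f (twist b)) F-zero) (+-identityˡ (linear f (twist b))))) ⟩
          app F (twist b) ∎
          where
          exchange : ∀ s f z → s * (f * z) ≡ f * (s * z)
          exchange = solve-∀
        f-a : linear f a ≢ 0ℤ
        f-a eq = D≢0 (trans (sym (on (in-L a∈A))) (trans (sym (σ-linear a)) (trans (cong (σ a *_) eq) (*-zeroʳ (σ a)))))
        f-off : ∀ {b} → b ∈ nonzero A → b ≢ a → linear f b ≡ 0ℤ
        f-off {b} b∈N b≢a = *-cancel-0 (sign-nonzero (σ-sign b)) (trans (σ-linear b)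
          (off (in-L a∈A) (in-L (proj₁ (member b∈N))) (λ eq → b≢a (sym (twist-injective a∈A (proj₁ (member b∈N)) eq)))))

    doubled? : ∀ (x y : Zm m) → Dec (Doubled x y)
    doubled? x y = any? (λ i → all? (λ k → lookup y k ≟ lookup x k + (1ℤ + 1ℤ) * δ i k))

    -- Then h g⁻¹ = - 2 e_i.
    ForbiddenPair : Set
    ForbiddenPair = ∃[ g ] ∃[ h ] ∃[ i ] (g ∈ A × h ∈ A × η g ≡ 0ℤ × η h ≡ -2ℤ × ∀ k → lookup h k ≡ - (lookup g k + (1ℤ + 1ℤ) * δ i k))

    -- Doubling raises the coordinate sum by 2, hence from 0 to 2: g is black and h is red.
    doubled-forbidden : ∀ {g h} → g ∈ A → h ∈ A → Doubled (twist g) (twist h) → ForbiddenPair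
    doubled-forbidden {g} {h} g∈A h∈A (i , eq) = colours (η-twist {a = g} (in-G₂ g∈A)) (η-twist {a = h} (in-G₂ h∈A))
      where
      size-h : η (twist h) ≡ η (twist g) + (1ℤ + 1ℤ)
      size-h = trans (η-∑ (twist h)) (trans (∑-cong (coords m) (λ {k} _ → eq k))
        (trans (∑-+ (coords m) (lookup (twist g)) _) (cong₂ _+_ (sym (η-∑ (twist g))) (∑δ (λ _ → 1ℤ + 1ℤ) i))))
      absurd : ∀ {a b} → a ≡ 0ℤ ⊎ a ≡ 1ℤ + 1ℤ → b ≡ 0ℤ → b ≢ a + (1ℤ + 1ℤ)
      absurd (inj₁ refl) refl ()
      absurd (inj₂ refl) refl ()
      absurd′ : ∀ {a b} → a ≡ 1ℤ + 1ℤ → b ≡ 1ℤ + 1ℤ → b ≢ a + (1ℤ + 1ℤ)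
      absurd′ refl refl ()
      colours : (η g ≡ 0ℤ × η (twist g) ≡ 0ℤ) ⊎ (η g ≡ -2ℤ × η (twist g) ≡ 1ℤ + 1ℤ) →
                (η h ≡ 0ℤ × η (twist h) ≡ 0ℤ) ⊎ (η h ≡ -2ℤ × η (twist h) ≡ 1ℤ + 1ℤ) → ForbiddenPair
      colours (inj₁ (_ , g0)) (inj₁ (_ , h0)) = ⊥-elim (absurd (inj₁ g0) h0 size-h)
      colours (inj₂ (_ , g2)) (inj₁ (_ , h0)) = ⊥-elim (absurd (inj₂ g2) h0 size-h)
      colours (inj₂ (_ , g2)) (inj₂ (_ , h2)) = ⊥-elim (absurd′ g2 h2 size-h)
      colours (inj₁ (black , _)) (inj₂ (red , _)) = g , h , i , g∈A , h∈A , black , red , λ k →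
        by₁ -1ℤ (trans (sym (trans (lookup-twist h k) (cong (_* lookup h k) (σ-red {a = h} red))))
                 (trans (eq k) (cong (_+ (1ℤ + 1ℤ) * δ i k) (trans (lookup-twist g k) (cong (_* lookup g k) (σ-black {a = g} black))))))
                (certificate (lookup g k) (lookup h k) ((1ℤ + 1ℤ) * δ i k))
        where
        certificate : ∀ g h d → h - - (g + d) ≡ -1ℤ * (-1ℤ * h - (1ℤ * g + d))
        certificate = solve-∀

    forbidden-pair : DegenerateResonant A → ForbiddenPair
    forbidden-pair (degenerate , crel) = search (Any.any? (λ g → Any.any? (λ h → doubled? (twist g) (twist h)) A) A)
      where
      spanning-B : ∃[ L ] (Grown (twist 0v) L × (∀ {p} → p ∈ L → p ∈ B) × (∀ {p} → p ∈ B → p ∈ L))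
      spanning-B = spanning (∈-map⁺ twist has0) path-to
        where
        path-to : ∀ {p} → p ∈ B → Star (EdgeIn B) (twist 0v) p
        path-to p∈B with ∈-map⁻ twist p∈B
        ... | a , a∈A , refl = reach-path (connected a∈A)
      search : Dec (Any.Any (λ g → Any.Any (λ h → Doubled (twist g) (twist h)) A) A) → ForbiddenPair
      search (yes any) with find any
      ... | g , g∈A , any′ with find any′
      ...   | h , h∈A , doubled = doubled-forbidden g∈A h∈A doubled
      search (no none) = ⊥-elim (not-degenerate A (conclude spanning-B) degenerate)
        where
        undoubled : ∀ {x y} → x ∈ B → y ∈ B → ¬ Doubled x y
        undoubled x∈B y∈B doubled with ∈-map⁻ twist x∈B | ∈-map⁻ twist y∈B
        ... | g , g∈A , refl | h , h∈A , refl = none (lose g∈A (lose h∈A doubled))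
        layered : ∀ {x} → x ∈ B → Layered x
        layered x∈B with ∈-map⁻ twist x∈B
        ... | a , a∈A , refl = twist-layered {a = a} (in-G₂ a∈A)
        conclude : ∃[ L ] (Grown (twist 0v) L × (∀ {p} → p ∈ L → p ∈ B) × (∀ {p} → p ∈ B → p ∈ L)) → LinIndep (fromList (nonzero A))
        conclude (L , grown , L⊆B , B⊆L) = dual-linIndep B⊆L
          (independent grown (resonant-⊆ twist-unique L⊆B (twist-resonant A crel)) (λ x∈ y∈ → undoubled (L⊆B x∈) (L⊆B y∈)) (λ x∈ → layered (L⊆B x∈)))

    -- Since σ(h) = -1 and σ(g) = 1, the product h g⁻¹ is the vector h + g.
    forbidden-translate : ForbiddenPair → ∃[ g ] (g ∈ A × ¬ Allowable (translate A g))
    forbidden-translate (g , h , i , g∈A , h∈A , black , red , eq) = g , g∈A , λ allowable →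
      allowable (∈-map⁺ (λ h → h ⊙ inv g) h∈A) (i , inj₁ (lookup-ext λ k → begin
        lookup (h ⊙ inv g) k
          ≡⟨ trans (lookup-+v h (σ h ·v inv g) k) (cong (lookup h k +_) (trans (lookup-·v (σ h) (inv g) k) (cong (σ h *_) (lookup-·v (- σ g) g k)))) ⟩
        lookup h k + σ h * (- σ g * lookup g k)
          ≡⟨ cong₂ (λ s t → lookup h k + s * (- t * lookup g k)) (σ-red {a = h} red) (σ-black {a = g} black) ⟩
        lookup h k + -1ℤ * (- 1ℤ * lookup g k)
          ≡⟨ cong (_+ -1ℤ * (- 1ℤ * lookup g k)) (eq k) ⟩
        - (lookup g k + (1ℤ + 1ℤ) * δ i k) + -1ℤ * (- 1ℤ * lookup g k)
          ≡⟨ cancel (lookup g k) (δ i k) ⟩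
        (1ℤ + 1ℤ) * - δ i k
          ≡⟨ sym (trans (lookup-·v (1ℤ + 1ℤ) (-v e i) k) (cong ((1ℤ + 1ℤ) *_) (trans (lookup--v (e i) k) (cong -_ (lookup-e i k))))) ⟩
        lookup ((1ℤ + 1ℤ) ·v (-v e i)) k ∎))
      where
      cancel : ∀ g d → - (g + (1ℤ + 1ℤ) * d) + -1ℤ * (- 1ℤ * g) ≡ (1ℤ + 1ℤ) * - d
      cancel = solve-∀

open Combinatorial

-- Real fields and Euclidean geometry.

module Field (R : RealField) where
  open RealField R
  open RealOps R
  open IsCommutativeRing isCommutativeRing using (+-identityˡ; +-identityʳ; +-assoc; +-comm; *-comm; *-assoc; *-identityˡ; *-identityʳ; zeroˡ; zeroʳ; distribʳ; -‿inverseʳ; -‿inverseˡ)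
  open IsTotalOrder isTotalOrder using (antisym; total; reflexive) renaming (trans to ≤-trans)

  commutativeRing : CommutativeRing _ _
  commutativeRing = record { isCommutativeRing = isCommutativeRing }

  open Algebra.Properties.Ring (CommutativeRing.ring commutativeRing)
    using (-0#≈0#; -‿+-comm; -‿involutive; -‿distribˡ-*; -‿distribʳ-*)

  ιℕ-+ : ∀ a b → ιℕ (a ℕ.+ b) ≡ ιℕ a + ιℕ b
  ιℕ-+ zero    b = sym (+-identityˡ (ιℕ b))
  ιℕ-+ (suc a) b = trans (cong (1# +_) (ιℕ-+ a b)) (sym (+-assoc 1# (ιℕ a) (ιℕ b)))

  ιℕ-* : ∀ a b → ιℕ (a ℕ.* b) ≡ ιℕ a * ιℕ b
  ιℕ-* zero    b = sym (zeroˡ (ιℕ b))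
  ιℕ-* (suc a) b = trans (ιℕ-+ b (a ℕ.* b)) (trans (cong₂ _+_ (sym (*-identityˡ (ιℕ b))) (ιℕ-* a b)) (sym (distribʳ (ιℕ b) 1# (ιℕ a))))

  ι-neg : ∀ a → ι (ℤ.- a) ≡ - ι a
  ι-neg (ℤ.+ zero)  = sym -0#≈0#
  ι-neg (ℤ.+ suc n) = refl
  ι-neg -[1+ n ]  = sym (-‿involutive (ιℕ (suc n)))

  ι-⊖ : ∀ a b → ι (a ℤ.⊖ b) ≡ ιℕ a + - ιℕ b
  ι-⊖ zero    zero    = sym (-‿inverseʳ 0#)
  ι-⊖ (suc a) zero    = sym (trans (cong (ιℕ (suc a) +_) -0#≈0#) (+-identityʳ (ιℕ (suc a))))
  ι-⊖ zero    (suc b) = sym (+-identityˡ (- ιℕ (suc b)))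
  ι-⊖ (suc a) (suc b) = begin
    ι (suc a ℤ.⊖ suc b)             ≡⟨ cong ι (ℤ.[1+m]⊖[1+n]≡m⊖n a b) ⟩
    ι (a ℤ.⊖ b)                     ≡⟨ ι-⊖ a b ⟩
    ιℕ a + - ιℕ b                   ≡⟨ cong (_+ - ιℕ b) (sym (trans (cong (_+ ιℕ a) (-‿inverseˡ 1#)) (+-identityˡ (ιℕ a)))) ⟩
    - 1# + 1# + ιℕ a + - ιℕ b       ≡⟨ cong (_+ - ιℕ b) (trans (+-assoc (- 1#) 1# (ιℕ a)) (+-comm (- 1#) (1# + ιℕ a))) ⟩
    1# + ιℕ a + - 1# + - ιℕ b       ≡⟨ +-assoc (1# + ιℕ a) (- 1#) (- ιℕ b) ⟩
    1# + ιℕ a + (- 1# + - ιℕ b)     ≡⟨ cong (1# + ιℕ a +_) (-‿+-comm 1# (ιℕ b)) ⟩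
    ιℕ (suc a) + - ιℕ (suc b)       ∎

  -- That ι is a ring homomorphism allows integer coefficients in the polynomial identities over the
  -- field.
  ι-+ : ∀ a b → ι (a ℤ.+ b) ≡ ι a + ι b
  ι-+ (ℤ.+ a)    (ℤ.+ b)    = ιℕ-+ a b
  ι-+ (ℤ.+ a)    -[1+ b ] = ι-⊖ a (suc b)
  ι-+ -[1+ a ] (ℤ.+ b)    = trans (ι-⊖ b (suc a)) (+-comm (ιℕ b) (- ιℕ (suc a)))
  ι-+ -[1+ a ] -[1+ b ] = trans (cong -_ (trans (cong (1# +_) (sym (ιℕ-suc-+))) (ιℕ-+ (suc a) (suc b)))) (sym (-‿+-comm (ιℕ (suc a)) (ιℕ (suc b))))
    where
    ιℕ-suc-+ : ιℕ (a ℕ.+ suc b) ≡ ιℕ (suc (a ℕ.+ b))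
    ιℕ-suc-+ = cong ιℕ (ℕ-+-suc a b)
      where
      ℕ-+-suc : ∀ a b → a ℕ.+ suc b ≡ suc (a ℕ.+ b)
      ℕ-+-suc zero    b = refl
      ℕ-+-suc (suc a) b = cong suc (ℕ-+-suc a b)

  ι-ℕ* : ∀ a b → ι (ℤ.+ a ℤ.* b) ≡ ιℕ a * ι b
  ι-ℕ* a (ℤ.+ b)  = trans (cong ι (sym (ℤ.pos-* a b))) (ιℕ-* a b)
  ι-ℕ* a -[1+ b ] = trans (cong ι (sym (ℤ.neg-distribʳ-* (ℤ.+ a) (ℤ.+ suc b)))) (trans (ι-neg (ℤ.+ a ℤ.* ℤ.+ suc b))
    (trans (cong -_ (ι-ℕ* a (ℤ.+ suc b))) (-‿distribʳ-* (ιℕ a) (ιℕ (suc b)))))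

  ι-* : ∀ a b → ι (a ℤ.* b) ≡ ι a * ι b
  ι-* (ℤ.+ a)  b = ι-ℕ* a b
  ι-* -[1+ a ] b = trans (cong ι (sym (ℤ.neg-distribˡ-* (ℤ.+ suc a) b))) (trans (ι-neg (ℤ.+ suc a ℤ.* b))
    (trans (cong -_ (ι-ℕ* (suc a) b)) (-‿distribˡ-* (ιℕ (suc a)) (ι b))))

  ι-1 : ι 1ℤ ≡ 1#
  ι-1 = +-identityʳ 1#

  private
    morphism : ℤ.+-*-rawRing -Raw-AlmostCommutative⟶ fromCommutativeRing commutativeRing
    morphism = record { ⟦_⟧ = ι ; +-homo = ι-+ ; *-homo = ι-* ; -‿homo = ι-neg ; 0-homo = refl ; 1-homo = ι-1 }

    coefficient-≟ : ∀ a b → Maybe (ι a ≡ ι b)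
    coefficient-≟ a b with a ℤ.≟ b
    ... | yes refl = just refl
    ... | no _     = nothing

  open RingSolver ℤ.+-*-rawRing (fromCommutativeRing commutativeRing) morphism coefficient-≟ using (solve; _:=_; _:+_; _:*_; :-_; con)

  ring-equal : ∀ {a b} → a + - b ≡ 0# → a ≡ b
  ring-equal {a} {b} eq = trans (restore a b) (trans (cong (_+ b) eq) (+-identityˡ b))
    where
    restore : ∀ a b → a ≡ a + - b + b
    restore = solve 2 (λ a b → a := a :+ :- b :+ b) refl

  ring-difference : ∀ {a b} → a ≡ b → a + - b ≡ 0#
  ring-difference {a} refl = -‿inverseʳ a

  0≤square : ∀ a → 0# ≤ a * a
  0≤square a with total 0# a
  ... | inj₁ 0≤a = *-nonneg 0≤a 0≤a
  ... | inj₂ a≤0 = subst (0# ≤_) (square-neg a) (*-nonneg 0≤-a 0≤-a)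
    where
    0≤-a : 0# ≤ - a
    0≤-a = subst (_≤ - a) (-‿inverseʳ a) (subst (a + - a ≤_) (+-identityˡ (- a)) (+-mono-≤ (- a) a≤0))
    square-neg : ∀ a → - a * - a ≡ a * a
    square-neg = solve 1 (λ a → :- a :* :- a := a :* a) refl

  0≤1 : 0# ≤ 1#
  0≤1 = subst (0# ≤_) (*-identityˡ 1#) (0≤square 1#)

  ≤-+ : ∀ {a} b → 0# ≤ a → b ≤ a + b
  ≤-+ {a} b 0≤a = subst (_≤ a + b) (+-identityˡ b) (+-mono-≤ b 0≤a)

  sum-zero : ∀ {a b} → 0# ≤ a → 0# ≤ b → a + b ≡ 0# → a ≡ 0# × b ≡ 0#
  sum-zero {a} {b} 0≤a 0≤b eq = antisym (subst (a ≤_) (trans (+-comm b a) eq) (≤-+ a 0≤b)) 0≤a ,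
                                antisym (subst (b ≤_) eq (≤-+ b 0≤a)) 0≤b

  two≢0 : 1# + 1# ≢ 0#
  two≢0 eq = 0≢1 (antisym 0≤1 (subst (1# ≤_) eq (≤-+ 1# 0≤1)))

  halves : half + half ≡ 1#
  halves = trans (trans (cong₂ _+_ (sym (*-identityˡ half)) (sym (*-identityˡ half))) (sym (distribʳ half 1# 1#)))
                 (inverse (1# + 1#) two≢0)

  half-zero : ∀ {a} → a + a ≡ 0# → a ≡ 0#
  half-zero {a} eq = trans (trans (sym (*-identityˡ a)) (cong (_* a) (sym halves)))
    (trans (regroup half a) (trans (cong (half *_) eq) (zeroʳ half)))
    where
    regroup : ∀ h a → (h + h) * a ≡ h * (a + a)
    regroup = solve 2 (λ h a → (h :+ h) :* a := h :* (a :+ a)) refl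

  square-zero : ∀ {a} → a * a ≡ 0# → ¬ (a ≢ 0#)
  square-zero {a} eq a≢0 = a≢0 (begin
    a                  ≡⟨ sym (*-identityʳ a) ⟩
    a * 1#             ≡⟨ cong (a *_) (sym (inverse a a≢0)) ⟩
    a * (a * a ⁻¹)     ≡⟨ sym (*-assoc a a (a ⁻¹)) ⟩
    a * a * a ⁻¹       ≡⟨ cong (_* a ⁻¹) eq ⟩
    0# * a ⁻¹          ≡⟨ zeroˡ (a ⁻¹) ⟩
    0#                 ∎)

  0≤norm : ∀ {n} (u : Vec Carrier n) → 0# ≤ ⟪ u , u ⟫
  0≤norm []      = reflexive refl
  0≤norm (a ∷ u) = ≤-trans (0≤norm u) (≤-+ ⟪ u , u ⟫ (0≤square a))

  -- Equality on the carrier is not decidable, so definiteness comes doubly negated.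
  norm-zero : ∀ {n} (u : Vec Carrier n) → ⟪ u , u ⟫ ≡ 0# → ¬ ¬ (∀ k → lookup u k ≡ 0#)
  norm-zero []      eq k¬ = k¬ λ ()
  norm-zero (a ∷ u) eq k¬ with sum-zero (0≤square a) (0≤norm u) eq
  ... | aa≡0 , uu≡0 = square-zero aa≡0 λ a≡0 → norm-zero u uu≡0 λ u≡0 → k¬ λ { zero → a≡0 ; (suc k) → u≡0 k }

  lookup-⊖ : ∀ {n} (u w : Vec Carrier n) k → lookup (u ⊖ w) k ≡ lookup u k + - lookup w k
  lookup-⊖ u w k = trans (lookup-zipWith _+_ k u ((- 1#) ⊛ w)) (cong (lookup u k +_) (trans (lookup-map k (- 1# *_) w)
    (trans (sym (-‿distribˡ-* 1# (lookup w k))) (cong -_ (*-identityˡ (lookup w k))))))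

  difference-zero : ∀ {n} (u w : Vec Carrier n) → ⟪ u ⊖ w , u ⊖ w ⟫ ≡ 0# → ¬ ¬ (u ≡ w)
  difference-zero u w eq k¬ = norm-zero (u ⊖ w) eq λ zeros → k¬ (lookup-ext λ k → ring-equal (trans (sym (lookup-⊖ u w k)) (zeros k)))

  -- Applied to both colours of edges, and to the pair g, h with h g⁻¹ = - 2 e_i.
  rectangle : ∀ {n} (y a b c : Vec Carrier n) → (∀ k → lookup y k ≡ lookup a k + - lookup b k + lookup c k) →
              ⟪ y , y ⟫ + ⟪ b , b ⟫ ≡ ⟪ a , a ⟫ + ⟪ c , c ⟫ → ⟪ b ⊖ a , b ⊖ c ⟫ ≡ 0#
  rectangle y a b c y-k norms = half-zero (trans (sym (polarise y a b c y-k)) (ring-difference norms))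
    where
    -- For the parallelogram b, a, y, c the two sums of squared distances from the origin to
    -- opposite corners differ by twice the inner product of the sides at b, wherever the origin
    -- lies.
    polarise : ∀ {n} (y a b c : Vec Carrier n) → (∀ k → lookup y k ≡ lookup a k + - lookup b k + lookup c k) →
               ⟪ y , y ⟫ + ⟪ b , b ⟫ + - (⟪ a , a ⟫ + ⟪ c , c ⟫) ≡ ⟪ b ⊖ a , b ⊖ c ⟫ + ⟪ b ⊖ a , b ⊖ c ⟫
    polarise []      []      []      []      _   = zero-case 0#
      where
      zero-case : ∀ z → z + z + - (z + z) ≡ 0# + 0#
      zero-case z = trans (-‿inverseʳ (z + z)) (sym (+-identityʳ 0#))
    polarise (y ∷ ys) (a ∷ as) (b ∷ bs) (c ∷ cs) y-k = begin
      y * y + Y + (b * b + B) + - (a * a + A + (c * c + C))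
        ≡⟨ cong (λ z → z * z + Y + (b * b + B) + - (a * a + A + (c * c + C))) (y-k zero) ⟩
      (a + - b + c) * (a + - b + c) + Y + (b * b + B) + - (a * a + A + (c * c + C))
        ≡⟨ solve 7 (λ a b c Y A B C → (a :+ :- b :+ c) :* (a :+ :- b :+ c) :+ Y :+ (b :* b :+ B) :+ :- (a :* a :+ A :+ (c :* c :+ C)) :=
             ((b :+ :- a) :* (b :+ :- c) :+ (b :+ :- a) :* (b :+ :- c)) :+ (Y :+ B :+ :- (A :+ C))) refl a b c Y A B C ⟩
      (b + - a) * (b + - c) + (b + - a) * (b + - c) + (Y + B + - (A + C))
        ≡⟨ cong₂ (λ p r → p + p + r) (cong₂ _*_ (minus b a) (minus b c)) (polarise ys as bs cs (λ k → y-k (suc k))) ⟩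
      (b + - 1# * a) * (b + - 1# * c) + (b + - 1# * a) * (b + - 1# * c) + (Z + Z)
        ≡⟨ solve 2 (λ p z → p :+ p :+ (z :+ z) := (p :+ z) :+ (p :+ z)) refl ((b + - 1# * a) * (b + - 1# * c)) Z ⟩
      (b + - 1# * a) * (b + - 1# * c) + Z + ((b + - 1# * a) * (b + - 1# * c) + Z) ∎
      where
      Y = ⟪ ys , ys ⟫
      A = ⟪ as , as ⟫
      B = ⟪ bs , bs ⟫
      C = ⟪ cs , cs ⟫
      Z = ⟪ bs ⊖ as , bs ⊖ cs ⟫
      minus : ∀ b a → b + - a ≡ b + - 1# * a
      minus b a = cong (b +_) (sym (trans (sym (-‿distribˡ-* 1# a)) (cong -_ (*-identityˡ a))))

  -- One weighted sum serves both parts of a realization: f a coordinate gives the entries of π(a),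
  -- f the norm gives Σ a_i |v_i|². Its dependence on the group element is computed once for both.
  combine : ∀ {X : Set} {m} → Zm m → Vec X m → (X → Carrier) → Carrier
  combine a ws f = foldr _ _+_ 0# (zipWith (λ ai w → ι ai * f w) a ws)

  module _ {X : Set} (f : X → Carrier) where
    combine-+v : ∀ {m} (a b : Zm m) (ws : Vec X m) → combine (a +v b) ws f ≡ combine a ws f + combine b ws f
    combine-+v []      []      []       = sym (+-identityʳ 0#)
    combine-+v (a ∷ as) (b ∷ bs) (w ∷ ws) = trans (cong₂ _+_ (cong (_* f w) (ι-+ a b)) (combine-+v as bs ws))
      (solve 5 (λ a b w A B → (a :+ b) :* w :+ (A :+ B) := a :* w :+ A :+ (b :* w :+ B)) refl (ι a) (ι b) (f w) (combine as ws f) (combine bs ws f))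

    combine-·v : ∀ {m} c (a : Zm m) (ws : Vec X m) → combine (c ·v a) ws f ≡ ι c * combine a ws f
    combine-·v c []       []       = sym (zeroʳ (ι c))
    combine-·v c (a ∷ as) (w ∷ ws) = trans (cong₂ _+_ (cong (_* f w) (ι-* c a)) (combine-·v c as ws))
      (solve 4 (λ c a w A → c :* a :* w :+ c :* A := c :* (a :* w :+ A)) refl (ι c) (ι a) (f w) (combine as ws f))

    combine--v : ∀ {m} (a : Zm m) (ws : Vec X m) → combine (-v a) ws f ≡ - combine a ws f
    combine--v []       []       = sym -0#≈0#
    combine--v (a ∷ as) (w ∷ ws) = trans (cong₂ _+_ (cong (_* f w) (ι-neg a)) (combine--v as ws))
      (solve 3 (λ a w A → :- a :* w :+ :- A := :- (a :* w :+ A)) refl (ι a) (f w) (combine as ws f))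

    combine-0v : ∀ {m} (ws : Vec X m) → combine 0v ws f ≡ 0#
    combine-0v []       = refl
    combine-0v (w ∷ ws) = trans (cong₂ _+_ (zeroˡ (f w)) (combine-0v ws)) (+-identityˡ 0#)

    combine-e : ∀ {m} (i : Fin m) (ws : Vec X m) → combine (e i) ws f ≡ f (lookup ws i)
    combine-e zero    (w ∷ ws) = trans (cong₂ _+_ (trans (cong (_* f w) ι-1) (*-identityˡ (f w))) (combine-0v ws)) (+-identityʳ (f w))
    combine-e (suc i) (w ∷ ws) = trans (cong₂ _+_ (zeroˡ (f w)) (combine-e i ws)) (+-identityˡ (f (lookup ws i)))

    combine-black : ∀ {m} i j (g : Zm m) (ws : Vec X m) →
      combine (black-generator i j ⊙ g) ws f ≡ f (lookup ws i) + - f (lookup ws j) + combine g ws f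
    combine-black i j g ws = trans (combine-+v (black-generator i j) (σ (black-generator i j) ·v g) ws)
      (cong₂ _+_ (trans (combine-+v (e i) (-v e j) ws) (cong₂ _+_ (combine-e i ws) (trans (combine--v (e j) ws) (cong -_ (combine-e j ws)))))
                 (trans (combine-·v (σ (black-generator i j)) g ws) (trans (cong (λ s → ι s * combine g ws f) (σ-black-generator i j))
                   (trans (cong (_* combine g ws f) ι-1) (*-identityˡ (combine g ws f))))))

    combine-red : ∀ {m} i j (g : Zm m) (ws : Vec X m) →
      combine (red-generator i j ⊙ g) ws f ≡ - f (lookup ws i) + - f (lookup ws j) + - combine g ws f
    combine-red i j g ws = trans (combine-+v (red-generator i j) (σ (red-generator i j) ·v g) ws)
      (cong₂ _+_ (trans (combine-+v (-v e i) (-v e j) ws) (cong₂ _+_ (trans (combine--v (e i) ws) (cong -_ (combine-e i ws))) (trans (combine--v (e j) ws) (cong -_ (combine-e j ws)))))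
                 (trans (combine-·v (σ (red-generator i j)) g ws) (trans (cong (λ s → ι s * combine g ws f) (σ-red-generator i j))
                   (solve 1 (λ c → con -1ℤ :* c := :- c) refl (combine g ws f)))))

    combine-doubled : ∀ {m} i (g h : Zm m) (ws : Vec X m) → (∀ k → lookup h k ≡ ℤ.- (lookup g k ℤ.+ (1ℤ ℤ.+ 1ℤ) ℤ.* δ i k)) →
      combine h ws f ≡ - (combine g ws f + (f (lookup ws i) + f (lookup ws i)))
    combine-doubled i g h ws eq = begin
      combine h ws f
        ≡⟨ cong (λ z → combine z ws f) (lookup-ext {u = h} {w = -v (g +v (e i +v e i))} coordinates) ⟩
      combine (-v (g +v (e i +v e i))) ws f
        ≡⟨ combine--v (g +v (e i +v e i)) ws ⟩
      - combine (g +v (e i +v e i)) ws f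
        ≡⟨ cong -_ (trans (combine-+v g (e i +v e i) ws) (cong (combine g ws f +_) (trans (combine-+v (e i) (e i) ws) (cong₂ _+_ (combine-e i ws) (combine-e i ws))))) ⟩
      - (combine g ws f + (f (lookup ws i) + f (lookup ws i))) ∎
      where
      twice : ∀ g d → ℤ.- (g ℤ.+ (1ℤ ℤ.+ 1ℤ) ℤ.* d) ≡ ℤ.- (g ℤ.+ (d ℤ.+ d))
      twice = ℤ-Solver.solve-∀
      coordinates : ∀ k → lookup h k ≡ lookup (-v (g +v (e i +v e i))) k
      coordinates k = trans (eq k) (trans (twice (lookup g k) (δ i k)) (sym (trans (lookup--v (g +v (e i +v e i)) k)
        (cong ℤ.-_ (trans (lookup-+v g (e i +v e i) k) (cong (λ z → lookup g k ℤ.+ z)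
          (trans (lookup-+v (e i) (e i) k) (cong₂ ℤ._+_ (lookup-e i k) (lookup-e i k)))))))))

  -- Realizations and right angles.

  module Realized {n m : ℕ} (vs : Vec (Vec Carrier n) m) (x : Vec Carrier n) where
    norm : Vec Carrier n → Carrier
    norm u = ⟪ u , u ⟫

    vtx : Fin m → Vec Carrier n
    vtx = lookup vs

    coord : Fin n → Vec Carrier n → Carrier
    coord k u = lookup u k

    κ : Zm m → Carrier
    κ a = combine a vs norm

    lookup-π : ∀ {m} (ws : Vec (Vec Carrier n) m) a k → lookup (π ws a) k ≡ combine a ws (coord k)
    lookup-π []       []       k = lookup-replicate k 0#
    lookup-π (w ∷ ws) (a ∷ as) k = trans (lookup-zipWith _+_ k (ι a ⊛ w) (π ws as)) (cong₂ _+_ (lookup-map k (ι a *_) w) (lookup-π ws as k))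

    -- The position of the vertex a in the realization of the graph at x.
    point : Zm m → Vec Carrier n
    point a = (ι (σ a) ⊛ x) ⊖ π vs a

    lookup-point : ∀ a k → lookup (point a) k ≡ ι (σ a) * lookup x k + - combine a vs (coord k)
    lookup-point a k = trans (lookup-⊖ (ι (σ a) ⊛ x) (π vs a) k) (cong₂ (λ p q → p + - q) (lookup-map k (ι (σ a) *_) x) (lookup-π vs a k))

    norm-expand : ∀ {n} s (x p : Vec Carrier n) → ⟪ (s ⊛ x) ⊖ p , (s ⊛ x) ⊖ p ⟫ ≡ s * s * ⟪ x , x ⟫ + - (s * ⟪ x , p ⟫ + s * ⟪ x , p ⟫) + ⟪ p , p ⟫
    norm-expand s []      []      = solve 1 (λ s → con 0ℤ := s :* s :* con 0ℤ :+ :- (s :* con 0ℤ :+ s :* con 0ℤ) :+ con 0ℤ) refl s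
    norm-expand s (x ∷ xs) (p ∷ ps) = trans (cong₂ _+_ (cong₂ _*_ (minus (s * x) p) (minus (s * x) p)) (norm-expand s xs ps))
      (solve 6 (λ s x p X Y Z → (s :* x :+ :- p) :* (s :* x :+ :- p) :+ (s :* s :* X :+ :- (s :* Y :+ s :* Y) :+ Z) :=
         s :* s :* (x :* x :+ X) :+ :- (s :* (x :* p :+ Y) :+ s :* (x :* p :+ Y)) :+ (p :* p :+ Z)) refl s x p ⟪ xs , xs ⟫ ⟪ xs , ps ⟫ ⟪ ps , ps ⟫)
      where
      minus : ∀ b a → b + - 1# * a ≡ b + - a
      minus b a = cong (b +_) (trans (sym (-‿distribˡ-* 1# a)) (cong -_ (*-identityˡ a)))

    realized-black : ∀ {a} → η a ≡ 0ℤ → RealizesVertex vs x a → ⟪ x , π vs a ⟫ ≡ ι 1ℤ * (half * (norm (π vs a) + κ a))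
    realized-black {a} black real with η a ℤ.≟ 0ℤ
    ... | yes _ = trans real (cong (λ s → ι s * (half * (norm (π vs a) + κ a))) (σ-black {a = a} black))
    ... | no ¬0 = ⊥-elim (¬0 black)

    realized-red : ∀ {a} → η a ≡ -2ℤ → RealizesVertex vs x a → ⟪ x , x ⟫ + ⟪ x , π vs a ⟫ ≡ ι -1ℤ * (half * (norm (π vs a) + κ a))
    realized-red {a} red real with η a ℤ.≟ 0ℤ
    ... | no _   = trans real (cong (λ s → ι s * (half * (norm (π vs a) + κ a))) (σ-red {a = a} red))
    ... | yes η0 with trans (sym η0) red
    ...   | ()

    halving : ∀ s X P k → s * X + (P + - ((half + half) * (P + k))) ≡ s * X + - k
    halving s X P k = trans (cong (λ z → s * X + (P + - z)) (trans (cong (_* (P + k)) halves) (*-identityˡ (P + k))))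
      (solve 4 (λ s X P k → s :* X :+ (P :+ :- (P :+ k)) := s :* X :+ :- k) refl s X P k)

    -- Completing the square: expanding |σ x - π(a)|² and inserting the vertex equation of either
    -- colour removes both the inner product and |π(a)|². What remains is linear in σ(a) and a, so
    -- it can be followed along edges.
    norm-point : ∀ {a} → InG2 a → RealizesVertex vs x a → norm (point a) ≡ ι (σ a) * norm x + - κ a
    norm-point {a} (inj₁ black) real = trans (norm-expand (ι (σ a)) x (π vs a)) (trans
      (cong₂ (λ s xp → ι s * ι s * norm x + - (ι s * xp + ι s * xp) + norm (π vs a)) σa
             (realized-black {a} black real))
      (trans (solve 4 (λ X P h Z → con 1ℤ :* con 1ℤ :* X :+ :- (con 1ℤ :* (con 1ℤ :* (h :* Z)) :+ con 1ℤ :* (con 1ℤ :* (h :* Z))) :+ P :=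
                con 1ℤ :* X :+ (P :+ :- ((h :+ h) :* Z))) refl (norm x) (norm (π vs a)) half (norm (π vs a) + κ a))
      (trans (halving (ι 1ℤ) (norm x) (norm (π vs a)) (κ a)) (cong (λ s → ι s * norm x + - κ a) (sym σa)))))
      where
      σa : σ a ≡ 1ℤ
      σa = σ-black {a = a} black
    norm-point {a} (inj₂ red) real = trans (norm-expand (ι (σ a)) x (π vs a)) (trans
      (cong₂ (λ s xp → ι s * ι s * norm x + - (ι s * xp + ι s * xp) + norm (π vs a)) σa
             (trans (isolate (norm x) ⟪ x , π vs a ⟫) (cong (_+ - norm x) (realized-red {a} red real))))
      (trans (solve 4 (λ X P h Z → con -1ℤ :* con -1ℤ :* X :+ :- (con -1ℤ :* (con -1ℤ :* (h :* Z) :+ :- X) :+ con -1ℤ :* (con -1ℤ :* (h :* Z) :+ :- X)) :+ P :=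
                con -1ℤ :* X :+ (P :+ :- ((h :+ h) :* Z))) refl (norm x) (norm (π vs a)) half (norm (π vs a) + κ a))
      (trans (halving (ι -1ℤ) (norm x) (norm (π vs a)) (κ a)) (cong (λ s → ι s * norm x + - κ a) (sym σa)))))
      where
      σa : σ a ≡ -1ℤ
      σa = σ-red {a = a} red
      isolate : ∀ X Y → Y ≡ X + Y + - X
      isolate = solve 2 (λ X Y → Y := X :+ Y :+ :- X) refl

    -- y, y′, v_i, v_j form a rectangle in which a black edge joins y and y′ by a
    -- side and a red one by a diagonal.
    data Neighbours (y y′ : Vec Carrier n) : Set where
      parallel  : ∀ {i j} → i ≢ j → (∀ k → lookup y′ k ≡ lookup y k + - lookup (vtx i) k + lookup (vtx j) k) →
                  norm y′ + norm (vtx i) ≡ norm y + norm (vtx j) → Neighbours y y′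
      antipodal : ∀ {i j} → i ≢ j → (∀ k → lookup y′ k ≡ lookup (vtx i) k + - lookup y k + lookup (vtx j) k) →
                  norm y′ + norm y ≡ norm (vtx i) + norm (vtx j) → Neighbours y y′

    neighbours-sym : ∀ {y y′} → Neighbours y y′ → Neighbours y′ y
    neighbours-sym {y} {y′} (parallel {i} {j} i≢j eq norms) = parallel (λ j≡i → i≢j (sym j≡i))
      (λ k → trans (back (lookup y k) (lookup (vtx i) k) (lookup (vtx j) k)) (cong (λ z → z + - lookup (vtx j) k + lookup (vtx i) k) (sym (eq k)))) (sym norms)
      where
      back : ∀ y a b → y ≡ y + - a + b + - b + a
      back = solve 3 (λ y a b → y := y :+ :- a :+ b :+ :- b :+ a) refl
    neighbours-sym {y} {y′} (antipodal {i} {j} i≢j eq norms) = antipodal i≢j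
      (λ k → trans (back (lookup y k) (lookup (vtx i) k) (lookup (vtx j) k)) (cong (λ z → lookup (vtx i) k + - z + lookup (vtx j) k) (sym (eq k))))
      (trans (+-comm (norm y) (norm y′)) norms)
      where
      back : ∀ y a b → y ≡ a + - (a + - y + b) + b
      back = solve 3 (λ y a b → y := a :+ :- (a :+ :- y :+ b) :+ b) refl

    Special : Vec Carrier n → Set
    Special y = ∃[ i ] y ≡ vtx i

    -- Three corners of the rectangle are now among the v's, and genericity forbids a right angle at
    -- three distinct indices. So t is one of i and j, and the fourth corner is again some v.
    special-step : Generic2 vs → ∀ {y y′} → Special y → Neighbours y y′ → ¬ ¬ Special y′
    special-step generic {y′ = y′} (t , refl) (parallel {i} {j} i≢j eq norms) k¬ = decide (t Fin.≟ i) (t Fin.≟ j)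
      where
      right-angle : ⟪ vtx i ⊖ vtx t , vtx i ⊖ vtx j ⟫ ≡ 0#
      right-angle = rectangle y′ (vtx t) (vtx i) (vtx j) eq norms
      cancel : ∀ a b → a + - a + b ≡ b
      cancel = solve 2 (λ a b → a :+ :- a :+ b := b) refl
      at-j : vtx t ≡ vtx i → ⊥
      at-j vt≡vi = k¬ (j , lookup-ext λ k → trans (eq k) (trans (cong (λ z → lookup z k + - lookup (vtx i) k + lookup (vtx j) k) vt≡vi) (cancel (lookup (vtx i) k) (lookup (vtx j) k))))
      decide : Dec (t ≡ i) → Dec (t ≡ j) → ⊥
      decide (yes refl) _          = at-j refl
      -- For t = j the right angle is between v_i - v_j and itself. Hence v_i = v_j and y′ is v_j
      -- once more.
      decide (no _)     (yes refl) = difference-zero (vtx i) (vtx j) right-angle λ vi≡vj → at-j (sym vi≡vj)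
      decide (no t≢i)   (no t≢j)   = generic i t j (λ i≡t → t≢i (sym i≡t)) i≢j t≢j right-angle
    special-step generic {y′ = y′} (t , refl) (antipodal {i} {j} i≢j eq norms) k¬ = decide (t Fin.≟ i) (t Fin.≟ j)
      where
      right-angle : ⟪ vtx t ⊖ vtx i , vtx t ⊖ vtx j ⟫ ≡ 0#
      right-angle = rectangle y′ (vtx i) (vtx t) (vtx j) eq norms
      cancel : ∀ a b → a + - a + b ≡ b
      cancel = solve 2 (λ a b → a :+ :- a :+ b := b) refl
      cancel′ : ∀ a b → a + - b + b ≡ a
      cancel′ = solve 2 (λ a b → a :+ :- b :+ b := a) refl
      decide : Dec (t ≡ i) → Dec (t ≡ j) → ⊥
      decide (yes refl) _          = k¬ (j , lookup-ext λ k → trans (eq k) (cancel (lookup (vtx i) k) (lookup (vtx j) k)))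
      decide (no _)     (yes refl) = k¬ (i , lookup-ext λ k → trans (eq k) (cancel′ (lookup (vtx i) k) (lookup (vtx j) k)))
      decide (no t≢i)   (no t≢j)   = generic t i j t≢i t≢j i≢j right-angle

    -- Positions and squared norms have the same form σ(a) · + minus a weighted sum, by
    -- `lookup-point` and `norm-point`, so the same `combine` identity gives both conditions.
    edge-neighbours : ∀ {g h} → InG2 g → InG2 h → RealizesVertex vs x g → RealizesVertex vs x h → Edge g h → Neighbours (point g) (point h)
    edge-neighbours {g} {h} g∈G h∈G real-g real-h (_ , (i , j , i≢j , inj₁ refl) , refl) = parallel i≢j
      (λ k → trans (lookup-point h k) (trans (cong₂ (λ s c → ι s * lookup x k + - c) σ-h (combine-black (coord k) i j g vs))
        (trans (shift (ι (σ g)) (lookup x k) (lookup (vtx i) k) (lookup (vtx j) k) (combine g vs (coord k)))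
               (cong (λ z → z + - lookup (vtx i) k + lookup (vtx j) k) (sym (lookup-point g k))))))
      (trans (cong (_+ norm (vtx i)) (trans (norm-point {h} h∈G real-h) (cong₂ (λ s c → ι s * norm x + - c) σ-h (combine-black norm i j g vs))))
        (trans (balance (ι (σ g)) (norm x) (norm (vtx i)) (norm (vtx j)) (κ g)) (cong (_+ norm (vtx j)) (sym (norm-point {g} g∈G real-g)))))
      where
      σ-h : σ h ≡ σ g
      σ-h = σ-black-edge i j {g} g∈G
      shift : ∀ s x a b c → s * x + - (a + - b + c) ≡ s * x + - c + - a + b
      shift = solve 5 (λ s x a b c → s :* x :+ :- (a :+ :- b :+ c) := s :* x :+ :- c :+ :- a :+ b) refl
      balance : ∀ s x a b c → s * x + - (a + - b + c) + a ≡ s * x + - c + b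
      balance = solve 5 (λ s x a b c → s :* x :+ :- (a :+ :- b :+ c) :+ a := s :* x :+ :- c :+ b) refl
    edge-neighbours {g} {h} g∈G h∈G real-g real-h (_ , (i , j , i≢j , inj₂ refl) , refl) = antipodal i≢j
      (λ k → trans (lookup-point h k) (trans (cong₂ (λ s c → s * lookup x k + - c) σ-h (combine-red (coord k) i j g vs))
        (trans (shift (ι (σ g)) (lookup x k) (lookup (vtx i) k) (lookup (vtx j) k) (combine g vs (coord k)))
               (cong (λ z → lookup (vtx i) k + - z + lookup (vtx j) k) (sym (lookup-point g k))))))
      (trans (cong₂ _+_ (trans (norm-point {h} h∈G real-h) (cong₂ (λ s c → s * norm x + - c) σ-h (combine-red norm i j g vs))) (norm-point {g} g∈G real-g))
        (balance (ι (σ g)) (norm x) (norm (vtx i)) (norm (vtx j)) (κ g)))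
      where
      σ-h : ι (σ h) ≡ - ι (σ g)
      σ-h = trans (cong ι (σ-red-edge i j {g} g∈G)) (ι-neg (σ g))
      shift : ∀ s x a b c → - s * x + - (- a + - b + - c) ≡ a + - (s * x + - c) + b
      shift = solve 5 (λ s x a b c → :- s :* x :+ :- (:- a :+ :- b :+ :- c) := a :+ :- (s :* x :+ :- c) :+ b) refl
      balance : ∀ s x a b c → - s * x + - (- a + - b + - c) + (s * x + - c) ≡ a + b
      balance = solve 5 (λ s x a b c → :- s :* x :+ :- (:- a :+ :- b :+ :- c) :+ (s :* x :+ :- c) := a :+ b) refl

    -- A rectangle with two opposite corners at v_i: its right angle at `point g` is between
    -- `point g` - v_i and itself, so this vector has norm zero.
    forbidden-special : ∀ {g h i} → η g ≡ 0ℤ → η h ≡ -2ℤ → RealizesVertex vs x g → RealizesVertex vs x h →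
      (∀ k → lookup h k ≡ ℤ.- (lookup g k ℤ.+ (1ℤ ℤ.+ 1ℤ) ℤ.* δ i k)) → ¬ ¬ Special (point g)
    forbidden-special {g} {h} {i} black red real-g real-h eq k¬ = difference-zero (point g) (vtx i)
      (rectangle (point h) (vtx i) (point g) (vtx i)
        (λ k → trans (lookup-point h k) (trans (cong₂ (λ s c → ι s * lookup x k + - c) σ-h (combine-doubled (coord k) i g h vs eq))
          (trans (shift (lookup x k) (lookup (vtx i) k) (combine g vs (coord k)))
                 (cong (λ z → lookup (vtx i) k + - z + lookup (vtx i) k) (sym (trans (lookup-point g k) (cong (λ s → ι s * lookup x k + - combine g vs (coord k)) σ-g)))))))
        (trans (cong₂ _+_ (trans (norm-point {h} (inj₂ red) real-h) (cong₂ (λ s c → ι s * norm x + - c) σ-h (combine-doubled norm i g h vs eq)))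
                          (trans (norm-point {g} (inj₁ black) real-g) (cong (λ s → ι s * norm x + - κ g) σ-g)))
          (balance (norm x) (norm (vtx i)) (κ g))))
      (λ y≡v → k¬ (i , y≡v))
      where
      σ-g : σ g ≡ 1ℤ
      σ-g = σ-black {a = g} black
      σ-h : σ h ≡ -1ℤ
      σ-h = σ-red {a = h} red
      shift : ∀ x a c → ι -1ℤ * x + - (- (c + (a + a))) ≡ a + - (ι 1ℤ * x + - c) + a
      shift = solve 3 (λ x a c → con -1ℤ :* x :+ :- (:- (c :+ (a :+ a))) := a :+ :- (con 1ℤ :* x :+ :- c) :+ a) refl
      balance : ∀ x a c → ι -1ℤ * x + - (- (c + (a + a))) + (ι 1ℤ * x + - c) ≡ a + a
      balance = solve 3 (λ x a c → con -1ℤ :* x :+ :- (:- (c :+ (a :+ a))) :+ (con 1ℤ :* x :+ :- c) := a :+ a) refl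

    point-0v : point 0v ≡ x
    point-0v = lookup-ext λ k → trans (lookup-point o k) (trans (cong₂ (λ s c → ι s * lookup x k + - c) (σ-black {a = o} (η-0v {m})) (combine-0v (coord k) vs))
      (solve 1 (λ x → con 1ℤ :* x :+ :- con 0ℤ := x) refl (lookup x k)))
      where
      o : Zm m
      o = 0v
      η-0v : ∀ {m} → η (0v {m}) ≡ 0ℤ
      η-0v {zero}  = refl
      η-0v {suc m} = cong (λ z → 0ℤ ℤ.+ z) (η-0v {m})

    module _ {A : List (Zm m)} (graph : CombGraph A) (generic : Generic2 vs) (realization : Realization vs A x) where
      -- The path from 0 to h is followed backwards; the position of 0 is x itself.
      special-root : ∀ {h} → Reach A h → ¬ ¬ Special (point h) → ¬ ¬ Special (point 0v)
      special-root Reach.here special = special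
      special-root (Reach.step {g} {h} reach h∈A adjacent) special = special-root reach
        λ k¬ → special λ s → special-step generic s (neighbours-sym (neighbours adjacent)) k¬
        where
        g∈A : g ∈ A
        g∈A = reach-∈ graph reach
        neighbours : Adjacent g h → Neighbours (point g) (point h)
        neighbours (inj₁ edge) = edge-neighbours {g} {h} (in-G₂ graph g∈A) (in-G₂ graph h∈A) (realization g∈A) (realization h∈A) edge
        neighbours (inj₂ edge) = neighbours-sym (edge-neighbours {h} {g} (in-G₂ graph h∈A) (in-G₂ graph g∈A) (realization h∈A) (realization g∈A) edge)

      no-realization : ForbiddenPair graph → (∀ i → x ≢ lookup vs i) → ⊥
      no-realization (g , h , i , g∈A , h∈A , black , red , eq) x≢v =
        special-root (CombGraph.connected graph g∈A) (forbidden-special {g} {h} {i} black red (realization g∈A) (realization h∈A) eq)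
          λ { (t , y≡v) → x≢v t (trans (sym point-0v) y≡v) }

mainTheorem2 : ∀ {m : ℕ} (A : List (Zm m)) → CombGraph A → DegenerateResonant A →
    (∃[ g ] (g ∈ A × ¬ Allowable (translate A g)))
    × (∀ (R : RealField) (n : ℕ) (vs : Vec (Vec (RealField.Carrier R) n) m) →
    RealOps.Generic1 R vs → RealOps.Generic2 R vs →
    ∀ (x : Vec (RealField.Carrier R) n) →
    (∀ i → x ≢ lookup vs i) → ¬ RealOps.Realization R vs A x)
mainTheorem2 A graph resonant = forbidden-translate graph pair ,
  λ R n vs _ generic x x≢v realization → Field.Realized.no-realization R vs x graph generic realization pair x≢v
  where
  pair : ForbiddenPair graph
  pair = forbidden-pair graph resonant
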